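{- For infinitely many odd prime powers $q$, the CAP bound for $\Gamma_{q^- }$ is strictly smaller than the Delsarte bound for $\Gamma_{q^- }$.
   Context: Let $q$ be an odd prime power, $\mathcal{O}$ a non-degenerate conic in the Desarguesian projective plane $\mathrm{PG}(2,q)$, and $\perp$ the polarity induced by $\mathcal{O}$. A line is external if it meets $\mathcal{O}$ in no point. The graph $\Gamma_{q^- }$ has as vertices the external lines of $\mathcal{O}$, with two distinct external lines $a,b$ adjacent if and only if they are polar conjugates with respect to $\perp$, i.e. the pole $a^\perp$ lies on $b$ (equivalently $b^\perp$ lies on $a$). It is an orbital graph (a single relation of the Schurian association scheme) of the action of $\mathrm{PGL}(2,q)\le\mathrm{PGL}(3,q)$, the stabiliser of $\mathcal{O}$, on external lines; it is edge-regular, with $v=q(q-1)/2$ vertices and valency $k=(q+1)/2$. A graph is $(v,k,\lambda)$ edge-regular if it has $v$ vertices, every vertex has degree $k$, and every two adjacent vertices have exactly $\lambda$ common neighbours. For such a graph $\Gamma$ the clique adjacency polynomial is $$\mathrm{CA}_\Gamma(x,s):=x(x+1)(v-s)-2xs(k-s+1)+s(s-1)(\lambda-s+2).$$ If $\mathrm{CA}_\Gamma(x,s)<0$ for some integer $x$, then $\Gamma$ has no $s$-clique; the CAP bound for $\Gamma$ is the least value of $s-1$ over all integers $s\ge2$ for which there is an integer $x$ with $\mathrm{CA}_\Gamma(x,s)<0$. The Delsarte bound for a graph $\Gamma$ that is a single relation of an association scheme is the real number $1-k/\gamma_v$, where $k$ is the valency and $\gamma_v$ the minimum eigenvalue of the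 adjacency matrix of $\Gamma$. -}

module Defs where

open import Level using (0ℓ)
open import Algebra.Bundles using (CommutativeRing)
import Algebra.Properties.Monoid.Mult as MonoidMult
import Algebra.Properties.CommutativeMonoid.Sum as MonoidSum
import Algebra.Properties.Ring as RingProperties
import Algebra.Solver.Ring.NaturalCoefficients.Default as RingSolver
open import Data.Fin.Base using (Fin)
import Data.Integer.Base as Int
open Int using (ℤ; +_)
open import Data.Nat.Base as ℕ using (ℕ; suc)
open import Data.Nat.Divisibility using (_∣_)
open import Data.Nat.Primality using (Prime)
open import Data.Product.Base using (Σ; ∃; ∃-syntax; _×_; _,_; proj₁; proj₂)
open import Data.Sum.Base using (_⊎_)
open import Data.Vec.Functional using (Vector)
open import Function.Bundles using (Inverse)
open import Relation.Binary.Bundles using (Setoid)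
open import Relation.Binary.Core using (Rel)
open import Relation.Binary.Definitions
  using (Symmetric; Irreflexive; _Respects₂_)
import Relation.Binary.Construct.On as On
open import Relation.Binary.PropositionalEquality.Core using (_≡_)
import Relation.Binary.PropositionalEquality.Properties as ≡
import Relation.Binary.Reasoning.Setoid as SetoidReasoning
open import Relation.Binary.Structures using (IsStrictTotalOrder)
open import Relation.Nullary.Negation.Core using (¬_)

------------------------------------------------------------------------
-- Cardinality of (sub)setoids

HasSize : Setoid 0ℓ 0ℓ → ℕ → Set
HasSize S n = Inverse (≡.setoid (Fin n)) S

SubSetoid : (S : Setoid 0ℓ 0ℓ) → (Setoid.Carrier S → Set) → Setoid 0ℓ 0ℓ
SubSetoid S P = On.setoid {B = Σ (Setoid.Carrier S) P} S proj₁

OddPrimePower : ℕ → Set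
OddPrimePower q = ¬ (2 ∣ q) × (∃[ p ] ∃[ n ] Prime p × q ≡ p ℕ.^ suc n)

------------------------------------------------------------------------
-- Fields and the real numbers

record Field : Set₁ where
  field
    commutativeRing : CommutativeRing 0ℓ 0ℓ
  open CommutativeRing commutativeRing public
  field
    1≉0      : ¬ (1# ≈ 0#)
    inv      : ∀ x → ¬ (x ≈ 0#) → Carrier
    inverseʳ : ∀ x (x≉0 : ¬ (x ≈ 0#)) → x * inv x x≉0 ≈ 1#

-- The real numbers, given by the axioms that determine them up to unique
-- isomorphism: a totally ordered field in which every non-empty set that is
-- bounded above has a least upper bound.

record CompleteOrderedField : Set₁ where
  infix 4 _<_ _≤_
  field
    isField : Field
  open Field isField public
  field
    _<_                : Rel Carrier 0ℓ
    isStrictTotalOrder : IsStrictTotalOrder _≈_ _<_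
    +-monoˡ-<          : ∀ {x y} z → x < y → x + z < y + z
    *-pos              : ∀ {x y} → 0# < x → 0# < y → 0# < x * y

  _≤_ : Rel Carrier 0ℓ
  x ≤ y = x < y ⊎ x ≈ y

  IsUpperBound : (Carrier → Set) → Carrier → Set
  IsUpperBound P b = ∀ x → P x → x ≤ b

  field
    lub : ∀ (P : Carrier → Set) → ∃ P → ∃ (IsUpperBound P) →
          ∃[ s ] IsUpperBound P s × (∀ b → IsUpperBound P b → s ≤ b)

  open MonoidSum +-commutativeMonoid public using (sum)

  fromℕ : ℕ → Carrier
  fromℕ n = n ·1 1#
    where open MonoidMult +-monoid renaming (_×_ to _·1_)

------------------------------------------------------------------------
-- Graphs

record Graph : Set₁ where
  field
    vertices : Setoid 0ℓ 0ℓ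
  open Setoid vertices public using (_≈_) renaming (Carrier to Vertex)
  field
    Adj    : Rel Vertex 0ℓ
    irrefl : Irreflexive _≈_ Adj
    symm   : Symmetric Adj
    resp   : Adj Respects₂ _≈_

module _ (Γ : Graph) where
  open Graph Γ

  Regular : ℕ → Set
  Regular k = ∀ a → HasSize (SubSetoid vertices (Adj a)) k

  record EdgeRegular (v k λ′ : ℕ) : Set where
    field
      order           : HasSize vertices v
      regular         : Regular k
      commonNeighbors : ∀ a b → Adj a b →
        HasSize (SubSetoid vertices (λ c → Adj a c × Adj b c)) λ′

------------------------------------------------------------------------
-- The clique adjacency polynomial and the CAP bound

CA : (v k λ′ : ℤ) → (x s : ℤ) → ℤ
CA v k λ′ x s =
  x * (x + 1ℤ) * (v - s) - + 2 * x * s * (k - s + 1ℤ) + s * (s - 1ℤ) * (λ′ - s + + 2)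
  where open Int using (_+_; _*_; _-_; 1ℤ)

CAPNegative : (v k λ′ s : ℕ) → Set
CAPNegative v k λ′ s = ∃[ x ] CA (+ v) (+ k) (+ λ′) x (+ s) Int.< + 0

IsCAPBound : Graph → ℕ → Set
IsCAPBound Γ c =
  ∃[ v ] ∃[ k ] ∃[ λ′ ] EdgeRegular Γ v k λ′ ×
  (∃[ s ] 2 ℕ.≤ s × CAPNegative v k λ′ s × c ≡ s ℕ.∸ 1 ×
          (∀ t → 2 ℕ.≤ t → CAPNegative v k λ′ t → s ℕ.≤ t))

------------------------------------------------------------------------
-- Adjacency eigenvalues and the Delsarte bound

module _ (ℝ : CompleteOrderedField) where
  open CompleteOrderedField ℝ

  Matrix : ℕ → Set
  Matrix n = Fin n → Fin n → Carrier

  IsEigenvalue : ∀ {n} → Matrix n → Carrier → Set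
  IsEigenvalue {n} A μ =
    Σ (Vector Carrier n) λ x →
      ¬ (∀ i → x i ≈ 0#) × (∀ i → sum (λ j → A i j * x j) ≈ μ * x i)

  IsMinEigenvalue : ∀ {n} → Matrix n → Carrier → Set
  IsMinEigenvalue A γ = IsEigenvalue A γ × (∀ μ → IsEigenvalue A μ → γ ≤ μ)

  IsAdjacencyMatrix : (Γ : Graph) {n : ℕ} → HasSize (Graph.vertices Γ) n → Matrix n → Set
  IsAdjacencyMatrix Γ e A = ∀ i j →
    (Adj (to i) (to j) × A i j ≈ 1#) ⊎ (¬ Adj (to i) (to j) × A i j ≈ 0#)
    where
    open Graph Γ using (Adj)
    open Inverse e using (to)

  -- 1 - k / γ.  The eigenvalues do not depend on the enumeration e.

  IsDelsarteBound : Graph → Carrier → Set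
  IsDelsarteBound Γ d =
    ∃[ k ] Regular Γ k ×
    (∃[ n ] Σ (HasSize (Graph.vertices Γ) n) λ e → Σ (Matrix n) λ A → IsAdjacencyMatrix Γ e A ×
    (∃[ γ ] IsMinEigenvalue A γ ×
    (Σ (¬ (γ ≈ 0#)) λ γ≉0 → d ≈ 1# - fromℕ k * inv γ γ≉0)))

------------------------------------------------------------------------
-- The projective plane over a field, its conics, and the graph on the
-- external lines of a conic

module Plane (F : Field) where
  open Field F
  open RingProperties ring using (-1*x≈-x)
  open SetoidReasoning setoid

  record Triple : Set where
    constructor ⟨_,_,_⟩
    field
      x₀ x₁ x₂ : Carrier
  open Triple public

  infixl 7 _∙_ _*ₗ_
  infix 4 _≋_

  _∙_ : Triple → Triple → Carrier
  u ∙ w = x₀ u * x₀ w + x₁ u * x₁ w + x₂ u * x₂ w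

  _*ₗ_ : Carrier → Triple → Triple
  t *ₗ u = ⟨ t * x₀ u , t * x₁ u , t * x₂ u ⟩

  _≋_ : Triple → Triple → Set
  u ≋ w = x₀ u ≈ x₀ w × x₁ u ≈ x₁ w × x₂ u ≈ x₂ w

  IsZero : Triple → Set
  IsZero u = x₀ u ≈ 0# × x₁ u ≈ 0# × x₂ u ≈ 0#

  ≋-refl : ∀ {u} → u ≋ u
  ≋-refl = refl , refl , refl

  ∙-cong : ∀ {u u′ w w′} → u ≋ u′ → w ≋ w′ → u ∙ w ≈ u′ ∙ w′
  ∙-cong (p₀ , p₁ , p₂) (r₀ , r₁ , r₂) =
    +-cong (+-cong (*-cong p₀ r₀) (*-cong p₁ r₁)) (*-cong p₂ r₂)

  ∙-*ₗ : ∀ u t w → u ∙ (t *ₗ w) ≈ t * (u ∙ w)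
  ∙-*ₗ ⟨ a , b , c ⟩ t ⟨ x , y , z ⟩ = solve 7 (λ a b c t x y z →
      a :* (t :* x) :+ b :* (t :* y) :+ c :* (t :* z)
      := t :* (a :* x :+ b :* y :+ c :* z)) refl a b c t x y z
    where open RingSolver commutativeSemiring

  ∙-comm : ∀ u w → u ∙ w ≈ w ∙ u
  ∙-comm u w = +-cong (+-cong (*-comm _ _) (*-comm _ _)) (*-comm _ _)

  *-cancel-0 : ∀ {t x} → ¬ (t ≈ 0#) → t * x ≈ 0# → x ≈ 0#
  *-cancel-0 {t} {x} t≉0 tx≈0 = begin
    x                     ≈⟨ *-identityˡ x ⟨
    1# * x                ≈⟨ *-congʳ (inverseʳ t t≉0) ⟨
    (t * inv t t≉0) * x   ≈⟨ *-congʳ (*-comm t _) ⟩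
    (inv t t≉0 * t) * x   ≈⟨ *-assoc _ t x ⟩
    inv t t≉0 * (t * x)   ≈⟨ *-congˡ tx≈0 ⟩
    inv t t≉0 * 0#        ≈⟨ zeroʳ _ ⟩
    0#                    ∎

  inv≉0 : ∀ {t} (t≉0 : ¬ (t ≈ 0#)) → ¬ (inv t t≉0 ≈ 0#)
  inv≉0 {t} t≉0 i≈0 = 1≉0 (trans (sym (inverseʳ t t≉0)) (trans (*-congˡ i≈0) (zeroʳ t)))

  -- Homogeneous coordinates: non-zero triples up to a non-zero scalar.  Both
  -- points and lines are given this way; the line with coordinates l consists
  -- of the points P with l ∙ P ≈ 0.

  Homogeneous : Set
  Homogeneous = Σ Triple λ u → ¬ IsZero u

  _∼_ : Rel Homogeneous 0ℓ
  (u , _) ∼ (w , _) = ∃[ t ] ¬ (t ≈ 0#) × u ≋ t *ₗ w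

  homogeneous : Setoid 0ℓ 0ℓ
  homogeneous = record
    { Carrier       = Homogeneous
    ; _≈_           = _∼_
    ; isEquivalence = record
      { refl  = λ {u} → ∼-refl {u}
      ; sym   = λ {u} {v} → ∼-sym {u} {v}
      ; trans = λ {u} {v} {w} → ∼-trans {u} {v} {w}
      }
    }
    where
    ∼-refl : ∀ {u} → u ∼ u
    ∼-refl = 1# , 1≉0 , sym (*-identityˡ _) , sym (*-identityˡ _) , sym (*-identityˡ _)

    ∼-sym : ∀ {u w} → u ∼ w → w ∼ u
    ∼-sym {u} {w} (t , t≉0 , p₀ , p₁ , p₂) =
      inv t t≉0 , inv≉0 t≉0 , flip p₀ , flip p₁ , flip p₂
      where
      flip : ∀ {x y} → x ≈ t * y → y ≈ inv t t≉0 * x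
      flip {x} {y} p = begin
        y                     ≈⟨ *-identityˡ y ⟨
        1# * y                ≈⟨ *-congʳ (inverseʳ t t≉0) ⟨
        (t * inv t t≉0) * y   ≈⟨ *-congʳ (*-comm t _) ⟩
        (inv t t≉0 * t) * y   ≈⟨ *-assoc _ t y ⟩
        inv t t≉0 * (t * y)   ≈⟨ *-congˡ p ⟨
        inv t t≉0 * x         ∎

    ∼-trans : ∀ {u v w} → u ∼ v → v ∼ w → u ∼ w
    ∼-trans (s , s≉0 , p₀ , p₁ , p₂) (t , t≉0 , r₀ , r₁ , r₂) =
      s * t , (λ st≈0 → t≉0 (*-cancel-0 s≉0 st≈0)) , comp p₀ r₀ , comp p₁ r₁ , comp p₂ r₂
      where
      comp : ∀ {x y z} → x ≈ s * y → y ≈ t * z → x ≈ s * t * z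
      comp p r = trans p (trans (*-congˡ r) (sym (*-assoc s t _)))

  Point Line : Set
  Point = Homogeneous
  Line  = Homogeneous

  infix 4 _on_
  _on_ : Point → Line → Set
  (P , _) on (l , _) = l ∙ P ≈ 0#

  -- Rows of the identity  M adj(M) u = det(M) u,  with m in place of -1: the
  -- solver works over semirings, so the terms that cancel are collected as a
  -- multiple of 1 + m.

  module AdjugateIdentity (a b c f g h m x y z : Carrier) where
    open RingSolver commutativeSemiring

    sub : Carrier → Carrier → Carrier
    sub s t = s + m * t

    B₀ B₁ B₂ Bu : Triple
    B₀ = ⟨ sub (b * c) (f * f) , sub (f * g) (c * h) , sub (h * f) (b * g) ⟩
    B₁ = ⟨ sub (f * g) (c * h) , sub (a * c) (g * g) , sub (g * h) (a * f) ⟩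
    B₂ = ⟨ sub (h * f) (b * g) , sub (g * h) (a * f) , sub (a * b) (h * h) ⟩
    Bu = ⟨ B₀ ∙ ⟨ x , y , z ⟩ , B₁ ∙ ⟨ x , y , z ⟩ , B₂ ∙ ⟨ x , y , z ⟩ ⟩

    W₀ W₁ W₂ : Carrier
    W₀ = (a * f * g + h * a * c + h * g * g) * y + (a * h * f + h * g * h + a * b * g) * z
    W₁ = (h * b * c + b * f * g + f * f * h) * x + (h * h * f + b * g * h + f * a * b) * z
    W₂ = (g * b * c + f * f * g + c * h * f) * x + (g * f * g + f * a * c + c * g * h) * y

    module Expr {n} (a b c f g h m x y z : Polynomial n) where
      X Y Z D : Polynomial n
      X = (b :* c :+ m :* (f :* f)) :* x :+ (f :* g :+ m :* (c :* h)) :* y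
          :+ (h :* f :+ m :* (b :* g)) :* z
      Y = (f :* g :+ m :* (c :* h)) :* x :+ (a :* c :+ m :* (g :* g)) :* y
          :+ (g :* h :+ m :* (a :* f)) :* z
      Z = (h :* f :+ m :* (b :* g)) :* x :+ (g :* h :+ m :* (a :* f)) :* y
          :+ (a :* b :+ m :* (h :* h)) :* z
      D = a :* (b :* c :+ m :* (f :* f)) :+ h :* (f :* g :+ m :* (c :* h))
          :+ g :* (h :* f :+ m :* (b :* g))

    row₀ : ⟨ a , h , g ⟩ ∙ Bu ≈ (⟨ a , h , g ⟩ ∙ B₀) * x + (1# + m) * W₀
    row₀ = solve 10 (λ a b c f g h m x y z → let open Expr a b c f g h m x y z in
        a :* X :+ h :* Y :+ g :* Z := D :* x :+ (con 1 :+ m) :*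
        ((a :* f :* g :+ h :* a :* c :+ h :* g :* g) :* y
         :+ (a :* h :* f :+ h :* g :* h :+ a :* b :* g) :* z))
      refl a b c f g h m x y z

    row₁ : ⟨ h , b , f ⟩ ∙ Bu ≈ (⟨ a , h , g ⟩ ∙ B₀) * y + (1# + m) * W₁
    row₁ = solve 10 (λ a b c f g h m x y z → let open Expr a b c f g h m x y z in
        h :* X :+ b :* Y :+ f :* Z := D :* y :+ (con 1 :+ m) :*
        ((h :* b :* c :+ b :* f :* g :+ f :* f :* h) :* x
         :+ (h :* h :* f :+ b :* g :* h :+ f :* a :* b) :* z))
      refl a b c f g h m x y z

    row₂ : ⟨ g , f , c ⟩ ∙ Bu ≈ (⟨ a , h , g ⟩ ∙ B₀) * z + (1# + m) * W₂
    row₂ = solve 10 (λ a b c f g h m x y z → let open Expr a b c f g h m x y z in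
        g :* X :+ f :* Y :+ c :* Z := D :* z :+ (con 1 :+ m) :*
        ((g :* b :* c :+ f :* f :* g :+ c :* h :* f) :* x
         :+ (g :* f :* g :+ f :* a :* c :+ c :* g :* h) :* y))
      refl a b c f g h m x y z

  -- A conic is the zero set of a non-degenerate quadratic form
  --   a x² + b y² + c z² + 2 f y z + 2 g z x + 2 h x y.
  -- In odd characteristic every ternary quadratic form has this shape, and it
  -- is non-degenerate exactly when its symmetric matrix, with rows M₀ M₁ M₂,
  -- is invertible.  The triples A₀ A₁ A₂ are the rows of the adjugate.

  record QuadraticForm : Set where
    field
      a b c f g h : Carrier

    M₀ M₁ M₂ : Triple
    M₀ = ⟨ a , h , g ⟩
    M₁ = ⟨ h , b , f ⟩
    M₂ = ⟨ g , f , c ⟩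

    A₀ A₁ A₂ : Triple
    A₀ = ⟨ b * c - f * f , f * g - c * h , h * f - b * g ⟩
    A₁ = ⟨ f * g - c * h , a * c - g * g , g * h - a * f ⟩
    A₂ = ⟨ h * f - b * g , g * h - a * f , a * b - h * h ⟩

    det : Carrier
    det = M₀ ∙ A₀

  record Conic : Set where
    field
      quadraticForm : QuadraticForm
    open QuadraticForm quadraticForm public
    field
      nondegenerate : ¬ (det ≈ 0#)

  module _ (O : Conic) where
    open Conic O

    M·_ A·_ : Triple → Triple
    M· u = ⟨ M₀ ∙ u , M₁ ∙ u , M₂ ∙ u ⟩
    A· u = ⟨ A₀ ∙ u , A₁ ∙ u , A₂ ∙ u ⟩

    OnConic : Point → Set
    OnConic (P , _) = P ∙ (M· P) ≈ 0#

    External : Line → Set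
    External l = ∀ (P : Point) → P on l → ¬ OnConic P

    M·A· : ∀ u → M· (A· u) ≋ det *ₗ u
    M·A· u = row M₀ row₀ , row M₁ row₁ , row M₂ row₂
      where
      open AdjugateIdentity a b c f g h (- 1#) (x₀ u) (x₁ u) (x₂ u)

      sub≈ : ∀ s t → s - t ≈ sub s t
      sub≈ s t = +-congˡ (sym (-1*x≈-x t))

      A₀≋B₀ : A₀ ≋ B₀
      A₀≋B₀ = sub≈ _ _ , sub≈ _ _ , sub≈ _ _

      A·≋B· : A· u ≋ Bu
      A·≋B· = ∙-cong A₀≋B₀ ≋-refl
            , ∙-cong {A₁} {B₁} {u} (sub≈ _ _ , sub≈ _ _ , sub≈ _ _) ≋-refl
            , ∙-cong {A₂} {B₂} {u} (sub≈ _ _ , sub≈ _ _ , sub≈ _ _) ≋-refl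

      row : ∀ r {s w} → r ∙ Bu ≈ (M₀ ∙ B₀) * s + (1# + - 1#) * w →
            r ∙ (A· u) ≈ det * s
      row r {s} {w} eq = begin
        r ∙ (A· u)                        ≈⟨ ∙-cong {r} {r} ≋-refl A·≋B· ⟩
        r ∙ Bu                            ≈⟨ eq ⟩
        (M₀ ∙ B₀) * s + (1# + - 1#) * w   ≈⟨ +-congˡ (*-congʳ (-‿inverseʳ 1#)) ⟩
        (M₀ ∙ B₀) * s + 0# * w            ≈⟨ +-congˡ (zeroˡ w) ⟩
        (M₀ ∙ B₀) * s + 0#                ≈⟨ +-identityʳ _ ⟩
        (M₀ ∙ B₀) * s                     ≈⟨ *-congʳ (∙-cong {M₀} {M₀} ≋-refl A₀≋B₀) ⟨
        det * s                           ∎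

    A·-nonzero : ∀ {u} → ¬ IsZero u → ¬ IsZero (A· u)
    A·-nonzero {u} u≢0 (p₀ , p₁ , p₂) = u≢0
      ( vanish M₀ (proj₁ (M·A· u))
      , vanish M₁ (proj₁ (proj₂ (M·A· u)))
      , vanish M₂ (proj₂ (proj₂ (M·A· u))) )
      where
      vanish : ∀ r {s} → r ∙ (A· u) ≈ det * s → s ≈ 0#
      vanish r {s} e = *-cancel-0 nondegenerate (begin
        det * s                          ≈⟨ e ⟨
        r ∙ (A· u)                       ≈⟨ ∙-cong {r} {r} ≋-refl (p₀ , p₁ , p₂) ⟩
        r ∙ ⟨ 0# , 0# , 0# ⟩             ≈⟨ +-cong (+-cong (zeroʳ _) (zeroʳ _)) (zeroʳ _) ⟩
        0# + 0# + 0#                     ≈⟨ trans (+-identityʳ _) (+-identityʳ _) ⟩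
        0#                               ∎)

    -- The polarity sends a point P to the line M· P; the pole of a line l is
    -- the point whose polar is l, namely A· l, since M A = det · 1.

    pole : Line → Point
    pole (l , l≢0) = A· l , A·-nonzero l≢0

    polar-pole : ∀ (l : Line) → M· (proj₁ (pole l)) ≋ det *ₗ proj₁ l
    polar-pole (l , _) = M·A· l

    Conjugate : Line → Line → Set
    Conjugate l m = pole l on m

    Conjugate-sym : ∀ {l m} → Conjugate l m → Conjugate m l
    Conjugate-sym {u , _} {w , _} p = trans (symmetric u w) p
      where
      symmetric : ∀ u w → u ∙ (A· w) ≈ w ∙ (A· u)
      symmetric ⟨ p , q , r ⟩ ⟨ x , y , z ⟩ = solve 12 (λ A B C F G H p q r x y z →
        p :* (A :* x :+ H :* y :+ G :* z) :+ q :* (H :* x :+ B :* y :+ F :* z)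
          :+ r :* (G :* x :+ F :* y :+ C :* z)
        := x :* (A :* p :+ H :* q :+ G :* r) :+ y :* (H :* p :+ B :* q :+ F :* r)
          :+ z :* (G :* p :+ F :* q :+ C :* r)) refl
        (x₀ A₀) (x₁ A₁) (x₂ A₂) (x₂ A₁) (x₂ A₀) (x₁ A₀) p q r x y z
        where open RingSolver commutativeSemiring

    Conjugate-respʳ : ∀ {l m m′} → m ∼ m′ → Conjugate l m → Conjugate l m′
    Conjugate-respʳ {u , _} {w , _} {w′ , _} (t , t≉0 , w≋tw′) p = *-cancel-0 t≉0 (begin
      t * (w′ ∙ (A· u))     ≈⟨ *-congˡ (∙-comm w′ (A· u)) ⟩
      t * ((A· u) ∙ w′)     ≈⟨ ∙-*ₗ (A· u) t w′ ⟨
      (A· u) ∙ (t *ₗ w′)    ≈⟨ ∙-cong {A· u} {A· u} {w} ≋-refl w≋tw′ ⟨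
      (A· u) ∙ w            ≈⟨ ∙-comm (A· u) w ⟩
      w ∙ (A· u)            ≈⟨ p ⟩
      0#                    ∎)

    ExternalLine : Set
    ExternalLine = Σ Line External

    Γ : Graph
    Γ = record
      { vertices = SubSetoid homogeneous External
      ; Adj      = Adj
      ; irrefl   = λ a≈b (a≉b , _) → a≉b a≈b
      ; symm     = λ {a} {b} → symm {a} {b}
      ; resp     = (λ {a} {b} {c} → respʳ {a} {b} {c}) , λ {a} {b} {c} → respˡ {a} {b} {c}
      }
      where
      open Setoid homogeneous using () renaming (sym to ∼-sym; trans to ∼-trans)

      Adj : ExternalLine → ExternalLine → Set
      Adj (a , _) (b , _) = ¬ (a ∼ b) × Conjugate a b

      symm : Symmetric Adj
      symm {a , _} {b , _} (a≁b , a⊥b) =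
        (λ b∼a → a≁b (∼-sym {b} {a} b∼a)) , Conjugate-sym {a} {b} a⊥b

      respʳ : ∀ {a b c : ExternalLine} → proj₁ b ∼ proj₁ c → Adj a b → Adj a c
      respʳ {a , _} {b , _} {c , _} b∼c (a≁b , a⊥b) =
        (λ a∼c → a≁b (∼-trans {a} {c} {b} a∼c (∼-sym {b} {c} b∼c))) ,
        Conjugate-respʳ {a} {b} {c} b∼c a⊥b

      respˡ : ∀ {a b c : ExternalLine} → proj₁ b ∼ proj₁ c → Adj b a → Adj c a
      respˡ {a} {b} {c} b∼c b⊥a = symm {a} {c} (respʳ {a} {b} {c} b∼c (symm {b} {a} b⊥a))

{-# OPTIONS --safe #-}
module Submission where

-- Take q a power of 5, so that -1 = 2² is a square and q ≡ 1 (mod 4).  Over such a field the conic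
-- has hyperbolic coordinates in which its external lines are the polars of the points (1, y, y² - n)
-- with n a non-square, and two of them are conjugate iff (y - y′)² = n + n′.  Hence with q = 2 r + 1
-- the graph has v = r (2 r + 1) vertices and valency k = r + 1, it has no triangle because a triangle
-- would make n a square, and two vertices have at most one common neighbour.
--
-- Since λ = 0, CA(0, 3) = -6 while CA(x, 2) ≥ 0, so the CAP bound is 2.  The Delsarte bound 1 - k/γ
-- exceeds 2 as soon as γ > -k.  Let A be the adjacency matrix.  The matrix
-- E = J - (1 - k) I - A - A² has non-negative entries and constant row sums v - 1 - k², so an
-- eigenvector of A with eigenvalue μ ≤ -k, which is orthogonal to the constant vector, would give
-- 1 - k + μ + μ² ≤ v - 1 - k²; this fails because v < 2 k² - 2 k + 2.
-- The minimum eigenvalue itself is obtained constructively as the greatest lower bound of the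
-- Rayleigh quotients.

open import Defs
open import Level using (0ℓ)
open import Algebra.Bundles using (CommutativeRing)
import Algebra.Properties.Ring as RingProperties
import Algebra.Properties.Semiring.Mult as SemiringMult
import Algebra.Properties.Semiring.Mult.TCOptimised as OptimisedMult
import Algebra.Properties.Semiring.Sum as SemiringSum
import Algebra.Solver.Ring as RingSolver
open import Algebra.Solver.Ring.AlmostCommutativeRing
  using (_-Raw-AlmostCommutative⟶_; fromCommutativeRing)
open import Data.Empty using (⊥)
open import Data.Fin.Base as Fin using (Fin; zero; suc; punchIn; punchOut)
open import Data.Fin.Permutation using (↔⇒≡)
open import Data.Fin.Properties as Finₚ
  using (any?; *↔×; punchIn-punchOut; punchOut-injective; injective⇒≤)
import Data.Integer.Base as Int
open Int using (ℤ; +_; -[1+_]; _⊖_)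
import Data.Integer.Properties as ℤₚ
import Data.Integer.Solver as IntegerSolver
open import Data.Maybe.Base using (Maybe; just; nothing)
open import Data.Nat.Base as ℕ using (ℕ; zero; suc; z≤n; s≤s)
open import Data.Nat.Divisibility using (_∣_; _∣?_; ∣1⇒≡1)
open import Data.Nat.Primality using (prime?; prime[2]; euclidsLemma)
import Data.Nat.Properties as ℕₚ
open import Data.Product.Base using (Σ; ∃; ∃-syntax; _×_; _,_; proj₁; proj₂)
open import Data.Product.Relation.Binary.Pointwise.NonDependent using (_×ₛ_)
open import Data.Sum.Base using (_⊎_; inj₁; inj₂; [_,_]′)
open import Data.Vec.Functional using (Vector)
open import Function.Base using (_∘_)
open import Function.Bundles using (Inverse)
import Function.Construct.Composition as Composition
import Function.Construct.Symmetry as Symmetry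
open import Relation.Binary.Bundles using (Setoid)
open import Relation.Binary.Core using (Rel)
open import Relation.Binary.Definitions using (_Respects_; Decidable; tri<; tri≈; tri>)
open import Relation.Binary.PropositionalEquality.Core as ≡ using (_≡_; _≢_)
import Relation.Binary.PropositionalEquality.Properties as ≡
import Relation.Binary.Reasoning.Setoid as SetoidReasoning
open import Relation.Binary.Structures using (IsStrictTotalOrder)
open import Relation.Nullary.Decidable.Core
  using (Dec; yes; no; ¬?; decidable-stable; map′; _×-dec_; from-yes; from-no)
open import Relation.Nullary.Negation.Core using (¬_; contradiction)
import Relation.Unary as Unary

-- In every k-regular graph with an edge γ ≥ -k, which only puts the Delsarte bound at 2 or above;
-- the work lies in making this strict. Equality means that some component is bipartite. The
-- threshold 2 k² - 2 k + 2 is the least possible order of a bipartite k-regular graph without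
-- 4-cycles, attained by the incidence graphs of projective planes of order k - 1, while here v = 2
-- k² - 3 k + 1 falls just below it.
--
-- Characteristic 5 also keeps the algebra integral: one half is -2, and the discriminant y² - 16 x
-- z of the equation for the intersection points becomes y² - x z. Identities are therefore stated
-- with integer coefficients up to an explicit multiple of 5.
--
-- The real numbers are known only through their axioms, so that a least eigenvalue exists is itself
-- something to prove. Trichotomy of the order decides equality, which makes Gaussian elimination
-- available.

-- Ring identities with integer coefficients

module ℤSolver (R : CommutativeRing 0ℓ 0ℓ) where
  open CommutativeRing R
  open RingProperties ring
  open OptimisedMult semiring using (×-homo-+; ×1-homo-*; 1+×)
    renaming (_×_ to _⋆_)
  open SetoidReasoning setoid

  -- With the optimised multiple, `fromℤ (+ 1)` reduces to `1#`, so `con (+ 1)` matches the `1#` of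
  -- a goal without a trailing `+ 0#`.
  fromℤ : ℤ → Carrier
  fromℤ (+ n)    = n ⋆ 1#
  fromℤ -[1+ n ] = - (suc n ⋆ 1#)

  private
    cancel : ∀ a x y → (a + x) - (a + y) ≈ x - y
    cancel a x y = begin
      (a + x) - (a + y)        ≈⟨ +-congˡ (-‿+-comm a y) ⟨
      (a + x) + (- a + - y)    ≈⟨ +-congʳ (+-comm a x) ⟩
      (x + a) + (- a + - y)    ≈⟨ +-assoc x a _ ⟩
      x + (a + (- a + - y))    ≈⟨ +-congˡ (+-assoc a (- a) (- y)) ⟨
      x + ((a + - a) + - y)    ≈⟨ +-congˡ (+-congʳ (-‿inverseʳ a)) ⟩
      x + (0# + - y)           ≈⟨ +-congˡ (+-identityˡ _) ⟩
      x - y                    ∎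

    -0≈0 : - 0# ≈ 0#
    -0≈0 = trans (sym (+-identityˡ _)) (-‿inverseʳ 0#)

    fromℤ-⊖ : ∀ m n → fromℤ (m ⊖ n) ≈ m ⋆ 1# - n ⋆ 1#
    fromℤ-⊖ zero    zero    = sym (-‿inverseʳ _)
    fromℤ-⊖ zero    (suc n) = sym (+-identityˡ _)
    fromℤ-⊖ (suc m) zero    = sym (trans (+-congˡ -0≈0) (+-identityʳ _))
    fromℤ-⊖ (suc m) (suc n) = begin
      fromℤ (suc m ⊖ suc n)               ≡⟨ ≡.cong fromℤ (ℤₚ.[1+m]⊖[1+n]≡m⊖n m n) ⟩
      fromℤ (m ⊖ n)                       ≈⟨ fromℤ-⊖ m n ⟩
      m ⋆ 1# - n ⋆ 1#                     ≈⟨ cancel 1# _ _ ⟨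
      (1# + m ⋆ 1#) - (1# + n ⋆ 1#)       ≈⟨ +-cong (1+× m 1#) (-‿cong (1+× n 1#)) ⟨
      suc m ⋆ 1# - suc n ⋆ 1#             ∎

    +-homo : ∀ m n → fromℤ (m Int.+ n) ≈ fromℤ m + fromℤ n
    +-homo (+ m)    (+ n)    = ×-homo-+ 1# m n
    +-homo (+ m)    -[1+ n ] = fromℤ-⊖ m (suc n)
    +-homo -[1+ m ] (+ n)    = trans (fromℤ-⊖ n (suc m)) (+-comm _ _)
    +-homo -[1+ m ] -[1+ n ] = begin
      - (suc (suc (m ℕ.+ n)) ⋆ 1#)        ≡⟨ ≡.cong (λ k → - (k ⋆ 1#)) (≡.cong suc (+-suc m n)) ⟨
      - ((suc m ℕ.+ suc n) ⋆ 1#)          ≈⟨ -‿cong (×-homo-+ 1# (suc m) (suc n)) ⟩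
      - (suc m ⋆ 1# + suc n ⋆ 1#)         ≈⟨ -‿+-comm _ _ ⟨
      - (suc m ⋆ 1#) + - (suc n ⋆ 1#)     ∎
      where open import Data.Nat.Properties using (+-suc)

    -‿homo : ∀ m → fromℤ (Int.- m) ≈ - fromℤ m
    -‿homo (+ zero)  = sym -0≈0
    -‿homo (+ suc n) = refl
    -‿homo -[1+ n ]  = sym (-‿involutive _)

    *-homo⁺ : ∀ m n → fromℤ (+ m Int.* n) ≈ fromℤ (+ m) * fromℤ n
    *-homo⁺ m (+ n)    = trans (reflexive (≡.cong fromℤ (≡.sym (ℤₚ.pos-* m n)))) (×1-homo-* m n)
    *-homo⁺ m -[1+ n ] = begin
      fromℤ (+ m Int.* Int.- (+ suc n))        ≡⟨ ≡.cong fromℤ (ℤₚ.neg-distribʳ-* (+ m) (+ suc n)) ⟨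
      fromℤ (Int.- (+ m Int.* + suc n))        ≈⟨ -‿homo (+ m Int.* + suc n) ⟩
      - fromℤ (+ m Int.* + suc n)            ≈⟨ -‿cong (*-homo⁺ m (+ suc n)) ⟩
      - (m ⋆ 1# * suc n ⋆ 1#)              ≈⟨ -‿distribʳ-* _ _ ⟩
      m ⋆ 1# * - (suc n ⋆ 1#)              ∎

    *-homo : ∀ m n → fromℤ (m Int.* n) ≈ fromℤ m * fromℤ n
    *-homo (+ m)    n = *-homo⁺ m n
    *-homo -[1+ m ] n = begin
      fromℤ (Int.- (+ suc m) Int.* n)          ≡⟨ ≡.cong fromℤ (ℤₚ.neg-distribˡ-* (+ suc m) n) ⟨
      fromℤ (Int.- (+ suc m Int.* n))          ≈⟨ -‿homo (+ suc m Int.* n) ⟩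
      - fromℤ (+ suc m Int.* n)              ≈⟨ -‿cong (*-homo⁺ (suc m) n) ⟩
      - (suc m ⋆ 1# * fromℤ n)             ≈⟨ -‿distribˡ-* _ _ ⟩
      - (suc m ⋆ 1#) * fromℤ n             ∎

    homomorphism : Int.+-*-rawRing -Raw-AlmostCommutative⟶ fromCommutativeRing R
    homomorphism = record
      { ⟦_⟧    = fromℤ
      ; +-homo = +-homo
      ; *-homo = *-homo
      ; -‿homo = -‿homo
      ; 0-homo = refl
      ; 1-homo = refl
      }

    coeff≟ : ∀ m n → Maybe (fromℤ m ≈ fromℤ n)
    coeff≟ m n with m ℤₚ.≟ n
    ... | yes ≡.refl = just refl
    ... | no  _      = nothing

  open RingSolver _ _ homomorphism coeff≟ public
    using (solve; _:=_; _:+_; _:*_; _:-_; :-_; con)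

-- Linear algebra over a field

module FieldMatrices (K : Field) where
  open Field K hiding (zero)
  open SemiringSum semiring
  open SetoidReasoning setoid
  open ℤSolver commutativeRing

  Mat : ℕ → Set
  Mat n = Fin n → Fin n → Carrier

  infixl 8 _·_ _·ᵥ_

  _·_ : ∀ {n} → Vector Carrier n → Vector Carrier n → Carrier
  x · y = sum (λ i → x i * y i)

  _·ᵥ_ : ∀ {m n} → (Fin m → Fin n → Carrier) → Vector Carrier n → Vector Carrier m
  (B ·ᵥ x) i = B i · x

  δ : ∀ {n} → Mat n
  δ zero    zero    = 1#
  δ zero    (suc j) = 0#
  δ (suc i) zero    = 0#
  δ (suc i) (suc j) = δ i j

  δ-refl : ∀ {n} (i : Fin n) → δ i i ≡ 1#
  δ-refl zero    = ≡.refl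
  δ-refl (suc i) = δ-refl i

  δ-≢ : ∀ {n} {i j : Fin n} → i ≢ j → δ i j ≡ 0#
  δ-≢ {i = zero}  {zero}  i≢j = contradiction ≡.refl i≢j
  δ-≢ {i = zero}  {suc j} i≢j = ≡.refl
  δ-≢ {i = suc i} {zero}  i≢j = ≡.refl
  δ-≢ {i = suc i} {suc j} i≢j = δ-≢ (i≢j ∘ ≡.cong suc)

  ·-zeroʳ : ∀ {n} (x : Vector Carrier n) {y} → (∀ i → y i ≈ 0#) → x · y ≈ 0#
  ·-zeroʳ {n} x y≈0 = trans (sum-cong-≋ (λ i → trans (*-congˡ (y≈0 i)) (zeroʳ _)))
                            (sum-replicate-zero n)

  ·-congˡ : ∀ {n} (x : Vector Carrier n) {y z} → (∀ i → y i ≈ z i) → x · y ≈ x · z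
  ·-congˡ x y≈z = sum-cong-≋ (λ i → *-congˡ (y≈z i))

  ·-comm : ∀ {n} (x y : Vector Carrier n) → x · y ≈ y · x
  ·-comm x y = sum-cong-≋ (λ i → *-comm (x i) (y i))

  sum-linear : ∀ {n} a (f g : Vector Carrier n) →
               sum (λ i → f i + a * g i) ≈ sum f + a * sum g
  sum-linear a f g = trans (∑-distrib-+ f _) (+-congˡ (sym (*-distribˡ-sum a g)))

  ·-linearʳ : ∀ {n} a (x f g : Vector Carrier n) →
              x · (λ i → f i + a * g i) ≈ x · f + a * x · g
  ·-linearʳ {n} a x f g = trans
    (sum-cong-≋ {n} λ i → solve 4 (λ a x f g → x :* (f :+ a :* g) := x :* f :+ a :* (x :* g))
                                  refl a (x i) (f i) (g i))
    (sum-linear a (λ i → x i * f i) (λ i → x i * g i))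

  ·-linearˡ : ∀ {n} a (x f g : Vector Carrier n) →
              (λ i → f i + a * g i) · x ≈ f · x + a * g · x
  ·-linearˡ a x f g = trans (·-comm _ x)
    (trans (·-linearʳ a x f g) (+-cong (·-comm x f) (*-congˡ (·-comm x g))))

  δ·ᵥ : ∀ {n} (x : Vector Carrier n) i → (δ ·ᵥ x) i ≈ x i
  δ·ᵥ {suc n} x zero    = trans (+-cong (*-identityˡ _)
    (trans (sum-cong-≋ (λ i → zeroˡ (x (suc i)))) (sum-replicate-zero n))) (+-identityʳ _)
  δ·ᵥ {suc n} x (suc i) = trans (+-cong (zeroˡ _) (δ·ᵥ (x ∘ suc) i)) (+-identityˡ _)

  ·ᵥ-assoc : ∀ {l m n} (B : Fin l → Fin m → Carrier) (C : Fin m → Fin n → Carrier)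
             x i → (B ·ᵥ (C ·ᵥ x)) i ≈ ((λ i k → B i · (λ j → C j k)) ·ᵥ x) i
  ·ᵥ-assoc {m = m} {n} B C x i = begin
    sum (λ j → B i j * sum (λ k → C j k * x k))
      ≈⟨ sum-cong-≋ (λ j → *-distribˡ-sum (B i j) (λ k → C j k * x k)) ⟩
    sum (λ j → sum (λ k → B i j * (C j k * x k)))
      ≈⟨ ∑-comm (λ j k → B i j * (C j k * x k)) ⟩
    sum (λ k → sum (λ j → B i j * (C j k * x k)))
      ≈⟨ sum-cong-≋ {n} (λ k → sum-cong-≋ {m} (λ j → *-assoc (B i j) (C j k) (x k))) ⟨
    sum (λ k → sum (λ j → B i j * C j k * x k))
      ≈⟨ sum-cong-≋ (λ k → *-distribʳ-sum (x k) (λ j → B i j * C j k)) ⟨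
    sum (λ k → sum (λ j → B i j * C j k) * x k) ∎

  Symmetric : ∀ {n} → Mat n → Set
  Symmetric A = ∀ i j → A i j ≈ A j i

  self-adjoint : ∀ {n} {A : Mat n} → Symmetric A → ∀ x y → x · (A ·ᵥ y) ≈ y · (A ·ᵥ x)
  self-adjoint {A = A} A-sym x y = begin
    x · (A ·ᵥ y)
      ≈⟨ sum-cong-≋ (λ i → *-distribˡ-sum (x i) (λ j → A i j * y j)) ⟩
    sum (λ i → sum (λ j → x i * (A i j * y j)))
      ≈⟨ ∑-comm (λ i j → x i * (A i j * y j)) ⟩
    sum (λ j → sum (λ i → x i * (A i j * y j)))
      ≈⟨ sum-cong-≋ (λ j → sum-cong-≋ λ i → trans (*-congˡ (*-congʳ (A-sym i j)))
           (solve 3 (λ x a y → x :* (a :* y) := y :* (a :* x)) refl (x i) (A j i) (y j))) ⟩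
    sum (λ j → sum (λ i → y j * (A j i * x i)))
      ≈⟨ sum-cong-≋ (λ j → *-distribˡ-sum (y j) (λ i → A j i * x i)) ⟨
    y · (A ·ᵥ x) ∎

  Kernel Solvable : ∀ {n} → Mat n → Set
  Kernel {n} B   = Σ (Vector Carrier n) λ x → ¬ (∀ i → x i ≈ 0#) × (∀ i → (B ·ᵥ x) i ≈ 0#)
  Solvable {n} B = (y : Vector Carrier n) → Σ (Vector Carrier n) λ x → ∀ i → (B ·ᵥ x) i ≈ y i

  module Elimination {n : ℕ} (B : Mat (suc n)) (k : Fin (suc n)) (p≉0 : ¬ (B k zero ≈ 0#)) where
    p⁻¹ : Carrier
    p⁻¹ = inv (B k zero) p≉0

    multiplier : Fin n → Carrier
    multiplier r = B (punchIn k r) zero * p⁻¹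

    -- Subtraction is written as adding a negated multiple, the shape that `·-linearˡ` splits.
    reduced : Mat n
    reduced r j = B (punchIn k r) (suc j) + - multiplier r * B k (suc j)

    extend : Vector Carrier (suc n) → Vector Carrier n → Vector Carrier (suc n)
    extend y x zero    = p⁻¹ * (y k - (λ j → B k (suc j)) · x)
    extend y x (suc j) = x j

    -- Row `k` holds by the choice of the first entry of `extend y x`. Every other row is a row of
    -- the reduced system plus `multiplier` times row `k`.
    extend-solves : ∀ y x → (∀ r → (reduced ·ᵥ x) r ≈ y (punchIn k r) - multiplier r * y k) →
                    ∀ i → (B ·ᵥ extend y x) i ≈ y i
    extend-solves y x solves i with k Finₚ.≟ i
    ... | yes ≡.refl = begin
      B k zero * (p⁻¹ * (y k - t)) + t  ≈⟨ +-congʳ (*-assoc _ _ _) ⟨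
      B k zero * p⁻¹ * (y k - t) + t    ≈⟨ +-congʳ (*-congʳ (inverseʳ _ p≉0)) ⟩
      1# * (y k - t) + t                ≈⟨ solve 2 (λ y t → con (+ 1) :* (y :- t) :+ t := y) refl (y k) t ⟩
      y k                               ∎
      where
      t : Carrier
      t = (λ j → B k (suc j)) · x
    ... | no k≢i = begin
      B i zero * (p⁻¹ * (y k - t)) + s
        ≡⟨ ≡.cong (λ i → B i zero * (p⁻¹ * (y k - t)) + (λ j → B i (suc j)) · x) (≡.sym i≡) ⟩
      b * (p⁻¹ * (y k - t)) + s′
        ≈⟨ solve 5 (λ b q y t s → b :* (q :* (y :- t)) :+ s :=
                      (s :+ (:- (b :* q)) :* t) :+ b :* q :* y) refl b p⁻¹ (y k) t s′ ⟩
      s′ + - m * t + m * y k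
        ≈⟨ +-congʳ (·-linearˡ (- m) x _ _) ⟨
      (reduced ·ᵥ x) r + m * y k
        ≈⟨ +-congʳ (solves r) ⟩
      y (punchIn k r) - m * y k + m * y k
        ≈⟨ solve 2 (λ y z → y :- z :+ z := y) refl _ _ ⟩
      y (punchIn k r)
        ≡⟨ ≡.cong y i≡ ⟩
      y i ∎
      where
      r : Fin n
      r = punchOut k≢i
      i≡ : punchIn k r ≡ i
      i≡ = punchIn-punchOut k≢i
      b m s s′ t : Carrier
      b  = B (punchIn k r) zero
      m  = multiplier r
      s  = (λ j → B i (suc j)) · x
      s′ = (λ j → B (punchIn k r) (suc j)) · x
      t  = (λ j → B k (suc j)) · x

  -- Gaussian elimination with a pivot from the first column. Without a pivot the first unit vector
  -- lies in the kernel; with one, `extend` lifts either alternative from the reduced matrix, a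
  -- kernel vector being lifted with right-hand side zero. The dichotomy replaces determinants in
  -- the search for an eigenvector.
  kernel⊎solvable : Decidable _≈_ → ∀ {n} (B : Mat n) → Kernel B ⊎ Solvable B
  kernel⊎solvable _≟_ {zero}  B = inj₂ λ y → (λ ()) , λ ()
  kernel⊎solvable _≟_ {suc n} B with any? (λ i → ¬? (B i zero ≟ 0#))
  ... | no  none = inj₁ ( e₀ , (λ e₀≈0 → 1≉0 (e₀≈0 zero)) , λ i → trans
      (+-cong (trans (*-identityʳ _) (decidable-stable (B i zero ≟ 0#) (λ b≉0 → none (i , b≉0))))
              (·-zeroʳ (λ j → B i (suc j)) {λ _ → 0#} (λ _ → refl)))
      (+-identityʳ 0#))
    where
    e₀ : Vector Carrier (suc n)
    e₀ zero    = 1#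
    e₀ (suc _) = 0#
  ... | yes (k , p≉0) with kernel⊎solvable _≟_ reduced
    where open Elimination B k p≉0
  ...   | inj₁ (x , x≉0 , x∈ker) = inj₁
      ( extend (λ _ → 0#) x , (λ ex≈0 → x≉0 (λ i → ex≈0 (suc i)))
      , extend-solves (λ _ → 0#) x (λ r → trans (x∈ker r)
          (solve 1 (λ m → con (+ 0) := con (+ 0) :- m :* con (+ 0)) refl _)))
    where open Elimination B k p≉0
  ...   | inj₂ solution = inj₂ λ y → let x , x-solves = solution (λ r → y (punchIn k r) - multiplier r * y k) in
      extend y x , extend-solves y x x-solves
    where open Elimination B k p≉0

-- Eigenvalues of symmetric matrices

module OrderedField (ℝ : CompleteOrderedField) where
  open CompleteOrderedField ℝ hiding (zero; sum)
  open RingProperties ring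
  open SemiringSum semiring
  open SetoidReasoning setoid
  open ℤSolver commutativeRing
  open IsStrictTotalOrder isStrictTotalOrder public
    using (compare; _≟_; <-resp-≈) renaming (trans to <-trans; irrefl to <-irrefl)
  open FieldMatrices isField

  <-resp : ∀ {x y u v} → x ≈ u → y ≈ v → x < y → u < v
  <-resp x≈u y≈v x<y = proj₂ <-resp-≈ x≈u (proj₁ <-resp-≈ y≈v x<y)

  <⇒0< : ∀ {x y} → x < y → 0# < y - x
  <⇒0< {x} x<y = <-resp (-‿inverseʳ x) refl (+-monoˡ-< (- x) x<y)

  0<⇒< : ∀ {x y} → 0# < y - x → x < y
  0<⇒< {x} {y} 0<y-x = <-resp (+-identityˡ x)
    (solve 2 (λ x y → y :- x :+ x := y) refl x y) (+-monoˡ-< x 0<y-x)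

  ≤⇒0≤ : ∀ {x y} → x ≤ y → 0# ≤ y - x
  ≤⇒0≤ (inj₁ x<y)      = inj₁ (<⇒0< x<y)
  ≤⇒0≤ {x} (inj₂ x≈y) = inj₂ (sym (trans (+-congʳ (sym x≈y)) (-‿inverseʳ x)))

  0≤⇒≤ : ∀ {x y} → 0# ≤ y - x → x ≤ y
  0≤⇒≤ (inj₁ 0<)  = inj₁ (0<⇒< 0<)
  0≤⇒≤ {x} {y} (inj₂ 0≈) = inj₂ (begin
    x            ≈⟨ +-identityˡ x ⟨
    0# + x       ≈⟨ +-congʳ 0≈ ⟩
    y - x + x    ≈⟨ solve 2 (λ x y → y :- x :+ x := y) refl x y ⟩
    y            ∎)

  0≤-resp : ∀ {x y} → x ≈ y → 0# ≤ x → 0# ≤ y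
  0≤-resp x≈y (inj₁ 0<x) = inj₁ (<-resp refl x≈y 0<x)
  0≤-resp x≈y (inj₂ 0≈x) = inj₂ (trans 0≈x x≈y)

  0<+0≤ : ∀ {x y} → 0# < x → 0# ≤ y → 0# < x + y
  0<+0≤ {x} {y} 0<x (inj₁ 0<y) =
    <-trans 0<y (<-resp (+-identityˡ y) refl (+-monoˡ-< y 0<x))
  0<+0≤ 0<x (inj₂ 0≈y) = <-resp refl (trans (sym (+-identityʳ _)) (+-congˡ 0≈y)) 0<x

  0≤+0≤ : ∀ {x y} → 0# ≤ x → 0# ≤ y → 0# ≤ x + y
  0≤+0≤ (inj₁ 0<x) 0≤y = inj₁ (0<+0≤ 0<x 0≤y)
  0≤+0≤ (inj₂ 0≈x) 0≤y = 0≤-resp (trans (sym (+-identityˡ _)) (+-congʳ 0≈x)) 0≤y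

  0≤*0≤ : ∀ {x y} → 0# ≤ x → 0# ≤ y → 0# ≤ x * y
  0≤*0≤ (inj₁ 0<x) (inj₁ 0<y) = inj₁ (*-pos 0<x 0<y)
  0≤*0≤ (inj₂ 0≈x) _          = inj₂ (trans (sym (zeroˡ _)) (*-congʳ 0≈x))
  0≤*0≤ (inj₁ _)   (inj₂ 0≈y) = inj₂ (trans (sym (zeroʳ _)) (*-congˡ 0≈y))

  sign : ∀ x → 0# ≤ x ⊎ 0# < - x
  sign x with compare 0# x
  ... | tri< 0<x _ _ = inj₁ (inj₁ 0<x)
  ... | tri≈ _ 0≈x _ = inj₁ (inj₂ 0≈x)
  ... | tri> _ _ x<0 = inj₂ (<-resp refl (+-identityˡ _) (<⇒0< x<0))

  0<⇒≉0 : ∀ {x} → 0# < x → ¬ (x ≈ 0#)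
  0<⇒≉0 0<x x≈0 = <-irrefl (sym x≈0) 0<x

  0<⇒¬0≤- : ∀ {x} → 0# < x → ¬ (0# ≤ - x)
  0<⇒¬0≤- {x} 0<x 0≤-x = 0<⇒≉0 (0<+0≤ 0<x 0≤-x) (-‿inverseʳ x)

  0≤∧≉0⇒0< : ∀ {x} → 0# ≤ x → ¬ (x ≈ 0#) → 0# < x
  0≤∧≉0⇒0< (inj₁ 0<x) _   = 0<x
  0≤∧≉0⇒0< (inj₂ 0≈x) x≉0 = contradiction (sym 0≈x) x≉0

  0≤x² : ∀ x → 0# ≤ x * x
  0≤x² x with sign x
  ... | inj₁ 0≤x  = 0≤*0≤ 0≤x 0≤x
  ... | inj₂ 0<-x = 0≤-resp (solve 1 (λ x → :- x :* :- x := x :* x) refl x)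
                            (inj₁ (*-pos 0<-x 0<-x))

  0<1 : 0# < 1#
  0<1 = 0≤∧≉0⇒0< (0≤-resp (*-identityˡ 1#) (0≤x² 1#)) 1≉0

  0≤fromℕ : ∀ n → 0# ≤ fromℕ n
  0≤fromℕ zero    = inj₂ refl
  0≤fromℕ (suc n) = inj₁ (0<+0≤ 0<1 (0≤fromℕ n))

  halve : ∀ {x} → 0# ≤ x + x → 0# ≤ x
  halve {x} 0≤2x with sign x
  ... | inj₁ 0≤x  = 0≤x
  ... | inj₂ 0<-x = contradiction
    (0≤-resp (solve 1 (λ x → x :+ x := :- (:- x :+ :- x)) refl x) 0≤2x)
    (0<⇒¬0≤- (0<+0≤ 0<-x (inj₁ 0<-x)))

  0≤a²+b²-ab : ∀ a b → 0# ≤ a * a + b * b - a * b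
  0≤a²+b²-ab a b = halve (0≤-resp
    (solve 2 (λ a b → (a :- b) :* (a :- b) :+ (a :* a :+ b :* b)
       := (a :* a :+ b :* b :- a :* b) :+ (a :* a :+ b :* b :- a :* b)) refl a b)
    (0≤+0≤ (0≤x² (a - b)) (0≤+0≤ (0≤x² a) (0≤x² b))))

  *-cancel-0≤ : ∀ {x y} → 0# < x → 0# ≤ x * y → 0# ≤ y
  *-cancel-0≤ {x} {y} 0<x 0≤xy with sign y
  ... | inj₁ 0≤y  = 0≤y
  ... | inj₂ 0<-y = contradiction
    (0≤-resp (solve 2 (λ x y → x :* y := :- (x :* :- y)) refl x y) 0≤xy)
    (0<⇒¬0≤- (*-pos 0<x 0<-y))

  0<inv : ∀ {x} (x≉0 : ¬ (x ≈ 0#)) → 0# < x → 0# < inv x x≉0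
  0<inv {x} x≉0 0<x = 0≤∧≉0⇒0<
    (*-cancel-0≤ 0<x (0≤-resp (sym (inverseʳ x x≉0)) (inj₁ 0<1)))
    (λ i≈0 → 1≉0 (trans (sym (inverseʳ x x≉0)) (trans (*-congˡ i≈0) (zeroʳ x))))

  sum-0≤ : ∀ {n} {f : Vector Carrier n} → (∀ i → 0# ≤ f i) → 0# ≤ sum f
  sum-0≤ {zero}  0≤f = inj₂ refl
  sum-0≤ {suc n} 0≤f = 0≤+0≤ (0≤f zero) (sum-0≤ (0≤f ∘ suc))

  term≤sum : ∀ {n} {f : Vector Carrier n} → (∀ i → 0# ≤ f i) → ∀ i → 0# ≤ sum f - f i
  term≤sum {f = f} 0≤f zero = 0≤-resp
    (solve 2 (λ x s → s := x :+ s :- x) refl (f zero) (sum (f ∘ suc))) (sum-0≤ (0≤f ∘ suc))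
  term≤sum {f = f} 0≤f (suc i) = 0≤-resp
    (solve 3 (λ x s y → x :+ (s :- y) := x :+ s :- y) refl (f zero) (sum (f ∘ suc)) (f (suc i)))
    (0≤+0≤ (0≤f zero) (term≤sum (0≤f ∘ suc) i))

  norm² : ∀ {n} → Vector Carrier n → Carrier
  norm² x = x · x

  0≤norm² : ∀ {n} (x : Vector Carrier n) → 0# ≤ norm² x
  0≤norm² x = sum-0≤ (λ i → 0≤x² (x i))

  xᵢ²≤norm² : ∀ {n} (x : Vector Carrier n) i → 0# ≤ norm² x - x i * x i
  xᵢ²≤norm² x = term≤sum (λ i → 0≤x² (x i))

  0<norm² : ∀ {n} {x : Vector Carrier n} → ¬ (∀ i → x i ≈ 0#) → 0# < norm² x
  0<norm² {x = x} x≉0 = 0≤∧≉0⇒0< (0≤norm² x) λ N≈0 → x≉0 λ i → square-zero (x i)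
    (0≤-resp (trans (+-congʳ N≈0) (+-identityˡ _)) (xᵢ²≤norm² x i))
    where
    square-zero : ∀ y → 0# ≤ - (y * y) → y ≈ 0#
    square-zero y 0≤-y² with compare 0# y
    ... | tri< 0<y _ _ = contradiction 0≤-y² (0<⇒¬0≤- (*-pos 0<y 0<y))
    ... | tri≈ _ 0≈y _ = sym 0≈y
    ... | tri> _ _ y<0 = contradiction 0≤-y² (0<⇒¬0≤-
      (<-resp refl (solve 1 (λ y → (con (+ 0) :- y) :* (con (+ 0) :- y) := y :* y) refl y)
              (*-pos (<⇒0< y<0) (<⇒0< y<0))))

  form : ∀ {n} → Mat n → Vector Carrier n → Carrier
  form A x = x · (A ·ᵥ x)

  -- x_i C_ij x_j ≤ C_ij² x_i² + x_j² ≤ (C_ij² + 1) |x|².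
  quadratic-bound : ∀ {n} (C : Mat n) → ∃[ c ] 0# < c × (∀ x → 0# ≤ c * norm² x - form C x)
  quadratic-bound {n} C = c , 0<+0≤ 0<1 (sum-0≤ λ i → sum-0≤ λ j →
                                inj₁ (0<+0≤ 0<1 (0≤x² (C i j)))) , bound
    where
    s c : Carrier
    s = sum (λ i → sum (λ j → 1# + C i j * C i j))
    -- The summand `1#` keeps `c` positive even when the sum is empty; `c` is inverted later.
    c = 1# + s

    bound : ∀ x → 0# ≤ c * norm² x - form C x
    bound x = 0≤-resp (begin
      sum (λ i → sum (λ j → t i j)) + N
        ≈⟨ +-congʳ (sum-cong-≋ {n} (λ i → trans (sum-linear (- 1#) (λ j → a i j * N) (λ j → x i * (C i j * x j)))
             (+-cong (sym (*-distribʳ-sum N (a i))) (*-congˡ (sym (*-distribˡ-sum (x i) (λ j → C i j * x j))))))) ⟩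
      sum (λ i → sum (a i) * N + - 1# * (x i * (C ·ᵥ x) i)) + N
        ≈⟨ +-congʳ (trans (sum-linear (- 1#) (λ i → sum (a i) * N) (λ i → x i * (C ·ᵥ x) i))
             (+-congʳ (sym (*-distribʳ-sum N (λ i → sum (a i)))))) ⟩
      s * N + - 1# * form C x + N
        ≈⟨ solve 3 (λ s N form → s :* N :+ :- con (+ 1) :* form :+ N := (con (+ 1) :+ s) :* N :- form)
             refl s N (form C x) ⟩
      c * N - form C x ∎)
      (0≤+0≤ (sum-0≤ λ i → sum-0≤ λ j → 0≤t i j) (0≤norm² x))
      where
      N : Carrier
      N = norm² x
      a t : Mat n
      a i j = 1# + C i j * C i j
      t i j = a i j * N + - 1# * (x i * (C i j * x j))
      0≤t : ∀ i j → 0# ≤ t i j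
      0≤t i j = 0≤-resp
        (solve 4 (λ C x y N → C :* C :* (N :- x :* x) :+ (N :- y :* y)
             :+ ((C :* x) :* (C :* x) :+ y :* y :- (C :* x) :* y)
           := (con (+ 1) :+ C :* C) :* N :+ :- con (+ 1) :* (x :* (C :* y)))
           refl (C i j) (x i) (x j) N)
        (0≤+0≤ (0≤+0≤ (0≤*0≤ (0≤x² (C i j)) (xᵢ²≤norm² x i)) (xᵢ²≤norm² x j))
               (0≤a²+b²-ab (C i j * x i) (x j)))

  eigenvector-form : ∀ {n} (A : Mat n) {x μ} → (∀ i → (A ·ᵥ x) i ≈ μ * x i) → form A x ≈ μ * norm² x
  eigenvector-form {n} A {x} {μ} Ax≈μx = begin
    form A x                        ≈⟨ ·-congˡ x Ax≈μx ⟩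
    x · (λ i → μ * x i)          ≈⟨ sum-cong-≋ {n} (λ i →
      solve 2 (λ x m → x :* (m :* x) := m :* (x :* x)) refl (x i) μ) ⟩
    sum (λ i → μ * (x i * x i))  ≈⟨ *-distribˡ-sum μ (λ i → x i * x i) ⟨
    μ * norm² x                  ∎

  -- The number `t` lies below all Rayleigh quotients of `A`, cleared of the denominator so that the
  -- zero vector is covered too.
  LowerBound : ∀ {n} → Mat n → Carrier → Set
  LowerBound A t = ∀ x → 0# ≤ form A x - t * norm² x

  lowerBound-below-eigenvalue : ∀ {n} (A : Mat n) {t μ} →
    LowerBound A t → IsEigenvalue ℝ A μ → t ≤ μ
  lowerBound-below-eigenvalue A {t} {μ} lb (x , x≉0 , Ax≈μx) = 0≤⇒≤
    (*-cancel-0≤ (0<norm² x≉0) (0≤-resp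
      (trans (+-congʳ (eigenvector-form A Ax≈μx))
        (solve 3 (λ m t N → m :* N :- t :* N := N :* (m :- t)) refl μ t (norm² x)))
      (lb x)))

  module Rayleigh {n : ℕ} (A : Mat n) (w : Vector Carrier n) (0<w : 0# < norm² w) where
    quotient : ∀ x → 0# < norm² x → Carrier
    quotient x 0<N = form A x * inv (norm² x) (0<⇒≉0 0<N)

    N*quotient : ∀ x 0<N → norm² x * quotient x 0<N ≈ form A x
    N*quotient x 0<N = begin
      N * (Q * i)  ≈⟨ solve 3 (λ N Q i → N :* (Q :* i) := (N :* i) :* Q) refl N Q i ⟩
      (N * i) * Q  ≈⟨ *-congʳ (inverseʳ N _) ⟩
      1# * Q       ≈⟨ *-identityˡ Q ⟩
      Q            ∎
      where
      N Q i : Carrier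
      N = norm² x
      Q = form A x
      i = inv N (0<⇒≉0 0<N)

    N*[quotient-t] : ∀ x 0<N t → norm² x * (quotient x 0<N - t) ≈ form A x - t * norm² x
    N*[quotient-t] x 0<N t = trans
      (solve 3 (λ N r t → N :* (r :- t) := N :* r :- t :* N) refl (norm² x) (quotient x 0<N) t)
      (+-congʳ (N*quotient x 0<N))

    quotient-bounds : ∀ x 0<N → IsUpperBound (LowerBound A) (quotient x 0<N)
    quotient-bounds x 0<N t lb =
      0≤⇒≤ (*-cancel-0≤ 0<N (0≤-resp (sym (N*[quotient-t] x 0<N t)) (lb x)))

    -- An upper bound for the form of the negated matrix is a lower bound for that of `A`. It
    -- provides the non-emptiness demanded by `lub`.
    someLowerBound : ∃ (LowerBound A)
    someLowerBound = let c , _ , bound = quadratic-bound (λ i j → - A i j) in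
      - c , λ x → 0≤-resp (begin
        c * norm² x - form (λ i j → - A i j) x
          ≈⟨ +-congˡ (-‿cong (·-congˡ x (λ i → trans (sum-cong-≋ {n} (λ j →
               solve 2 (λ a x → :- a :* x := :- con (+ 1) :* (a :* x)) refl (A i j) (x j)))
               (sym (*-distribˡ-sum (- 1#) (λ j → A i j * x j)))))) ⟩
        c * norm² x - x · (λ i → - 1# * (A ·ᵥ x) i)
          ≈⟨ +-congˡ (-‿cong (trans (sum-cong-≋ {n} (λ i →
               solve 2 (λ x y → x :* (:- con (+ 1) :* y) := :- con (+ 1) :* (x :* y)) refl (x i) ((A ·ᵥ x) i)))
               (sym (*-distribˡ-sum (- 1#) (λ i → x i * (A ·ᵥ x) i))))) ⟩
        c * norm² x - (- 1# * form A x)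
          ≈⟨ solve 3 (λ c N Q → c :* N :- (:- con (+ 1) :* Q) := Q :- (:- c) :* N)
               refl c (norm² x) (form A x) ⟩
        form A x - - c * norm² x ∎) (bound x)

    -- At norm zero the inequality does not depend on `t`, which settles this case without showing
    -- that the vector vanishes.
    lowerBound-at : ∀ {t s} x → norm² x ≈ 0# → 0# ≤ form A x - t * norm² x → 0# ≤ form A x - s * norm² x
    lowerBound-at {t} {s} x N≈0 = 0≤-resp (+-congˡ (-‿cong (begin
      t * norm² x  ≈⟨ *-congˡ N≈0 ⟩
      t * 0#       ≈⟨ solve 2 (λ t s → t :* con (+ 0) := s :* con (+ 0)) refl t s ⟩
      s * 0#       ≈⟨ *-congˡ N≈0 ⟨
      s * norm² x  ∎)))

    -- Each Rayleigh quotient is an upper bound of the set of lower bounds, so it is at least the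
    -- supremum `γ`; hence `γ` is a lower bound itself. The quotient at `w` shows that the set is
    -- bounded above.
    greatestLowerBound : ∃[ γ ] LowerBound A γ × IsUpperBound (LowerBound A) γ
    greatestLowerBound =
      let t , t-lb = someLowerBound
          γ , γ-upper , γ-least =
            lub (LowerBound A) (t , t-lb) (quotient w 0<w , quotient-bounds w 0<w)
          γ-lb : LowerBound A γ
          γ-lb x = [_,_]′
            (λ 0<N → 0≤-resp (N*[quotient-t] x 0<N γ)
              (0≤*0≤ (inj₁ 0<N) (≤⇒0≤ (γ-least _ (quotient-bounds x 0<N)))))
            (λ 0≈N → lowerBound-at x (sym 0≈N) (t-lb x))
            (0≤norm² x)
      in γ , γ-lb , γ-upper

  module _ {n : ℕ} {A : Mat n} (A-sym : Symmetric A) {γ : Carrier} (γ-lowerBound : LowerBound A γ)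
           (γ-upper : IsUpperBound (LowerBound A) γ) where
    shifted : Mat n
    shifted i j = A i j + - γ * δ i j

    shifted·ᵥ : ∀ x i → (shifted ·ᵥ x) i ≈ (A ·ᵥ x) i + - γ * x i
    shifted·ᵥ x i = trans (·-linearˡ (- γ) x (A i) (δ i)) (+-congˡ (*-congˡ (δ·ᵥ x i)))

    -- If A - γ had an inverse C, then for c bounding the form of C the value of the form of
    -- A - γ at c x - C x shows that γ + 1/c is still a lower bound.
    γ-eigenvalue : IsEigenvalue ℝ A γ
    γ-eigenvalue with kernel⊎solvable _≟_ shifted
    ... | inj₁ (x , x≉0 , x∈ker) = x , x≉0 , λ i → begin
      (A ·ᵥ x) i                          ≈⟨ solve 3 (λ a g x → a := (a :+ (:- g) :* x) :+ g :* x)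
                                               refl ((A ·ᵥ x) i) γ (x i) ⟩
      (A ·ᵥ x) i + - γ * x i + γ * x i    ≈⟨ +-congʳ (shifted·ᵥ x i) ⟨
      (shifted ·ᵥ x) i + γ * x i          ≈⟨ +-congʳ (x∈ker i) ⟩
      0# + γ * x i                        ≈⟨ +-identityˡ _ ⟩
      γ * x i                             ∎
    ... | inj₂ solution = contradiction
      (≤⇒0≤ (γ-upper (γ + c⁻¹) improved))
      (λ 0≤ → 0<⇒¬0≤- 0<c⁻¹ (0≤-resp (solve 2 (λ g e → g :- (g :+ e) := :- e) refl γ c⁻¹) 0≤))
      where
      C : Mat n
      C i j = proj₁ (solution (λ k → δ k j)) i

      c c⁻¹ : Carrier
      c = proj₁ (quadratic-bound C)
      0<c : 0# < c
      0<c = proj₁ (proj₂ (quadratic-bound C))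
      c⁻¹ = inv c (0<⇒≉0 0<c)
      0<c⁻¹ : 0# < c⁻¹
      0<c⁻¹ = 0<inv _ 0<c

      improved : LowerBound A (γ + c⁻¹)
      improved x = *-cancel-0≤ 0<c (*-cancel-0≤ 0<c (0≤-resp identity
        (0≤+0≤ (γ-lowerBound z) (proj₂ (proj₂ (quadratic-bound C)) x))))
        where
        y z : Vector Carrier n
        y = C ·ᵥ x
        z i = - y i + c * x i
        N Q p : Carrier
        N = norm² x
        Q = form A x
        p = form C x

        Ay : ∀ i → (A ·ᵥ y) i ≈ x i + γ * y i
        Ay i = begin
          (A ·ᵥ y) i                          ≈⟨ solve 3 (λ a g x → a := (a :+ (:- g) :* x) :+ g :* x)
                                                   refl ((A ·ᵥ y) i) γ (y i) ⟩
          (A ·ᵥ y) i + - γ * y i + γ * y i    ≈⟨ +-congʳ (shifted·ᵥ y i) ⟨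
          (shifted ·ᵥ y) i + γ * y i          ≈⟨ +-congʳ (·ᵥ-assoc shifted C x i) ⟩
          ((λ i k → shifted i · (λ j → C j k)) ·ᵥ x) i + γ * y i
            ≈⟨ +-congʳ (sum-cong-≋ {n} (λ k → *-congʳ (proj₂ (solution (λ l → δ l k)) i))) ⟩
          (δ ·ᵥ x) i + γ * y i                ≈⟨ +-congʳ (δ·ᵥ x i) ⟩
          x i + γ * y i                       ∎

        yAx : y · (A ·ᵥ x) ≈ N + γ * p
        yAx = trans (self-adjoint A-sym y x) (trans (·-congˡ x Ay) (·-linearʳ γ x x y))

        y·Ay : form A y ≈ p + γ * norm² y
        y·Ay = trans (·-congˡ y Ay) (trans (·-linearʳ γ y x y) (+-congʳ (·-comm y x)))

        -y : Vector Carrier n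
        -y i = - y i

        -y≈ : ∀ {v} → -y · v ≈ - (y · v)
        -y≈ {v} = trans (sum-cong-≋ {n} (λ i → solve 2 (λ y v → :- y :* v := :- con (+ 1) :* (y :* v)) refl (y i) (v i)))
          (trans (sym (*-distribˡ-sum (- 1#) (λ i → y i * v i))) (-1*x≈-x _))

        zv : ∀ v → z · v ≈ - (y · v) + c * x · v
        zv v = trans (·-linearˡ c v -y x) (+-congʳ -y≈)

        N-z : norm² z ≈ norm² y - c * p - c * p + c * c * N
        N-z = begin
          z · z                           ≈⟨ zv z ⟩
          - (y · z) + c * x · z           ≈⟨ +-cong (-‿cong (·-comm y z)) (*-congˡ (·-comm x z)) ⟩
          - (z · y) + c * z · x           ≈⟨ +-cong (-‿cong (zv y)) (*-congˡ (zv x)) ⟩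
          - (- norm² y + c * p) + c * (- (y · x) + c * N)
            ≈⟨ +-congˡ (*-congˡ (+-congʳ (-‿cong (·-comm y x)))) ⟩
          - (- norm² y + c * p) + c * (- p + c * N)
            ≈⟨ solve 4 (λ Y c p N → :- (:- Y :+ c :* p) :+ c :* (:- p :+ c :* N)
                 := Y :- c :* p :- c :* p :+ c :* c :* N) refl (norm² y) c p N ⟩
          norm² y - c * p - c * p + c * c * N ∎

        Az : ∀ v → v · (A ·ᵥ z) ≈ - (y · (A ·ᵥ v)) + c * x · (A ·ᵥ v)
        Az v = trans (self-adjoint A-sym v z) (zv (A ·ᵥ v))

        Q-z : form A z ≈ (p + γ * norm² y) - c * (N + γ * p) - c * (N + γ * p) + c * c * Q
        Q-z = begin
          z · (A ·ᵥ z)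
            ≈⟨ zv (A ·ᵥ z) ⟩
          - (y · (A ·ᵥ z)) + c * x · (A ·ᵥ z)
            ≈⟨ +-cong (-‿cong (Az y)) (*-congˡ (Az x)) ⟩
          - (- form A y + c * x · (A ·ᵥ y)) + c * (- (y · (A ·ᵥ x)) + c * Q)
            ≈⟨ +-cong (-‿cong (+-cong (-‿cong y·Ay) (*-congˡ (trans (self-adjoint A-sym x y) yAx))))
                      (*-congˡ (+-congʳ (-‿cong yAx))) ⟩
          - (- (p + γ * norm² y) + c * (N + γ * p)) + c * (- (N + γ * p) + c * Q)
            ≈⟨ solve 4 (λ a b c Q → :- (:- a :+ c :* b) :+ c :* (:- b :+ c :* Q)
                 := a :- c :* b :- c :* b :+ c :* c :* Q) refl (p + γ * norm² y) (N + γ * p) c Q ⟩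
          (p + γ * norm² y) - c * (N + γ * p) - c * (N + γ * p) + c * c * Q ∎

        -- As `A - γ` times `C` is the identity, the form of `A - γ` at `z` is p - 2 c N + c² (Q - γ
        -- N). Adding the slack c N - p of the bound on `C` cancels `p` and leaves c² (Q - γ N) - c
        -- N.
        identity : (form A z - γ * norm² z) + (c * N - p) ≈ c * (c * (Q - (γ + c⁻¹) * N))
        identity = begin
          (form A z - γ * norm² z) + (c * N - p)
            ≈⟨ +-congʳ (+-cong Q-z (-‿cong (*-congˡ N-z))) ⟩
          (((p + γ * norm² y) - c * (N + γ * p) - c * (N + γ * p) + c * c * Q)
            - γ * (norm² y - c * p - c * p + c * c * N)) + (c * N - p)
            ≈⟨ solve 6 (λ p g Y c N Q →
                 (((p :+ g :* Y) :- c :* (N :+ g :* p) :- c :* (N :+ g :* p) :+ c :* c :* Q)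
                   :- g :* (Y :- c :* p :- c :* p :+ c :* c :* N)) :+ (c :* N :- p)
                 := c :* (c :* (Q :- g :* N) :- con (+ 1) :* N)) refl p γ (norm² y) c N Q ⟩
          c * (c * (Q - γ * N) - 1# * N)
            ≈⟨ *-congˡ (+-congˡ (-‿cong (*-congʳ (inverseʳ c (0<⇒≉0 0<c))))) ⟨
          c * (c * (Q - γ * N) - c * c⁻¹ * N)
            ≈⟨ solve 5 (λ c Q g N e → c :* (c :* (Q :- g :* N) :- c :* e :* N)
                 := c :* (c :* (Q :- (g :+ e) :* N))) refl c Q γ N c⁻¹ ⟩
          c * (c * (Q - (γ + c⁻¹) * N)) ∎

  -- The vector `w` excludes dimension zero, where no Rayleigh quotient would bound the lower
  -- bounds.
  minEigenvalue : ∀ {n} {A : Mat n} → Symmetric A → ∀ w → 0# < norm² w →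
                  ∃[ γ ] IsMinEigenvalue ℝ A γ × LowerBound A γ
  minEigenvalue {A = A} A-sym w 0<w =
    let γ , γ-lb , γ-upper = Rayleigh.greatestLowerBound A w 0<w
    in γ , (γ-eigenvalue A-sym γ-lb γ-upper , λ μ → lowerBound-below-eigenvalue A γ-lb) , γ-lb

-- The least eigenvalue of an adjacency matrix and the Delsarte bound

module AdjacencySpectrum (ℝ : CompleteOrderedField) where
  open CompleteOrderedField ℝ hiding (zero; sum)
  open RingProperties ring
  open SemiringSum semiring
  open SetoidReasoning setoid
  open ℤSolver commutativeRing
  open FieldMatrices isField
  open OrderedField ℝ

  ones : ∀ {n} → Vector Carrier n
  ones _ = 1#

  square : ∀ {n} → Mat n → Mat n
  square A i j = A i · (λ l → A l j)

  -- For a regular graph of valency κ without triangles in which two vertices have at most one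
  -- common neighbour, this is the adjacency matrix of the relation "at distance at least 3".
  remote : ∀ {n} → Carrier → Mat n → Mat n
  remote κ A i j = ((1# + (κ - 1#) * δ i j) + - 1# * A i j) + - 1# * square A i j

  δ-sym : ∀ {n} → Symmetric (δ {n})
  δ-sym zero    zero    = refl
  δ-sym zero    (suc j) = refl
  δ-sym (suc i) zero    = refl
  δ-sym (suc i) (suc j) = δ-sym i j

  module _ {n : ℕ} {A : Mat n} {κ : Carrier} (A-sym : Symmetric A) where
    square-sym : Symmetric (square A)
    square-sym i j = sum-cong-≋ {n} λ l → trans (*-comm _ _) (*-cong (A-sym l j) (A-sym i l))

    remote-sym : Symmetric (remote κ A)
    remote-sym i j = +-cong (+-cong (+-congˡ (*-congˡ (δ-sym i j))) (*-congˡ (A-sym i j)))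
                            (*-congˡ (square-sym i j))

    remote·ᵥ : ∀ x i → (remote κ A ·ᵥ x) i ≈
      ((ones · x + (κ - 1#) * x i) + - 1# * (A ·ᵥ x) i) + - 1# * (A ·ᵥ (A ·ᵥ x)) i
    remote·ᵥ x i = begin
      (remote κ A ·ᵥ x) i
        ≈⟨ ·-linearˡ (- 1#) x (λ j → (1# + (κ - 1#) * δ i j) + - 1# * A i j) (square A i) ⟩
      (λ j → (1# + (κ - 1#) * δ i j) + - 1# * A i j) · x + - 1# * (square A ·ᵥ x) i
        ≈⟨ +-cong (·-linearˡ (- 1#) x (λ j → 1# + (κ - 1#) * δ i j) (A i))
                  (*-congˡ (sym (·ᵥ-assoc A A x i))) ⟩
      ((λ j → 1# + (κ - 1#) * δ i j) · x + - 1# * (A ·ᵥ x) i) + - 1# * (A ·ᵥ (A ·ᵥ x)) i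
        ≈⟨ +-congʳ (+-congʳ (trans (·-linearˡ (κ - 1#) x ones (δ i)) (+-congˡ (*-congˡ (δ·ᵥ x i))))) ⟩
      ((ones · x + (κ - 1#) * x i) + - 1# * (A ·ᵥ x) i) + - 1# * (A ·ᵥ (A ·ᵥ x)) i ∎

    ·ᵥ-scale : ∀ {x y μ} → (∀ i → x i ≈ μ * y i) → ∀ i → (A ·ᵥ x) i ≈ μ * (A ·ᵥ y) i
    ·ᵥ-scale {x} {y} {μ} x≈μy i = begin
      A i · x                          ≈⟨ sum-cong-≋ {n} (λ j → trans (*-congˡ (x≈μy j))
        (solve 3 (λ a m y → a :* (m :* y) := m :* (a :* y)) refl (A i j) μ (y j))) ⟩
      sum (λ j → μ * (A i j * y j))    ≈⟨ *-distribˡ-sum μ (λ j → A i j * y j) ⟨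
      μ * A i · y                      ∎

    module _ (regular : ∀ i → (A ·ᵥ ones) i ≈ κ) where
      -- The rows of J, I, A and A² sum to v, 1, κ and κ²; here v appears as `ones · ones`.
      remote-regular : ∀ i → (remote κ A ·ᵥ ones) i ≈ (ones {n} · ones) - 1# - κ * κ
      remote-regular i = begin
        (remote κ A ·ᵥ ones) i
          ≈⟨ remote·ᵥ ones i ⟩
        ((ones {n} · ones + (κ - 1#) * 1#) + - 1# * (A ·ᵥ ones) i) + - 1# * (A ·ᵥ (A ·ᵥ ones)) i
          ≈⟨ +-cong (+-congˡ (*-congˡ (regular i)))
                    (*-congˡ (trans (·ᵥ-scale (λ j → trans (regular j) (sym (*-identityʳ κ))) i)
                                    (*-congˡ (regular i)))) ⟩
        ((ones {n} · ones + (κ - 1#) * 1#) + - 1# * κ) + - 1# * (κ * κ)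
          ≈⟨ solve 2 (λ s k → ((s :+ (k :- con (+ 1)) :* con (+ 1)) :+ :- con (+ 1) :* k)
               :+ :- con (+ 1) :* (k :* k) := s :- con (+ 1) :- k :* k) refl (ones {n} · ones) κ ⟩
        (ones {n} · ones) - 1# - κ * κ ∎

      module _ {x : Vector Carrier n} {μ : Carrier} (Ax≈μx : ∀ i → (A ·ᵥ x) i ≈ μ * x i) where
        -- Self-adjointness evaluates the pairing of `ones` with `A ·ᵥ x` in two ways. For μ ≠ κ the
        -- eigenvector is thus annihilated by J, which drops out of `remote`.
        [κ-μ]sum≈0 : (κ - μ) * ones · x ≈ 0#
        [κ-μ]sum≈0 = begin
          (κ - μ) * ones · x               ≈⟨ solve 3 (λ k m s → (k :- m) :* s := k :* s :- m :* s)
                                                refl κ μ (ones · x) ⟩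
          κ * ones · x - μ * ones · x      ≈⟨ +-congʳ κ≈μ ⟩
          μ * ones · x - μ * ones · x      ≈⟨ -‿inverseʳ _ ⟩
          0#                               ∎
          where
          κ≈μ : κ * ones · x ≈ μ * ones · x
          κ≈μ = begin
            κ * ones · x                   ≈⟨ *-distribˡ-sum κ (λ i → 1# * x i) ⟩
            sum (λ i → κ * (1# * x i))     ≈⟨ sum-cong-≋ {n} (λ i → trans
              (solve 2 (λ k x → k :* (con (+ 1) :* x) := x :* k) refl κ (x i))
              (*-congˡ (sym (regular i)))) ⟩
            x · (A ·ᵥ ones)                ≈⟨ self-adjoint A-sym x ones ⟩
            ones · (A ·ᵥ x)                ≈⟨ sum-cong-≋ {n} (λ i → trans (*-congˡ (Ax≈μx i))
              (solve 2 (λ m x → con (+ 1) :* (m :* x) := m :* (con (+ 1) :* x)) refl μ (x i))) ⟩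
            sum (λ i → μ * (1# * x i))     ≈⟨ *-distribˡ-sum μ (λ i → 1# * x i) ⟨
            μ * ones · x                   ∎

        remote-eigenvector : ones · x ≈ 0# → ∀ i →
                             (remote κ A ·ᵥ x) i ≈ - (1# - κ + μ + μ * μ) * x i
        remote-eigenvector S≈0 i = begin
          (remote κ A ·ᵥ x) i
            ≈⟨ remote·ᵥ x i ⟩
          ((ones · x + (κ - 1#) * x i) + - 1# * (A ·ᵥ x) i) + - 1# * (A ·ᵥ (A ·ᵥ x)) i
            ≈⟨ +-cong (+-cong (+-congʳ S≈0) (*-congˡ (Ax≈μx i)))
                      (*-congˡ (trans (·ᵥ-scale Ax≈μx i) (*-congˡ (Ax≈μx i)))) ⟩
          ((0# + (κ - 1#) * x i) + - 1# * (μ * x i)) + - 1# * (μ * (μ * x i))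
            ≈⟨ solve 3 (λ k m x → ((con (+ 0) :+ (k :- con (+ 1)) :* x) :+ :- con (+ 1) :* (m :* x))
                 :+ :- con (+ 1) :* (m :* (m :* x))
                 := :- (con (+ 1) :- k :+ m :+ m :* m) :* x) refl κ μ (x i) ⟩
          - (1# - κ + μ + μ * μ) * x i ∎

  -- Σ_ij E_ij (x_i + x_j)² = 2 (r - θ) |x|².
  nonneg-spectrum : ∀ {n} {E : Mat n} {r θ x} → Symmetric E → (∀ i j → 0# ≤ E i j) →
    (∀ i → (E ·ᵥ ones) i ≈ r) → (∀ i → (E ·ᵥ x) i ≈ - θ * x i) → 0# < norm² x → 0# ≤ r - θ
  nonneg-spectrum {n} {E} {r} {θ} {x} E-sym 0≤E E-regular Ex≈-θx 0<N =
    *-cancel-0≤ 0<N (halve (0≤-resp identity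
      (sum-0≤ λ i → sum-0≤ λ j → 0≤*0≤ (0≤E i j) (0≤-resp
        (solve 2 (λ x y → (x :+ y) :* (x :+ y) := (y :* y :+ (x :* x) :* con (+ 1)) :+ (x :+ x) :* y)
           refl (x i) (x j)) (0≤x² (x i + x j))))))
    where
    x² : Vector Carrier n
    x² i = x i * x i
    N : Carrier
    N = norm² x

    row : ∀ i → E i · (λ j → (x j * x j + x² i * 1#) + (x i + x i) * x j) ≈
                (1# * (E ·ᵥ x²) i + r * x² i) + - (θ + θ) * x² i
    row i = begin
      E i · (λ j → (x j * x j + x² i * 1#) + (x i + x i) * x j)
        ≈⟨ ·-linearʳ (x i + x i) (E i) (λ j → x j * x j + x² i * 1#) x ⟩
      E i · (λ j → x j * x j + x² i * 1#) + (x i + x i) * (E ·ᵥ x) i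
        ≈⟨ +-cong (·-linearʳ (x² i) (E i) x² ones) (*-congˡ (Ex≈-θx i)) ⟩
      (E ·ᵥ x²) i + x² i * (E ·ᵥ ones) i + (x i + x i) * (- θ * x i)
        ≈⟨ +-congʳ (+-congˡ (*-congˡ (E-regular i))) ⟩
      (E ·ᵥ x²) i + x² i * r + (x i + x i) * (- θ * x i)
        ≈⟨ solve 4 (λ e x r t → e :+ (x :* x) :* r :+ (x :+ x) :* (:- t :* x)
             := (con (+ 1) :* e :+ r :* (x :* x)) :+ :- (t :+ t) :* (x :* x)) refl ((E ·ᵥ x²) i) (x i) r θ ⟩
      (1# * (E ·ᵥ x²) i + r * x² i) + - (θ + θ) * x² i ∎

    identity : sum (λ i → E i · (λ j → (x j * x j + x² i * 1#) + (x i + x i) * x j)) ≈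
               N * (r - θ) + N * (r - θ)
    identity = begin
      sum (λ i → E i · (λ j → (x j * x j + x² i * 1#) + (x i + x i) * x j))
        ≈⟨ sum-cong-≋ {n} row ⟩
      sum (λ i → (1# * (E ·ᵥ x²) i + r * x² i) + - (θ + θ) * x² i)
        ≈⟨ sum-linear (- (θ + θ)) (λ i → 1# * (E ·ᵥ x²) i + r * x² i) x² ⟩
      sum (λ i → 1# * (E ·ᵥ x²) i + r * x² i) + - (θ + θ) * N
        ≈⟨ +-congʳ (sum-linear r (λ i → 1# * (E ·ᵥ x²) i) x²) ⟩
      ones · (E ·ᵥ x²) + r * N + - (θ + θ) * N
        ≈⟨ +-congʳ (+-congʳ (trans (self-adjoint E-sym ones x²) (trans
             (sum-cong-≋ {n} (λ i → trans (*-congˡ (E-regular i)) (*-comm (x² i) r)))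
             (sym (*-distribˡ-sum r x²))))) ⟩
      r * N + r * N + - (θ + θ) * N
        ≈⟨ solve 3 (λ r N t → r :* N :+ r :* N :+ :- (t :+ t) :* N
             := N :* (r :- t) :+ N :* (r :- t)) refl r N θ ⟩
      N * (r - θ) + N * (r - θ) ∎

  -- With k = ρ + 1 and v = ρ (2 ρ + 1), an eigenvalue μ ≤ -k would give
  -- 0 ≤ (v - 1 - k²) - (1 - k + μ + μ²) = - (ρ + 2) - (- k - μ) (k - 1 - μ).
  eigenvalue>-k : ∀ {n} {A : Mat n} ρ {μ} → Symmetric A → 0# ≤ ρ →
    (∀ i → (A ·ᵥ ones) i ≈ 1# + ρ) → ones {n} · ones ≈ ρ * (1# + ρ + ρ) →
    (∀ i j → 0# ≤ remote (1# + ρ) A i j) →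
    IsEigenvalue ℝ A μ → 0# < (1# + ρ) + μ
  eigenvalue>-k {n} {A} ρ {μ} A-sym 0≤ρ regular order 0≤E (x , x≉0 , Ax≈μx) =
    [ (λ 0≤-κ-μ → contradiction (0≤-deficit 0≤-κ-μ) (0<⇒¬0≤- (0<+0≤ 0<1 (inj₁ 0<κ))))
    , <-resp refl (-‿involutive _)
    ]′ (sign (- (κ + μ)))
    where
    κ : Carrier
    κ = 1# + ρ
    0<κ : 0# < κ
    0<κ = 0<+0≤ 0<1 0≤ρ
    0<κ-μ : 0# ≤ - (κ + μ) → 0# < κ - μ
    0<κ-μ 0≤-κ-μ = <-resp refl (solve 2 (λ k m → k :+ k :+ :- (k :+ m) := k :- m) refl κ μ)
      (0<+0≤ (0<+0≤ 0<κ (inj₁ 0<κ)) 0≤-κ-μ)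
    remote-bound : 0# ≤ - (κ + μ) →
      0# ≤ (ones {n} · ones - 1# - κ * κ) - (1# - κ + μ + μ * μ)
    remote-bound 0≤-κ-μ = nonneg-spectrum (remote-sym A-sym) 0≤E (remote-regular A-sym regular)
      (remote-eigenvector A-sym regular Ax≈μx
        (Plane.*-cancel-0 isField (0<⇒≉0 (0<κ-μ 0≤-κ-μ)) ([κ-μ]sum≈0 A-sym regular Ax≈μx)))
      (0<norm² x≉0)
    deficit : (ρ * (1# + ρ + ρ) - 1# - κ * κ) - (1# - κ + μ + μ * μ) +
              - (κ + μ) * (- (κ + μ) + ρ + κ) ≈ - (1# + κ)
    deficit = solve 2 (λ r m →
        (r :* (con (+ 1) :+ r :+ r) :- con (+ 1) :- (con (+ 1) :+ r) :* (con (+ 1) :+ r))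
          :- (con (+ 1) :- (con (+ 1) :+ r) :+ m :+ m :* m)
          :+ (:- ((con (+ 1) :+ r) :+ m)) :* (:- ((con (+ 1) :+ r) :+ m) :+ r :+ (con (+ 1) :+ r))
        := :- (con (+ 1) :+ (con (+ 1) :+ r))) refl ρ μ
    0≤-deficit : 0# ≤ - (κ + μ) → 0# ≤ - (1# + κ)
    0≤-deficit 0≤-κ-μ = 0≤-resp (trans (+-congʳ (+-congʳ (+-congʳ (+-congʳ order)))) deficit)
      (0≤+0≤ (remote-bound 0≤-κ-μ) (0≤*0≤ 0≤-κ-μ (0≤+0≤ (0≤+0≤ 0≤-κ-μ 0≤ρ) (inj₁ 0<κ))))

  -- The difference 1 - κ/γ - 2 equals (κ + γ) (-1/γ), a product of two positive numbers.
  2<1-κ/γ : ∀ {κ γ} (γ≉0 : ¬ (γ ≈ 0#)) → 0# < - γ → 0# < κ + γ →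
            fromℕ 2 < 1# - κ * inv γ γ≉0
  2<1-κ/γ {κ} {γ} γ≉0 0<-γ 0<κ+γ = 0<⇒< (<-resp refl (begin
    (κ + γ) * - γ⁻¹
      ≈⟨ solve 3 (λ k g i → (k :+ g) :* (:- i) := :- (g :* i) :- k :* i) refl κ γ γ⁻¹ ⟩
    - (γ * γ⁻¹) - κ * γ⁻¹
      ≈⟨ +-congʳ (-‿cong (inverseʳ γ γ≉0)) ⟩
    - 1# - κ * γ⁻¹
      ≈⟨ solve 1 (λ t → :- con (+ 1) :- t :=
           con (+ 1) :- t :- (con (+ 1) :+ (con (+ 1) :+ con (+ 0)))) refl (κ * γ⁻¹) ⟩
    1# - κ * γ⁻¹ - fromℕ 2 ∎) (*-pos 0<κ+γ 0<-γ⁻¹))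
    where
    γ⁻¹ : Carrier
    γ⁻¹ = inv γ γ≉0
    0<-γ⁻¹ : 0# < - γ⁻¹
    0<-γ⁻¹ = 0≤∧≉0⇒0<
      (*-cancel-0≤ 0<-γ (0≤-resp
        (trans (sym (inverseʳ γ γ≉0)) (solve 2 (λ g i → g :* i := (:- g) :* (:- i)) refl γ γ⁻¹))
        (inj₁ 0<1)))
      (λ -i≈0 → 1≉0 (begin
        1#             ≈⟨ inverseʳ γ γ≉0 ⟨
        γ * γ⁻¹        ≈⟨ solve 2 (λ g i → g :* i := (:- g) :* (:- i)) refl γ γ⁻¹ ⟩
        - γ * - γ⁻¹    ≈⟨ *-congˡ -i≈0 ⟩
        - γ * 0#       ≈⟨ zeroʳ _ ⟩
        0#             ∎))

  -- An edge supplies the test vector: its value is negative, so the vector is non-zero and every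
  -- lower bound of the Rayleigh quotients is negative. This is why the least eigenvalue may be
  -- inverted.
  edge-form : ∀ {n} {A : Mat n} {a b} → A a a ≈ 0# → A b b ≈ 0# → A a b ≈ 1# → A b a ≈ 1# →
              form A (λ i → δ a i + - 1# * δ b i) ≈ - (1# + 1#)
  edge-form {n} {A} {a} {b} aa bb ab ba = begin
    w · (A ·ᵥ w)                                    ≈⟨ w· (A ·ᵥ w) ⟩
    (A ·ᵥ w) a + - 1# * (A ·ᵥ w) b
      ≈⟨ +-cong (trans (·-comm (A a) w) (w· (A a))) (*-congˡ (trans (·-comm (A b) w) (w· (A b)))) ⟩
    (A a a + - 1# * A a b) + - 1# * (A b a + - 1# * A b b)
      ≈⟨ +-cong (+-cong aa (*-congˡ ab)) (*-congˡ (+-cong ba (*-congˡ bb))) ⟩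
    (0# + - 1# * 1#) + - 1# * (1# + - 1# * 0#)
      ≈⟨ solve 0 ((con (+ 0) :+ :- con (+ 1) :* con (+ 1)) :+ :- con (+ 1) :* (con (+ 1) :+ :- con (+ 1) :* con (+ 0))
           := :- (con (+ 1) :+ con (+ 1))) refl ⟩
    - (1# + 1#) ∎
    where
    w : Vector Carrier n
    w i = δ a i + - 1# * δ b i
    w· : ∀ v → w · v ≈ v a + - 1# * v b
    w· v = trans (·-linearˡ (- 1#) v (δ a) (δ b)) (+-cong (δ·ᵥ v a) (*-congˡ (δ·ᵥ v b)))

  smallEigenvalue : ∀ {n} {A : Mat n} ρ → Symmetric A → 0# ≤ ρ →
    (∀ i → (A ·ᵥ ones) i ≈ 1# + ρ) → ones {n} · ones ≈ ρ * (1# + ρ + ρ) →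
    (∀ i j → 0# ≤ remote (1# + ρ) A i j) →
    ∀ {a b} → A a a ≈ 0# → A b b ≈ 0# → A a b ≈ 1# →
    ∃[ γ ] IsMinEigenvalue ℝ A γ ×
      (Σ (¬ (γ ≈ 0#)) λ γ≉0 → fromℕ 2 < 1# - (1# + ρ) * inv γ γ≉0)
  smallEigenvalue {n} {A} ρ A-sym 0≤ρ regular order 0≤E {a} {b} aa bb ab =
    let γ , γ-min , γ-lb = minEigenvalue A-sym w (0<norm² w≉0)
        0<-γ = negative γ γ-lb
        γ≉0 : ¬ (γ ≈ 0#)
        γ≉0 γ≈0 = 0<⇒≉0 0<-γ (trans (-‿cong γ≈0) (trans (sym (+-identityˡ _)) (-‿inverseʳ 0#)))
    in γ , γ-min , γ≉0 , 2<1-κ/γ γ≉0 0<-γ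
         (eigenvalue>-k ρ A-sym 0≤ρ regular order 0≤E (proj₁ γ-min))
    where
    w : Vector Carrier n
    w i = δ a i + - 1# * δ b i

    form-w : form A w ≈ - (1# + 1#)
    form-w = edge-form {A = A} aa bb ab (trans (A-sym b a) ab)

    0<2 : 0# < 1# + 1#
    0<2 = 0<+0≤ 0<1 (inj₁ 0<1)

    w≉0 : ¬ (∀ i → w i ≈ 0#)
    w≉0 w≈0 = 0<⇒¬0≤- 0<2 (inj₂ (begin
      0#           ≈⟨ ·-zeroʳ (A ·ᵥ w) {w} w≈0 ⟨
      (A ·ᵥ w) · w ≈⟨ ·-comm (A ·ᵥ w) w ⟩
      form A w        ≈⟨ form-w ⟩
      - (1# + 1#)  ∎))

    negative : ∀ γ → LowerBound A γ → 0# < - γ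
    negative γ γ-lb = [ (λ 0≤γ → contradiction
      (0≤-resp (trans (+-congʳ (+-congʳ form-w))
        (solve 2 (λ g N → (:- (con (+ 1) :+ con (+ 1)) :- g :* N) :+ g :* N
           := :- (con (+ 1) :+ con (+ 1))) refl γ (norm² w)))
        (0≤+0≤ (γ-lb w) (0≤*0≤ 0≤γ (0≤norm² w))))
      (0<⇒¬0≤- 0<2)) , (λ 0<-γ → 0<-γ) ]′ (sign γ)

-- Finite setoids

module _ {S T : Setoid 0ℓ 0ℓ} where
  private
    module S = Setoid S
    module T = Setoid T

  mkInverse : (to : S.Carrier → T.Carrier) (from : T.Carrier → S.Carrier) →
    (∀ {x y} → x S.≈ y → to x T.≈ to y) → (∀ {x y} → x T.≈ y → from x S.≈ from y) →
    (∀ y → to (from y) T.≈ y) → (∀ x → from (to x) S.≈ x) → Inverse S T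
  mkInverse to from to-cong from-cong to∘from from∘to = record
    { to        = to
    ; from      = from
    ; to-cong   = to-cong
    ; from-cong = from-cong
    ; inverse   = (λ {x} y≈ → T.trans (to-cong y≈) (to∘from x))
                , (λ {x} y≈ → S.trans (from-cong y≈) (from∘to x))
    }

  bijection⇒inverse : (to : S.Carrier → T.Carrier) → (∀ {x y} → x S.≈ y → to x T.≈ to y) →
    (∀ {x y} → to x T.≈ to y → x S.≈ y) → (∀ y → ∃[ x ] to x T.≈ y) → Inverse S T
  bijection⇒inverse to cong inj onto = mkInverse to (λ y → proj₁ (onto y)) cong
    (λ {y} {y′} y≈y′ → inj (T.trans (proj₂ (onto y)) (T.trans y≈y′ (T.sym (proj₂ (onto y′))))))
    (λ y → proj₂ (onto y)) (λ x → inj (proj₂ (onto (to x))))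

  mapSize : ∀ {n} → Inverse S T → HasSize S n → HasSize T n
  mapSize S≅T e = Composition.inverse e S≅T

×-size : ∀ {S T : Setoid 0ℓ 0ℓ} {m n} → HasSize S m → HasSize T n → HasSize (S ×ₛ T) (m ℕ.* n)
×-size {S} {T} {m} {n} e f = Composition.inverse (*↔× {m} {n}) (mkInverse
  (λ (i , j) → E.to i , F.to j) (λ (x , y) → E.from x , F.from y)
  (λ { ≡.refl → S.refl , T.refl })
  (λ (x≈ , y≈) → ≡.cong₂ _,_ (E.from-cong x≈) (F.from-cong y≈))
  (λ (x , y) → E.strictlyInverseˡ x , F.strictlyInverseˡ y)
  (λ (i , j) → ≡.cong₂ _,_ (E.strictlyInverseʳ i) (F.strictlyInverseʳ j)))
  where
  module S = Setoid S
  module T = Setoid T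
  module E = Inverse e
  module F = Inverse f

size-unique : ∀ {S : Setoid 0ℓ 0ℓ} {m n} → HasSize S m → HasSize S n → m ≡ n
size-unique e f = ↔⇒≡ (Composition.inverse e (Symmetry.inverse f))

-- Pigeonhole: removing a missed value `j` from the codomain would squeeze `Fin (suc n)` injectively
-- into `Fin n`.
injective⇒surjective : ∀ {n} {f : Fin n → Fin n} → (∀ {i j} → f i ≡ f j → i ≡ j) →
                       ∀ j → ∃[ i ] f i ≡ j
injective⇒surjective {suc n} {f} f-inj j with any? (λ i → f i Finₚ.≟ j)
... | yes hit = hit
... | no miss = contradiction
  (injective⇒≤ {f = λ i → punchOut (j≢f i)} (λ {i} {i′} eq →
    f-inj (punchOut-injective (j≢f i) (j≢f i′) eq)))
  ℕₚ.1+n≰n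
  where
  j≢f : ∀ i → j ≢ f i
  j≢f i eq = miss (i , ≡.sym eq)

equalSize-surjective : ∀ {S T : Setoid 0ℓ 0ℓ} {n} → HasSize S n → HasSize T n →
  let module S = Setoid S ; module T = Setoid T in
  (g : S.Carrier → T.Carrier) → (∀ {x y} → g x T.≈ g y → x S.≈ y) → ∀ t → ∃[ x ] g x T.≈ t
equalSize-surjective {S} {T} e f g g-inj t =
  let i , eq = injective⇒surjective {f = λ i → F.from (g (E.to i))}
        (λ eq → ≡.trans (≡.sym (E.strictlyInverseʳ _)) (≡.trans
          (E.from-cong (g-inj (from-injective eq))) (E.strictlyInverseʳ _)))
        (F.from t)
  in E.to i , from-injective eq
  where
  module T = Setoid T
  module E = Inverse e
  module F = Inverse f
  from-injective : ∀ {t u} → F.from t ≡ F.from u → t T.≈ u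
  from-injective eq = T.trans (T.sym (F.strictlyInverseˡ _))
    (T.trans (F.to-cong eq) (F.strictlyInverseˡ _))

count : ∀ {n} {P : Fin n → Set} → Unary.Decidable P → ℕ
count {zero}  P? = zero
count {suc n} P? with P? zero
... | yes _ = suc (count (P? ∘ suc))
... | no  _ = count (P? ∘ suc)

count-complement : ∀ {n} {P : Fin n → Set} (P? : Unary.Decidable P) →
                   count P? ℕ.+ count (¬? ∘ P?) ≡ n
count-complement {zero}  P? = ≡.refl
count-complement {suc n} P? with P? zero
... | yes _ = ≡.cong suc (count-complement (P? ∘ suc))
... | no  _ = ≡.trans (ℕₚ.+-suc _ _) (≡.cong suc (count-complement (P? ∘ suc)))

-- `index` enumerates the subset in increasing order and `rank` inverts it; `rank-cong` makes the
-- rank independent of the proof of membership.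
index : ∀ {n} {P : Fin n → Set} (P? : Unary.Decidable P) → Fin (count P?) → ∃ P
index {suc n} P? i with P? zero
index {suc n} P? zero    | yes p = zero , p
index {suc n} P? (suc i) | yes p = let j , pj = index (P? ∘ suc) i in suc j , pj
index {suc n} P? i       | no  _ = let j , pj = index (P? ∘ suc) i in suc j , pj

rank : ∀ {n} {P : Fin n → Set} (P? : Unary.Decidable P) i → P i → Fin (count P?)
rank {suc n} P? i p with P? zero
rank {suc n} P? zero    p | yes _ = zero
rank {suc n} P? (suc i) p | yes _ = suc (rank (P? ∘ suc) i p)
rank {suc n} P? zero    p | no ¬p = contradiction p ¬p
rank {suc n} P? (suc i) p | no _  = rank (P? ∘ suc) i p

rank-cong : ∀ {n} {P : Fin n → Set} (P? : Unary.Decidable P) {i j} p p′ →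
            i ≡ j → rank P? i p ≡ rank P? j p′
rank-cong {suc n} P? p p′ eq with P? zero
rank-cong {suc n} P? {zero}  p p′ ≡.refl | yes _ = ≡.refl
rank-cong {suc n} P? {suc i} p p′ ≡.refl | yes _ = ≡.cong suc (rank-cong (P? ∘ suc) p p′ ≡.refl)
rank-cong {suc n} P? {zero}  p p′ ≡.refl | no ¬p = contradiction p ¬p
rank-cong {suc n} P? {suc i} p p′ ≡.refl | no _  = rank-cong (P? ∘ suc) p p′ ≡.refl

index-rank : ∀ {n} {P : Fin n → Set} (P? : Unary.Decidable P) i p →
             proj₁ (index P? (rank P? i p)) ≡ i
index-rank {suc n} P? i p with P? zero
index-rank {suc n} P? zero    p | yes _ = ≡.refl
index-rank {suc n} P? (suc i) p | yes _ = ≡.cong suc (index-rank (P? ∘ suc) i p)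
index-rank {suc n} P? zero    p | no ¬p = contradiction p ¬p
index-rank {suc n} P? (suc i) p | no _  = ≡.cong suc (index-rank (P? ∘ suc) i p)

rank-index : ∀ {n} {P : Fin n → Set} (P? : Unary.Decidable P) k →
             rank P? (proj₁ (index P? k)) (proj₂ (index P? k)) ≡ k
rank-index {suc n} P? k with P? zero
rank-index {suc n} P? zero    | yes _ = ≡.refl
rank-index {suc n} P? (suc k) | yes _ = ≡.cong suc (rank-index (P? ∘ suc) k)
rank-index {suc n} P? k       | no _  = rank-index (P? ∘ suc) k

SubSetoid-⇔ : ∀ {S : Setoid 0ℓ 0ℓ} {P Q : Setoid.Carrier S → Set} →
  (∀ x → P x → Q x) → (∀ x → Q x → P x) → Inverse (SubSetoid S P) (SubSetoid S Q)
SubSetoid-⇔ {S} P⇒Q Q⇒P = mkInverse (λ (x , p) → x , P⇒Q x p) (λ (x , p) → x , Q⇒P x p)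
  (λ x≈y → x≈y) (λ x≈y → x≈y) (λ _ → refl) (λ _ → refl)
  where open Setoid S

module Finite {S : Setoid 0ℓ 0ℓ} {n : ℕ} (e : HasSize S n) where
  open Setoid S
  open Inverse e

  infix 4 _≟_
  _≟_ : Decidable _≈_
  x ≟ y = map′ (λ eq → trans (sym (strictlyInverseˡ x)) (trans (to-cong eq) (strictlyInverseˡ y)))
               from-cong (from x Finₚ.≟ from y)

  module _ {P : Carrier → Set} (resp : P Respects _≈_) (P? : Unary.Decidable P) where
    ∃? : Dec (∃ P)
    ∃? = map′ (λ (i , p) → to i , p) (λ (x , p) → from x , resp (sym (strictlyInverseˡ x)) p)
              (any? (P? ∘ to))

  subsetSize : ∀ {P : Carrier → Set} → P Respects _≈_ → (P? : Unary.Decidable P) →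
               HasSize (SubSetoid S P) (count (P? ∘ to))
  subsetSize {P} resp P? = mkInverse
    (λ k → let i , p = index (P? ∘ to) k in to i , p)
    (λ (x , p) → rank (P? ∘ to) (from x) (resp (sym (strictlyInverseˡ x)) p))
    (λ { ≡.refl → refl })
    (λ x≈y → rank-cong (P? ∘ to) _ _ (from-cong x≈y))
    (λ (x , p) → trans (to-cong (index-rank (P? ∘ to) (from x) _)) (strictlyInverseˡ x))
    (λ k → ≡.trans (rank-cong (P? ∘ to) _ _ (strictlyInverseʳ _)) (rank-index (P? ∘ to) k))

  complementSize : ∀ {P : Carrier → Set} → P Respects _≈_ → Unary.Decidable P →
    ∀ {m} → HasSize (SubSetoid S P) m → ∃[ m′ ] HasSize (SubSetoid S (¬_ ∘ P)) m′ × m ℕ.+ m′ ≡ n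
  complementSize {P} resp P? {m} em =
    _ , subsetSize (λ x≈y ¬p p → ¬p (resp (sym x≈y) p)) (¬? ∘ P?) ,
    ≡.trans (≡.cong (ℕ._+ _) (size-unique em (subsetSize resp P?))) (count-complement (P? ∘ to))

  -- Each fibre {x, σ x} contains exactly one element that precedes its partner in the enumeration.
  module _ {T : Setoid 0ℓ 0ℓ} (f : Carrier → Setoid.Carrier T) (σ : Carrier → Carrier) where
    private module T = Setoid T

    twoToOne-image : (∀ {x y} → x ≈ y → f x T.≈ f y) → (∀ {x y} → x ≈ y → σ x ≈ σ y) →
      (∀ x → σ (σ x) ≈ x) → (∀ x → ¬ (σ x ≈ x)) → (∀ x → f (σ x) T.≈ f x) →
      (∀ {x y} → f x T.≈ f y → x ≈ y ⊎ x ≈ σ y) →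
      ∃[ m ] HasSize (SubSetoid T (λ t → ∃[ x ] f x T.≈ t)) m × m ℕ.+ m ≡ n
    twoToOne-image f-cong σ-cong σσ σ≉ fσ fibre =
      let m′ , highs , m+m′≡n = complementSize low-resp low? lows
          m≡m′ = size-unique (mapSize low≅high lows) highs
      in _ , mapSize low≅image lows , ≡.trans (≡.cong (count (low? ∘ to) ℕ.+_) m≡m′) m+m′≡n
      where
      Low : Carrier → Set
      Low x = from x Fin.< from (σ x)

      low? : Unary.Decidable Low
      low? x = from x Finₚ.<? from (σ x)

      low-resp : Low Respects _≈_
      low-resp x≈y = ≡.subst₂ Fin._<_ (from-cong x≈y) (from-cong (σ-cong x≈y))

      lows : HasSize (SubSetoid S Low) _
      lows = subsetSize low-resp low?

      low⇒σ-high : ∀ {x} → Low x → ¬ Low (σ x)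
      low⇒σ-high {x} l l′ =
        Finₚ.<-asym l (≡.subst (from (σ x) Fin.<_) (from-cong (σσ x)) l′)

      high⇒σ-low : ∀ {x} → ¬ Low x → Low (σ x)
      high⇒σ-low {x} ¬l with Finₚ.<-cmp (from x) (from (σ x))
      ... | tri< l _ _ = contradiction l ¬l
      ... | tri≈ _ eq _ = contradiction
        (trans (sym (strictlyInverseˡ (σ x))) (trans (to-cong (≡.sym eq)) (strictlyInverseˡ x))) (σ≉ x)
      ... | tri> _ _ g = ≡.subst (from (σ x) Fin.<_) (≡.sym (from-cong (σσ x))) g

      -- The involution exchanges the two classes, so each of them is half of the setoid.
      low≅high : Inverse (SubSetoid S Low) (SubSetoid S (¬_ ∘ Low))
      low≅high = mkInverse (λ (x , l) → σ x , low⇒σ-high l) (λ (x , ¬l) → σ x , high⇒σ-low ¬l)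
        σ-cong σ-cong (λ (x , _) → σσ x) (λ (x , _) → σσ x)

      representative : ∀ x → ∃[ y ] Low y × f y T.≈ f x
      representative x with low? x
      ... | yes l = x , l , T.refl
      ... | no ¬l = σ x , high⇒σ-low ¬l , fσ x

      f-injective-on-low : ∀ {x y} → Low x → Low y → f x T.≈ f y → x ≈ y
      f-injective-on-low {x} {y} lx ly fx≈fy with fibre fx≈fy
      ... | inj₁ x≈y  = x≈y
      ... | inj₂ x≈σy = contradiction (low-resp x≈σy lx) (low⇒σ-high ly)

      low≅image : Inverse (SubSetoid S Low) (SubSetoid T (λ t → ∃[ x ] f x T.≈ t))
      low≅image = mkInverse (λ (x , _) → f x , x , T.refl)
        (λ (t , x , _) → let y , l , _ = representative x in y , l)
        f-cong
        (λ {(t , x , fx≈t)} {(t′ , x′ , fx′≈t′)} t≈t′ →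
          let y , l , fy≈fx = representative x ; y′ , l′ , fy′≈fx′ = representative x′ in
          f-injective-on-low l l′ (T.trans fy≈fx (T.trans fx≈t (T.trans t≈t′
            (T.trans (T.sym fx′≈t′) (T.sym fy′≈fx′))))))
        (λ (t , x , fx≈t) → T.trans (proj₂ (proj₂ (representative x))) fx≈t)
        (λ (x , l) → let y , l′ , fy≈fx = representative x in f-injective-on-low l′ l fy≈fx)

-- Finite fields of characteristic 5

module FiniteFields (F : Field) where
  open Field F hiding (zero)
  open RingProperties ring
  open ℤSolver commutativeRing
  open SetoidReasoning setoid
  open Plane F public using (*-cancel-0; inv≉0)

  module _ {q : ℕ} (e : HasSize setoid q) where
    open SemiringMult semiring using (×1-homo-*) renaming (_×_ to _⋆_)
    open SemiringSum semiring
    open Inverse e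
    open Finite e using (_≟_)

    -- Translation by 1 permutes the field, so the sum of all elements equals itself plus q.
    size·1≈0 : q ⋆ 1# ≈ 0#
    size·1≈0 = begin
      q ⋆ 1#                          ≈⟨ solve 2 (λ s t → t := (s :+ t) :- s) refl (sum to) (q ⋆ 1#) ⟩
      (sum to + q ⋆ 1#) - sum to      ≈⟨ +-congʳ shifted ⟨
      sum to - sum to                  ≈⟨ -‿inverseʳ (sum to) ⟩
      0#                               ∎
      where
      shift : Carrier → Fin q → Fin q
      shift a i = from (to i + a)
      shift-shift : ∀ a b → a + b ≈ 0# → ∀ i → shift a (shift b i) ≡ i
      shift-shift a b a+b≈0 i = ≡.trans (from-cong (begin
        to (from (to i + b)) + a     ≈⟨ +-congʳ (strictlyInverseˡ _) ⟩
        to i + b + a                 ≈⟨ solve 3 (λ x a b → x :+ b :+ a := x :+ (a :+ b)) refl (to i) a b ⟩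
        to i + (a + b)               ≈⟨ +-congˡ a+b≈0 ⟩
        to i + 0#                    ≈⟨ +-identityʳ _ ⟩
        to i                         ∎)) (strictlyInverseʳ i)
      π : Inverse (≡.setoid (Fin q)) (≡.setoid (Fin q))
      π = mkInverse (shift 1#) (shift (- 1#)) (≡.cong _) (≡.cong _)
        (shift-shift _ _ (-‿inverseʳ 1#)) (shift-shift _ _ (-‿inverseˡ 1#))
      shifted : sum to ≈ sum to + q ⋆ 1#
      shifted = begin
        sum to                          ≈⟨ sum-permute to π ⟩
        sum (λ i → to (shift 1# i))     ≈⟨ sum-cong-≋ {q} (λ i → strictlyInverseˡ _) ⟩
        sum (λ i → to i + 1#)           ≈⟨ ∑-distrib-+ to (λ _ → 1#) ⟩
        sum to + sum {q} (λ _ → 1#)     ≈⟨ +-congˡ (sum-replicate q) ⟩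
        sum to + q ⋆ 1#                ∎

    -- The multiple by a product is the product of the multiples of `1#`, and a field has no zero
    -- divisors.
    p^n·1≈0⇒p·1≈0 : ∀ p n → (p ℕ.^ n) ⋆ 1# ≈ 0# → p ⋆ 1# ≈ 0#
    p^n·1≈0⇒p·1≈0 p zero    1≈0 = contradiction (trans (sym (+-identityʳ 1#)) 1≈0) 1≉0
    p^n·1≈0⇒p·1≈0 p (suc n) eq with p ⋆ 1# ≟ 0#
    ... | yes p≈0 = p≈0
    ... | no  p≉0 = p^n·1≈0⇒p·1≈0 p n
      (*-cancel-0 p≉0 (trans (sym (×1-homo-* p (p ℕ.^ n))) eq))

    size5^n⇒5≈0 : ∀ {n} → q ≡ 5 ℕ.^ n → fromℤ (+ 5) ≈ 0#
    size5^n⇒5≈0 {n} ≡.refl = trans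
      -- Passes from the optimised multiple inside `fromℤ` to the plain one in `size·1≈0`, which
      -- ends in `+ 0#`.
      (solve 0 (con (+ 5) := con (+ 1) :+ (con (+ 1) :+ (con (+ 1) :+ (con (+ 1) :+ (con (+ 1) :+ con (+ 0))))))
             refl)
      (p^n·1≈0⇒p·1≈0 5 n size·1≈0)

  -≈0 : ∀ {x y} → x ≈ y → x - y ≈ 0#
  -≈0 {x} {y} x≈y = trans (+-congʳ x≈y) (-‿inverseʳ y)

  -≈0⇒≈ : ∀ {x y} → x - y ≈ 0# → x ≈ y
  -≈0⇒≈ {x} {y} x-y≈0 = begin
    x          ≈⟨ solve 2 (λ x y → x := x :- y :+ y) refl x y ⟩
    x - y + y  ≈⟨ +-congʳ x-y≈0 ⟩
    0# + y     ≈⟨ +-identityˡ y ⟩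
    y          ∎

  -≉0 : ∀ {x y} → ¬ (x ≈ y) → ¬ (x - y ≈ 0#)
  -≉0 x≉y x-y≈0 = x≉y (-≈0⇒≈ x-y≈0)

  *-≉0 : ∀ {x y} → ¬ (x ≈ 0#) → ¬ (y ≈ 0#) → ¬ (x * y ≈ 0#)
  *-≉0 x≉0 y≉0 xy≈0 = y≉0 (*-cancel-0 x≉0 xy≈0)

  *-cancelˡ : ∀ {x y z} → ¬ (x ≈ 0#) → x * y ≈ x * z → y ≈ z
  *-cancelˡ {x} {y} {z} x≉0 eq = -≈0⇒≈ (*-cancel-0 x≉0
    (trans (solve 3 (λ x y z → x :* (y :- z) := x :* y :- x :* z) refl x y z) (-≈0 eq)))

  inv-cong : ∀ {x y} (x≉0 : ¬ (x ≈ 0#)) (y≉0 : ¬ (y ≈ 0#)) → x ≈ y → inv x x≉0 ≈ inv y y≉0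
  inv-cong x≉0 y≉0 x≈y = *-cancelˡ x≉0
    (trans (inverseʳ _ x≉0) (trans (sym (inverseʳ _ y≉0)) (*-congʳ (sym x≈y))))

  IsSquare NonSquare : Carrier → Set
  IsSquare x  = ∃[ s ] s * s ≈ x
  NonSquare x = ¬ IsSquare x

  isSquare-resp : IsSquare Respects _≈_
  isSquare-resp x≈y (s , s²≈x) = s , trans s²≈x x≈y

  nonSquare-resp : NonSquare Respects _≈_
  nonSquare-resp x≈y ¬x y = ¬x (isSquare-resp (sym x≈y) y)

  nonSquare-≉0 : ∀ {x} → NonSquare x → ¬ (x ≈ 0#)
  nonSquare-≉0 ¬x x≈0 = ¬x (0# , trans (zeroˡ 0#) (sym x≈0))

  isSquare-cancel : ∀ {x s} → ¬ (s ≈ 0#) → IsSquare (s * s * x) → IsSquare x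
  isSquare-cancel {x} {s} s≉0 (t , t²≈) = t * s⁻¹ , (begin
    t * s⁻¹ * (t * s⁻¹)       ≈⟨ solve 2 (λ t i → t :* i :* (t :* i) := t :* t :* (i :* i)) refl t s⁻¹ ⟩
    t * t * (s⁻¹ * s⁻¹)       ≈⟨ *-congʳ t²≈ ⟩
    s * s * x * (s⁻¹ * s⁻¹)   ≈⟨ solve 3 (λ s x i → s :* s :* x :* (i :* i) := (s :* i) :* (s :* i) :* x)
                                   refl s x s⁻¹ ⟩
    s * s⁻¹ * (s * s⁻¹) * x   ≈⟨ *-congʳ (*-cong (inverseʳ s s≉0) (inverseʳ s s≉0)) ⟩
    1# * 1# * x               ≈⟨ trans (*-congʳ (*-identityˡ 1#)) (*-identityˡ x) ⟩
    x                         ∎)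
    where
    s⁻¹ : Carrier
    s⁻¹ = inv s s≉0

  nonzero : Setoid 0ℓ 0ℓ
  nonzero = SubSetoid setoid (λ x → ¬ (x ≈ 0#))

  module Characteristic5 {q : ℕ} (e : HasSize setoid q) (5≈0 : fromℤ (+ 5) ≈ 0#) where
    open Finite e public using (_≟_)

    -- The solver sees only integer coefficients. An identity that holds modulo 5 is given to it
    -- with the explicit correction `5 w`, which is then discarded here.
    mod5 : ∀ {x y} w → x ≈ y + fromℤ (+ 5) * w → x ≈ y
    mod5 {x} {y} w eq = begin
      x                     ≈⟨ eq ⟩
      y + fromℤ (+ 5) * w   ≈⟨ +-congˡ (trans (*-congʳ 5≈0) (zeroˡ w)) ⟩
      y + 0#                ≈⟨ +-identityʳ y ⟩
      y                     ∎

    2≉0 : ¬ (fromℤ (+ 2) ≈ 0#)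
    2≉0 2≈0 = 1≉0 (begin
      1#                                ≈⟨ solve 0 (con (+ 1) := con (+ 5) :- con (+ 2) :* con (+ 2)) refl ⟩
      fromℤ (+ 5) - fromℤ (+ 2) * fromℤ (+ 2)  ≈⟨ +-cong 5≈0 (-‿cong (*-congʳ 2≈0)) ⟩
      0# - 0# * fromℤ (+ 2)             ≈⟨ solve 1 (λ t → con (+ 0) :- con (+ 0) :* t := con (+ 0)) refl _ ⟩
      0#                                ∎)

    isSquare-neg : ∀ {x} → IsSquare x → IsSquare (- x)
    isSquare-neg {x} (s , s²≈x) = fromℤ (+ 2) * s , trans
      (mod5 (s * s) (solve 1 (λ s → (con (+ 2) :* s) :* (con (+ 2) :* s) :=
         :- (s :* s) :+ con (+ 5) :* (s :* s)) refl s))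
      (-‿cong s²≈x)

    isSquare? : Unary.Decidable IsSquare
    isSquare? x = Finite.∃? e (λ s≈t s²≈x → trans (*-cong (sym s≈t) (sym s≈t)) s²≈x) (λ s → s * s ≟ x)

    ≉0-size : ∃[ m ] HasSize nonzero m × suc m ≡ q
    ≉0-size = Finite.complementSize e (λ x≈y x≈0 → trans (sym x≈y) x≈0) (λ x → x ≟ 0#) zeroSize
      where
      zeroSize : HasSize (SubSetoid setoid (λ x → x ≈ 0#)) 1
      zeroSize = mkInverse (λ _ → 0# , refl) (λ _ → Fin.zero) (λ _ → refl) (λ _ → ≡.refl)
        (λ (x , x≈0) → sym x≈0) (λ { Fin.zero → ≡.refl })

    square* : Setoid.Carrier nonzero → Setoid.Carrier nonzero
    square* (x , x≉0) = x * x , *-≉0 x≉0 x≉0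

    NonzeroSquare : Setoid.Carrier nonzero → Set
    NonzeroSquare t = ∃[ x ] proj₁ (square* x) ≈ proj₁ t

    -- Squaring is two-to-one on the non-zero elements: its fibres are the pairs x, -x, which are
    -- distinct because 2 ≠ 0.
    squares-half : ∀ {m} → HasSize nonzero m →
      ∃[ r ] HasSize (SubSetoid nonzero NonzeroSquare) r × r ℕ.+ r ≡ m
    squares-half em = Finite.twoToOne-image em {nonzero} square* (λ (x , x≉0) → - x , λ -x≈0 →
        x≉0 (trans (sym (-‿involutive x)) (trans (-‿cong -x≈0) (solve 0 (:- con (+ 0) := con (+ 0)) refl))))
      (λ x≈y → *-cong x≈y x≈y) (λ x≈y → -‿cong x≈y) (λ _ → -‿involutive _)
      (λ (x , x≉0) -x≈x → x≉0 (*-cancel-0 2≉0 (begin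
        fromℤ (+ 2) * x  ≈⟨ solve 1 (λ x → con (+ 2) :* x := x :- :- x) refl x ⟩
        x - - x          ≈⟨ +-congˡ (-‿cong -x≈x) ⟩
        x - x            ≈⟨ -‿inverseʳ x ⟩
        0#               ∎)))
      (λ (x , _) → solve 1 (λ x → :- x :* :- x := x :* x) refl x)
      (λ {(x , _)} {(y , _)} x²≈y² → fibre x y x²≈y²)
      where
      fibre : ∀ x y → x * x ≈ y * y → x ≈ y ⊎ x ≈ - y
      fibre x y x²≈y² with x ≟ y
      ... | yes x≈y = inj₁ x≈y
      ... | no  x≉y = inj₂ (-≈0⇒≈ (*-cancel-0 (-≉0 x≉y) (trans
        (solve 2 (λ x y → (x :- y) :* (x :- :- y) := x :* x :- y :* y) refl x y) (-≈0 x²≈y²))))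

    nonzeroSquare? : Unary.Decidable NonzeroSquare
    nonzeroSquare? (t , t≉0) with isSquare? t
    ... | yes (s , s²≈t) = yes ((s , λ s≈0 → t≉0 (trans (sym s²≈t) (trans (*-congʳ s≈0) (zeroˡ s)))) , s²≈t)
    ... | no  ¬t         = no λ ((s , _) , s²≈t) → ¬t (s , s²≈t)

    -- Zero is a square, so the non-squares of the field are exactly the non-zero elements outside
    -- the non-zero squares.
    nonSquares-half : ∀ {m r} → HasSize nonzero m → HasSize (SubSetoid nonzero NonzeroSquare) r →
      r ℕ.+ r ≡ m → HasSize (SubSetoid setoid NonSquare) r
    nonSquares-half {m} {r} em er r+r≡m =
      let r′ , er′ , r+r′≡m = Finite.complementSize em
            (λ t≈u (x , x²≈t) → x , trans x²≈t t≈u) nonzeroSquare? er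
      in ≡.subst (HasSize _) (ℕₚ.+-cancelˡ-≡ r r′ r (≡.trans r+r′≡m (≡.sym r+r≡m)))
           (mapSize (mkInverse
             (λ ((x , x≉0) , ¬x) → x , λ (s , s²≈x) →
               ¬x ((s , λ s≈0 → x≉0 (trans (sym s²≈x) (trans (*-congʳ s≈0) (zeroˡ s)))) , s²≈x))
             (λ (x , ¬x) → (x , nonSquare-≉0 ¬x) , λ ((s , _) , s²≈x) → ¬x (s , s²≈x))
             (λ x≈y → x≈y) (λ x≈y → x≈y) (λ _ → refl) (λ _ → refl)) er′)

    halves : ∃[ r ] HasSize (SubSetoid nonzero NonzeroSquare) r ×
                    HasSize (SubSetoid setoid NonSquare) r × suc (r ℕ.+ r) ≡ q
    halves = let m , em , 1+m≡q = ≉0-size ; r , er , r+r≡m = squares-half em in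
      r , er , nonSquares-half em er r+r≡m , ≡.trans (≡.cong suc r+r≡m) 1+m≡q

    -- Multiplication by x maps the non-zero squares injectively, hence onto, the non-squares.
    nonSquare-* : ∀ {x y} → NonSquare x → NonSquare y → IsSquare (x * y)
    nonSquare-* {x} {y} ¬x ¬y =
      let _ , squares , nonSquares , _ = halves
          t , xt≈y = equalSize-surjective squares nonSquares multiply (*-cancelˡ (nonSquare-≉0 ¬x)) (y , ¬y)
      in product t xt≈y
      where
      multiply : Setoid.Carrier (SubSetoid nonzero NonzeroSquare) →
                 Setoid.Carrier (SubSetoid setoid NonSquare)
      multiply ((t , _) , (s , s≉0) , s²≈t) = x * t , λ xt →
        ¬x (isSquare-cancel s≉0 (isSquare-resp (trans (*-congˡ (sym s²≈t)) (*-comm _ _)) xt))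
      product : ∀ t → x * proj₁ (proj₁ t) ≈ y → IsSquare (x * y)
      product ((t , _) , (s , _) , s²≈t) xt≈y = x * s , (begin
        x * s * (x * s)    ≈⟨ solve 2 (λ x s → x :* s :* (x :* s) := x :* (x :* (s :* s))) refl x s ⟩
        x * (x * (s * s))  ≈⟨ *-congˡ (trans (*-congˡ s²≈t) xt≈y) ⟩
        x * y              ∎)

    -- The solutions of d² - n = e² are d = (a + n / a) / 2 for the factorisations n = a (n / a).
    -- As 4 = -1, the half of x is - 2 x.
    module _ {n : Carrier} (¬n : NonSquare n) where
      private
        n≉0 : ¬ (n ≈ 0#)
        n≉0 = nonSquare-≉0 ¬n

        partner : Setoid.Carrier nonzero → Setoid.Carrier nonzero
        partner (a , a≉0) = n * inv a a≉0 , *-≉0 n≉0 (inv≉0 a≉0)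

        mean : Setoid.Carrier nonzero → Carrier
        mean a = - fromℤ (+ 2) * (proj₁ a + proj₁ (partner a))

        a*partner : ∀ a → proj₁ a * proj₁ (partner a) ≈ n
        a*partner (a , a≉0) = trans
          (solve 3 (λ a n i → a :* (n :* i) := n :* (a :* i)) refl a n (inv a a≉0))
          (trans (*-congˡ (inverseʳ a a≉0)) (*-identityʳ n))

        partner-cong : ∀ {a b} → proj₁ a ≈ proj₁ b → proj₁ (partner a) ≈ proj₁ (partner b)
        partner-cong {_ , a≉0} {_ , b≉0} a≈b = *-congˡ (inv-cong a≉0 b≉0 a≈b)

        partner-unique : ∀ a {b} → proj₁ a * b ≈ n → b ≈ proj₁ (partner a)
        partner-unique a ab≈n = *-cancelˡ (proj₂ a) (trans ab≈n (sym (a*partner a)))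

        partner² : ∀ a → proj₁ (partner (partner a)) ≈ proj₁ a
        partner² a = sym (partner-unique (partner a) (trans (*-comm _ _) (a*partner a)))

        sum≈ : ∀ {x y} → - fromℤ (+ 2) * x ≈ - fromℤ (+ 2) * y → x ≈ y
        sum≈ {x} {y} eq = -≈0⇒≈ (*-cancel-0 2≉0 (trans
          (solve 2 (λ x y → con (+ 2) :* (x :- y) := :- con (+ 2) :* y :- :- con (+ 2) :* x) refl x y)
          (-≈0 (sym eq))))

        -- Two factorisations of `n` with the same sum come from one quadratic: its roots are `b`
        -- and its partner, and `a` is one of them.
        mean-fibre : ∀ a b → mean a ≈ mean b → proj₁ a ≈ proj₁ b ⊎ proj₁ a ≈ proj₁ (partner b)
        mean-fibre a b eq with proj₁ a ≟ proj₁ b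
        ... | yes a≈b = inj₁ a≈b
        ... | no  a≉b = inj₂ (partner-unique b (sym (-≈0⇒≈ (*-cancel-0 (-≉0 a≉b) (begin
          (x - y) * (n - y * x)
            ≈⟨ solve 3 (λ x y n → (x :- y) :* (n :- y :* x) := y :* x :* (y :- x) :+ x :* n :- y :* n) refl x y n ⟩
          y * x * (y - x) + x * n - y * n
            ≈⟨ +-cong (+-congˡ (*-congˡ (sym (a*partner b)))) (-‿cong (*-congˡ (sym (a*partner a)))) ⟩
          y * x * (y - x) + x * (y * y′) - y * (x * x′)
            ≈⟨ solve 4 (λ x y x′ y′ → y :* x :* (y :- x) :+ x :* (y :* y′) :- y :* (x :* x′)
                 := y :* x :* ((y :+ y′) :- (x :+ x′))) refl x y x′ y′ ⟩
          y * x * ((y + y′) - (x + x′))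
            ≈⟨ *-congˡ (-≈0 (sym (sum≈ eq))) ⟩
          y * x * 0#
            ≈⟨ zeroʳ _ ⟩
          0# ∎)))))
          where
          x y x′ y′ : Carrier
          x  = proj₁ a
          y  = proj₁ b
          x′ = proj₁ (partner a)
          y′ = proj₁ (partner b)

        -- With factors x and x′ of `n`, the square of 2 (x - x′) is d² - 16 x x′, and 16 is 1
        -- modulo 5.
        mean⇒square : ∀ d → (∃[ a ] mean a ≈ d) → IsSquare (d * d - n)
        mean⇒square d (a , mean≈d) = fromℤ (+ 2) * (x - x′) , (begin
          fromℤ (+ 2) * (x - x′) * (fromℤ (+ 2) * (x - x′))
            ≈⟨ solve 2 (λ x y → con (+ 2) :* (x :- y) :* (con (+ 2) :* (x :- y))
                 := (:- con (+ 2) :* (x :+ y)) :* (:- con (+ 2) :* (x :+ y)) :- con (+ 16) :* (x :* y))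
                 refl x x′ ⟩
          mean a * mean a - fromℤ (+ 16) * (x * x′)
            ≈⟨ mod5 (- (x * x′) * fromℤ (+ 3)) (solve 2 (λ m t → m :* m :- con (+ 16) :* t
                 := m :* m :- t :+ con (+ 5) :* (:- t :* con (+ 3))) refl (mean a) (x * x′)) ⟩
          mean a * mean a - x * x′
            ≈⟨ +-cong (*-cong mean≈d mean≈d) (-‿cong (a*partner a)) ⟩
          d * d - n ∎)
          where
          x x′ : Carrier
          x  = proj₁ a
          x′ = proj₁ (partner a)

        square⇒mean : ∀ d → IsSquare (d * d - n) → ∃[ a ] mean a ≈ d
        square⇒mean d (s , s²≈) = (d - s , d-s≉0) , (begin
          - fromℤ (+ 2) * (d - s + n * inv (d - s) d-s≉0)
            ≈⟨ *-congˡ (+-congˡ (partner-unique (d - s , d-s≉0) factors)) ⟨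
          - fromℤ (+ 2) * (d - s + (d + s))
            ≈⟨ mod5 (- d) (solve 2 (λ d s → :- con (+ 2) :* (d :- s :+ (d :+ s))
                 := d :+ con (+ 5) :* (:- d)) refl d s) ⟩
          d ∎)
          where
          factors : (d - s) * (d + s) ≈ n
          factors = begin
            (d - s) * (d + s)      ≈⟨ solve 2 (λ d s → (d :- s) :* (d :+ s) := d :* d :- s :* s) refl d s ⟩
            d * d - s * s          ≈⟨ +-congˡ (-‿cong s²≈) ⟩
            d * d - (d * d - n)    ≈⟨ solve 2 (λ d n → d :* d :- (d :* d :- n) := n) refl d n ⟩
            n                      ∎
          d-s≉0 : ¬ (d - s ≈ 0#)
          d-s≉0 eq = n≉0 (trans (sym factors) (trans (*-congʳ eq) (zeroˡ _)))

      -- `mean` is two-to-one with fibres a, n/a. These two never coincide, because a² = n would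
      -- make `n` a square.
      shiftedSquares : ∀ {m} → HasSize nonzero m →
        ∃[ s ] HasSize (SubSetoid setoid (λ d → IsSquare (d * d - n))) s × s ℕ.+ s ≡ m
      shiftedSquares em =
        let s , es , s+s≡m = Finite.twoToOne-image em {setoid} mean partner
              (λ {a} {b} a≈b → *-congˡ (+-cong a≈b (partner-cong {a} {b} a≈b)))
              (λ {a} {b} → partner-cong {a} {b})
              partner²
              (λ a pa≈a → ¬n (proj₁ a , trans (*-congˡ (sym pa≈a)) (a*partner a)))
              (λ a → *-congˡ (trans (+-congˡ (partner² a)) (+-comm _ _)))
              (λ {a} {b} → mean-fibre a b)
        in s , mapSize (SubSetoid-⇔ {setoid} mean⇒square square⇒mean) es , s+s≡m

      -- The valency count: a neighbour of (y, n) at first coordinate y + d has second coordinate d²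
      -- - n, which must be a non-square. Of the q = 2 r + 1 values of `d` exactly r make it a
      -- square.
      shiftedNonSquares : ∀ {r} → suc (r ℕ.+ r) ≡ q →
        HasSize (SubSetoid setoid (λ d → NonSquare (d * d - n))) (suc r)
      shiftedNonSquares {r} 1+r+r≡q =
        let m , em , 1+m≡q = ≉0-size
            s , es , s+s≡m = shiftedSquares em
            k , ek , s+k≡q = Finite.complementSize e
              (λ d≈d′ → isSquare-resp (+-congʳ (*-cong d≈d′ d≈d′)))
              (λ d → isSquare? (d * d - n)) es
        in ≡.subst (HasSize _) (sizes s k m 1+m≡q s+s≡m s+k≡q) ek
        where
        sizes : ∀ s k m → suc m ≡ q → s ℕ.+ s ≡ m → s ℕ.+ k ≡ q → k ≡ suc r
        sizes s k m 1+m≡q s+s≡m s+k≡q =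
          ≡.trans k≡1+s (≡.cong suc (double-injective s r (ℕₚ.suc-injective
            (≡.trans (≡.cong suc s+s≡m) (≡.trans 1+m≡q (≡.sym 1+r+r≡q))))))
          where
          k≡1+s : k ≡ suc s
          k≡1+s = ℕₚ.+-cancelˡ-≡ s k (suc s) (≡.trans s+k≡q
            (≡.trans (≡.sym 1+m≡q) (≡.trans (≡.cong suc (≡.sym s+s≡m)) (≡.sym (ℕₚ.+-suc s s)))))
          double-injective : ∀ s r → s ℕ.+ s ≡ r ℕ.+ r → s ≡ r
          double-injective zero    zero    _  = ≡.refl
          double-injective (suc s) (suc r) eq = ≡.cong suc (double-injective s r
            (ℕₚ.suc-injective (≡.trans (≡.sym (ℕₚ.+-suc s s))
              (≡.trans (ℕₚ.suc-injective eq) (ℕₚ.+-suc r r)))))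

-- Conics and their external lines

module TripleAlgebra (F : Field) where
  open Field F hiding (zero)
  open ℤSolver commutativeRing
  open Plane F using (Triple; ⟨_,_,_⟩; x₀; x₁; x₂; _∙_; _≋_)

  infixl 7 _⨯_

  _⨯_ : Triple → Triple → Triple
  u ⨯ w = ⟨ x₁ u * x₂ w - x₂ u * x₁ w , x₂ u * x₀ w - x₀ u * x₂ w , x₀ u * x₁ w - x₁ u * x₀ w ⟩

  -- Shorter combinations are written in the same form, filled up with terms of coefficient `0#`.
  lin₃ : Carrier → Triple → Carrier → Triple → Carrier → Triple → Triple
  lin₃ s u t w r v = ⟨ s * x₀ u + t * x₀ w + r * x₀ v
                     , s * x₁ u + t * x₁ w + r * x₁ v
                     , s * x₂ u + t * x₂ w + r * x₂ v ⟩

  lin₃-∙ : ∀ s u t w r v k → lin₃ s u t w r v ∙ k ≈ s * (u ∙ k) + t * (w ∙ k) + r * (v ∙ k)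
  lin₃-∙ s ⟨ u₀ , u₁ , u₂ ⟩ t ⟨ w₀ , w₁ , w₂ ⟩ r ⟨ v₀ , v₁ , v₂ ⟩ ⟨ k₀ , k₁ , k₂ ⟩ =
    solve 15 (λ s u₀ u₁ u₂ t w₀ w₁ w₂ r v₀ v₁ v₂ k₀ k₁ k₂ →
      (s :* u₀ :+ t :* w₀ :+ r :* v₀) :* k₀ :+ (s :* u₁ :+ t :* w₁ :+ r :* v₁) :* k₁
        :+ (s :* u₂ :+ t :* w₂ :+ r :* v₂) :* k₂
      := s :* (u₀ :* k₀ :+ u₁ :* k₁ :+ u₂ :* k₂) :+ t :* (w₀ :* k₀ :+ w₁ :* k₁ :+ w₂ :* k₂)
        :+ r :* (v₀ :* k₀ :+ v₁ :* k₁ :+ v₂ :* k₂))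
      refl s u₀ u₁ u₂ t w₀ w₁ w₂ r v₀ v₁ v₂ k₀ k₁ k₂

  ⨯-∙ˡ : ∀ u w → (u ⨯ w) ∙ u ≈ 0#
  ⨯-∙ˡ ⟨ u₀ , u₁ , u₂ ⟩ ⟨ w₀ , w₁ , w₂ ⟩ = solve 6 (λ u₀ u₁ u₂ w₀ w₁ w₂ →
    (u₁ :* w₂ :- u₂ :* w₁) :* u₀ :+ (u₂ :* w₀ :- u₀ :* w₂) :* u₁ :+ (u₀ :* w₁ :- u₁ :* w₀) :* u₂
    := con (+ 0)) refl u₀ u₁ u₂ w₀ w₁ w₂

  ⨯-∙ʳ : ∀ u w → (u ⨯ w) ∙ w ≈ 0#
  ⨯-∙ʳ ⟨ u₀ , u₁ , u₂ ⟩ ⟨ w₀ , w₁ , w₂ ⟩ = solve 6 (λ u₀ u₁ u₂ w₀ w₁ w₂ →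
    (u₁ :* w₂ :- u₂ :* w₁) :* w₀ :+ (u₂ :* w₀ :- u₀ :* w₂) :* w₁ :+ (u₀ :* w₁ :- u₁ :* w₀) :* w₂
    := con (+ 0)) refl u₀ u₁ u₂ w₀ w₁ w₂

  binet-cauchy : ∀ a b c d → (a ⨯ b) ∙ (c ⨯ d) ≈ (a ∙ c) * (b ∙ d) - (a ∙ d) * (b ∙ c)
  binet-cauchy ⟨ a₀ , a₁ , a₂ ⟩ ⟨ b₀ , b₁ , b₂ ⟩ ⟨ c₀ , c₁ , c₂ ⟩ ⟨ d₀ , d₁ , d₂ ⟩ =
    solve 12 (λ a₀ a₁ a₂ b₀ b₁ b₂ c₀ c₁ c₂ d₀ d₁ d₂ →
      (a₁ :* b₂ :- a₂ :* b₁) :* (c₁ :* d₂ :- c₂ :* d₁)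
        :+ (a₂ :* b₀ :- a₀ :* b₂) :* (c₂ :* d₀ :- c₀ :* d₂)
        :+ (a₀ :* b₁ :- a₁ :* b₀) :* (c₀ :* d₁ :- c₁ :* d₀)
      := (a₀ :* c₀ :+ a₁ :* c₁ :+ a₂ :* c₂) :* (b₀ :* d₀ :+ b₁ :* d₁ :+ b₂ :* d₂)
        :- (a₀ :* d₀ :+ a₁ :* d₁ :+ a₂ :* d₂) :* (b₀ :* c₀ :+ b₁ :* c₁ :+ b₂ :* c₂))
      refl a₀ a₁ a₂ b₀ b₁ b₂ c₀ c₁ c₂ d₀ d₁ d₂

  -- Expansion of `r`, times the triple product of `n`, `m`, `k`, in the reciprocal basis. A vector
  -- orthogonal to three independent ones is therefore zero. Only the first coordinate is expanded
  -- in full; the other two follow by rotating the indices.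
  reciprocal-basis : ∀ n m k r →
    ⟨ (n ⨯ m) ∙ k * x₀ r , (n ⨯ m) ∙ k * x₁ r , (n ⨯ m) ∙ k * x₂ r ⟩ ≋
    lin₃ (r ∙ n) (m ⨯ k) (r ∙ m) (k ⨯ n) (r ∙ k) (n ⨯ m)
  reciprocal-basis ⟨ n₀ , n₁ , n₂ ⟩ ⟨ m₀ , m₁ , m₂ ⟩ ⟨ k₀ , k₁ , k₂ ⟩ ⟨ r₀ , r₁ , r₂ ⟩ =
    row n₀ n₁ n₂ m₀ m₁ m₂ k₀ k₁ k₂ r₀ r₁ r₂ ,
    trans (solve 12 (λ n₀ n₁ n₂ m₀ m₁ m₂ k₀ k₁ k₂ r₀ r₁ r₂ →
        ((n₁ :* m₂ :- n₂ :* m₁) :* k₀ :+ (n₂ :* m₀ :- n₀ :* m₂) :* k₁ :+ (n₀ :* m₁ :- n₁ :* m₀) :* k₂) :* r₁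
        := ((n₂ :* m₀ :- n₀ :* m₂) :* k₁ :+ (n₀ :* m₁ :- n₁ :* m₀) :* k₂ :+ (n₁ :* m₂ :- n₂ :* m₁) :* k₀) :* r₁)
        refl n₀ n₁ n₂ m₀ m₁ m₂ k₀ k₁ k₂ r₀ r₁ r₂)
      (trans (row n₁ n₂ n₀ m₁ m₂ m₀ k₁ k₂ k₀ r₁ r₂ r₀)
        (+-cong (+-cong (*-congʳ (rotate _ _ _)) (*-congʳ (rotate _ _ _))) (*-congʳ (rotate _ _ _)))) ,
    trans (solve 12 (λ n₀ n₁ n₂ m₀ m₁ m₂ k₀ k₁ k₂ r₀ r₁ r₂ →
        ((n₁ :* m₂ :- n₂ :* m₁) :* k₀ :+ (n₂ :* m₀ :- n₀ :* m₂) :* k₁ :+ (n₀ :* m₁ :- n₁ :* m₀) :* k₂) :* r₂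
        := ((n₀ :* m₁ :- n₁ :* m₀) :* k₂ :+ (n₁ :* m₂ :- n₂ :* m₁) :* k₀ :+ (n₂ :* m₀ :- n₀ :* m₂) :* k₁) :* r₂)
        refl n₀ n₁ n₂ m₀ m₁ m₂ k₀ k₁ k₂ r₀ r₁ r₂)
      (trans (row n₂ n₀ n₁ m₂ m₀ m₁ k₂ k₀ k₁ r₂ r₀ r₁)
        (+-cong (+-cong (*-congʳ (rotate′ _ _ _)) (*-congʳ (rotate′ _ _ _))) (*-congʳ (rotate′ _ _ _))))
    where
    rotate : ∀ x y z → y + z + x ≈ x + y + z
    rotate = solve 3 (λ x y z → y :+ z :+ x := x :+ y :+ z) refl
    rotate′ : ∀ x y z → z + x + y ≈ x + y + z
    rotate′ = solve 3 (λ x y z → z :+ x :+ y := x :+ y :+ z) refl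
    row : ∀ n₀ n₁ n₂ m₀ m₁ m₂ k₀ k₁ k₂ r₀ r₁ r₂ →
      ((n₁ * m₂ - n₂ * m₁) * k₀ + (n₂ * m₀ - n₀ * m₂) * k₁ + (n₀ * m₁ - n₁ * m₀) * k₂) * r₀ ≈
      (r₀ * n₀ + r₁ * n₁ + r₂ * n₂) * (m₁ * k₂ - m₂ * k₁)
        + (r₀ * m₀ + r₁ * m₁ + r₂ * m₂) * (k₁ * n₂ - k₂ * n₁)
        + (r₀ * k₀ + r₁ * k₁ + r₂ * k₂) * (n₁ * m₂ - n₂ * m₁)
    row = solve 12 (λ n₀ n₁ n₂ m₀ m₁ m₂ k₀ k₁ k₂ r₀ r₁ r₂ →
      ((n₁ :* m₂ :- n₂ :* m₁) :* k₀ :+ (n₂ :* m₀ :- n₀ :* m₂) :* k₁ :+ (n₀ :* m₁ :- n₁ :* m₀) :* k₂) :* r₀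
      := (r₀ :* n₀ :+ r₁ :* n₁ :+ r₂ :* n₂) :* (m₁ :* k₂ :- m₂ :* k₁)
        :+ (r₀ :* m₀ :+ r₁ :* m₁ :+ r₂ :* m₂) :* (k₁ :* n₂ :- k₂ :* n₁)
        :+ (r₀ :* k₀ :+ r₁ :* k₁ :+ r₂ :* k₂) :* (n₁ :* m₂ :- n₂ :* m₁)) refl

module ConicForm (F : Field) (O : Plane.Conic F) where
  open Field F hiding (zero)
  open ℤSolver commutativeRing
  open SetoidReasoning setoid
  open FiniteFields F using (*-cancel-0; *-≉0)
  open TripleAlgebra F
  open Plane F hiding (*-cancel-0)
  open Conic O

  M A : Triple → Triple
  M u = M·_ O u
  A u = A·_ O u

  B : Triple → Triple → Carrier
  B u w = u ∙ M w

  MA : ∀ u → M (A u) ≋ det *ₗ u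
  MA = M·A· O

  B-sym : ∀ u w → B u w ≈ B w u
  B-sym ⟨ u₀ , u₁ , u₂ ⟩ ⟨ w₀ , w₁ , w₂ ⟩ = solve 12 (λ a b c f g h u₀ u₁ u₂ w₀ w₁ w₂ →
    u₀ :* (a :* w₀ :+ h :* w₁ :+ g :* w₂) :+ u₁ :* (h :* w₀ :+ b :* w₁ :+ f :* w₂)
      :+ u₂ :* (g :* w₀ :+ f :* w₁ :+ c :* w₂)
    := w₀ :* (a :* u₀ :+ h :* u₁ :+ g :* u₂) :+ w₁ :* (h :* u₀ :+ b :* u₁ :+ f :* u₂)
      :+ w₂ :* (g :* u₀ :+ f :* u₁ :+ c :* u₂)) refl a b c f g h u₀ u₁ u₂ w₀ w₁ w₂

  M-cong : ∀ {u w} → u ≋ w → M u ≋ M w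
  M-cong {u} {w} eq = ∙-cong {M₀} {M₀} ≋-refl eq , ∙-cong {M₁} {M₁} ≋-refl eq , ∙-cong {M₂} {M₂} ≋-refl eq

  B-lin₃ : ∀ s u t w r v k → B (lin₃ s u t w r v) k ≈ s * B u k + t * B w k + r * B v k
  B-lin₃ s u t w r v k = lin₃-∙ s u t w r v (M k)

  B-lin₃ʳ : ∀ s u t w r v k → B k (lin₃ s u t w r v) ≈ s * B k u + t * B k w + r * B k v
  B-lin₃ʳ s u t w r v k = trans (B-sym k _) (trans (B-lin₃ s u t w r v k)
    (+-cong (+-cong (*-congˡ (B-sym u k)) (*-congˡ (B-sym w k))) (*-congˡ (B-sym v k))))

  -- The cofactor identity for cross products; `M` is symmetric, so the adjugate appears without a
  -- transpose.
  M⨯M : ∀ u w → M u ⨯ M w ≋ A (u ⨯ w)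
  M⨯M ⟨ u₀ , u₁ , u₂ ⟩ ⟨ w₀ , w₁ , w₂ ⟩ =
    solve 12 (λ a b c f g h u₀ u₁ u₂ w₀ w₁ w₂ →
      (h :* u₀ :+ b :* u₁ :+ f :* u₂) :* (g :* w₀ :+ f :* w₁ :+ c :* w₂)
        :- (g :* u₀ :+ f :* u₁ :+ c :* u₂) :* (h :* w₀ :+ b :* w₁ :+ f :* w₂)
      := (b :* c :- f :* f) :* (u₁ :* w₂ :- u₂ :* w₁) :+ (f :* g :- c :* h) :* (u₂ :* w₀ :- u₀ :* w₂)
        :+ (h :* f :- b :* g) :* (u₀ :* w₁ :- u₁ :* w₀)) refl a b c f g h u₀ u₁ u₂ w₀ w₁ w₂ ,
    solve 12 (λ a b c f g h u₀ u₁ u₂ w₀ w₁ w₂ →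
      (g :* u₀ :+ f :* u₁ :+ c :* u₂) :* (a :* w₀ :+ h :* w₁ :+ g :* w₂)
        :- (a :* u₀ :+ h :* u₁ :+ g :* u₂) :* (g :* w₀ :+ f :* w₁ :+ c :* w₂)
      := (f :* g :- c :* h) :* (u₁ :* w₂ :- u₂ :* w₁) :+ (a :* c :- g :* g) :* (u₂ :* w₀ :- u₀ :* w₂)
        :+ (g :* h :- a :* f) :* (u₀ :* w₁ :- u₁ :* w₀)) refl a b c f g h u₀ u₁ u₂ w₀ w₁ w₂ ,
    solve 12 (λ a b c f g h u₀ u₁ u₂ w₀ w₁ w₂ →
      (a :* u₀ :+ h :* u₁ :+ g :* u₂) :* (h :* w₀ :+ b :* w₁ :+ f :* w₂)
        :- (h :* u₀ :+ b :* u₁ :+ f :* u₂) :* (a :* w₀ :+ h :* w₁ :+ g :* w₂)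
      := (h :* f :- b :* g) :* (u₁ :* w₂ :- u₂ :* w₁) :+ (g :* h :- a :* f) :* (u₂ :* w₀ :- u₀ :* w₂)
        :+ (a :* b :- h :* h) :* (u₀ :* w₁ :- u₁ :* w₀)) refl a b c f g h u₀ u₁ u₂ w₀ w₁ w₂

  -- M u ⨯ M w is the vector orthogonal to `u` and `w` under `B`. Since M times the adjugate is det,
  -- Binet-Cauchy reduces its value to det times the Gram determinant of `u` and `w`.
  form-of-⨯ : ∀ u w → B (M u ⨯ M w) (M u ⨯ M w) ≈ det * (B u u * B w w - B u w * B u w)
  form-of-⨯ u w = begin
    B v v                                          ≈⟨ ∙-cong {v} {v} ≋-refl (M-cong (M⨯M u w)) ⟩
    v ∙ M (A (u ⨯ w))                              ≈⟨ ∙-cong {v} {v} ≋-refl (MA (u ⨯ w)) ⟩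
    v ∙ (det *ₗ (u ⨯ w))                           ≈⟨ ∙-*ₗ v det (u ⨯ w) ⟩
    det * (v ∙ (u ⨯ w))                            ≈⟨ *-congˡ (binet-cauchy (M u) (M w) u w) ⟩
    det * ((M u ∙ u) * (M w ∙ w) - (M u ∙ w) * (M w ∙ u))
      ≈⟨ *-congˡ (+-cong (*-cong (∙-comm (M u) u) (∙-comm (M w) w))
           (-‿cong (*-cong (trans (∙-comm (M u) w) (B-sym w u)) (∙-comm (M w) u)))) ⟩
    det * (B u u * B w w - B u w * B u w)          ∎
    where
    v : Triple
    v = M u ⨯ M w

  e₀ e₁ e₂ : Triple
  e₀ = ⟨ 1# , 0# , 0# ⟩
  e₁ = ⟨ 0# , 1# , 0# ⟩
  e₂ = ⟨ 0# , 0# , 1# ⟩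

  -- Recovers `u` from `M u`: the product of `A` and `M` in the other order is obtained from `MA`
  -- and the symmetry of `B`.
  det-component : ∀ u w → det * (w ∙ u) ≈ A w ∙ M u
  det-component u w = begin
    det * (w ∙ u)       ≈⟨ *-congˡ (∙-comm w u) ⟩
    det * (u ∙ w)       ≈⟨ ∙-*ₗ u det w ⟨
    u ∙ (det *ₗ w)      ≈⟨ ∙-cong {u} {u} ≋-refl (MA w) ⟨
    B u (A w)           ≈⟨ B-sym u (A w) ⟩
    B (A w) u           ∎

  e₀∙ : ∀ u → e₀ ∙ u ≈ x₀ u
  e₀∙ ⟨ x , y , z ⟩ = solve 3 (λ x y z → con (+ 1) :* x :+ con (+ 0) :* y :+ con (+ 0) :* z := x) refl x y z

  e₁∙ : ∀ u → e₁ ∙ u ≈ x₁ u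
  e₁∙ ⟨ x , y , z ⟩ = solve 3 (λ x y z → con (+ 0) :* x :+ con (+ 1) :* y :+ con (+ 0) :* z := y) refl x y z

  e₂∙ : ∀ u → e₂ ∙ u ≈ x₂ u
  e₂∙ ⟨ x , y , z ⟩ = solve 3 (λ x y z → con (+ 0) :* x :+ con (+ 0) :* y :+ con (+ 1) :* z := z) refl x y z

  ∙-zero : ∀ w {u} → IsZero u → w ∙ u ≈ 0#
  ∙-zero w {u} u≈0 = trans (∙-cong {w} {w} {u} {⟨ 0# , 0# , 0# ⟩} ≋-refl u≈0)
    (solve 3 (λ x y z → x :* con (+ 0) :+ y :* con (+ 0) :+ z :* con (+ 0) := con (+ 0)) refl
      (x₀ w) (x₁ w) (x₂ w))

  M-nonzero : ∀ {u} → ¬ IsZero u → ¬ IsZero (M u)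
  M-nonzero {u} u≉0 Mu≈0 = u≉0
    ( trans (sym (e₀∙ u)) (component e₀)
    , trans (sym (e₁∙ u)) (component e₁)
    , trans (sym (e₂∙ u)) (component e₂) )
    where
    component : ∀ w → w ∙ u ≈ 0#
    component w = *-cancel-0 nondegenerate (trans (det-component u w) (∙-zero (A w) Mu≈0))

-- Hyperbolic coordinates of a non-degenerate ternary form

module NormalForm (F : Field) {q : ℕ} (e : HasSize (Field.setoid F) q)
  (5≈0 : Field._≈_ F (ℤSolver.fromℤ (Field.commutativeRing F) (+ 5)) (Field.0# F))
  (O : Plane.Conic F) where
  open Field F hiding (zero)
  open RingProperties ring
  open ℤSolver commutativeRing
  open SetoidReasoning setoid
  open FiniteFields F
  open Characteristic5 e 5≈0
  open TripleAlgebra F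
  open Plane F hiding (*-cancel-0; inv≉0)
  open Conic O using (a; g; h; det; nondegenerate)
  open ConicForm F O

  -- A point `p` of the conic with a second vector `w`: the Gram determinant of the two is minus the
  -- square of B w p, so they span a hyperbolic plane.
  IsotropicPair : Set
  IsotropicPair = ∃[ p ] ∃[ w ] B p p ≈ 0# × ¬ (B w p ≈ 0#)

  isotropicPair : ∀ {p} → ¬ IsZero p → B p p ≈ 0# → IsotropicPair
  isotropicPair {p} p≉0 Qp≈0 with x₀ (M p) ≟ 0# | x₁ (M p) ≟ 0# | x₂ (M p) ≟ 0#
  ... | no ≉0 | _ | _ = p , e₀ , Qp≈0 , λ ≈0 → ≉0 (trans (sym (e₀∙ (M p))) ≈0)
  ... | yes _ | no ≉0 | _ = p , e₁ , Qp≈0 , λ ≈0 → ≉0 (trans (sym (e₁∙ (M p))) ≈0)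
  ... | yes _ | yes _ | no ≉0 = p , e₂ , Qp≈0 , λ ≈0 → ≉0 (trans (sym (e₂∙ (M p))) ≈0)
  ... | yes z₀ | yes z₁ | yes z₂ = contradiction (z₀ , z₁ , z₂) (M-nonzero p≉0)

  module _ {u w : Triple} (u⊥w : B u w ≈ 0#) where
    -- Since -1 is a square, so is -α ω, say s². Then ω u + s w has value ω² α + s² ω = 0.
    orthogonalPair : ¬ (B u u ≈ 0#) → ¬ (B w w ≈ 0#) → IsSquare (B u u * B w w) → IsotropicPair
    orthogonalPair α≉0 ω≉0 αω = p , u , Qp≈0 , λ Bup≈0 → *-≉0 ω≉0 α≉0 (trans (sym Bup) Bup≈0)
      where
      α ω s : Carrier
      α = B u u
      ω = B w w
      s = proj₁ (isSquare-neg αω)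
      s² : s * s ≈ - (α * ω)
      s² = proj₂ (isSquare-neg αω)
      p : Triple
      p = lin₃ ω u s w 0# w
      Bup : B u p ≈ ω * α
      Bup = trans (B-lin₃ʳ ω u s w 0# w u) (trans (+-cong (+-congˡ (*-congˡ u⊥w)) (*-congˡ u⊥w))
        (solve 3 (λ o a s → o :* a :+ s :* con (+ 0) :+ con (+ 0) :* con (+ 0) := o :* a) refl ω α s))
      Bwp : B w p ≈ s * ω
      Bwp = trans (B-lin₃ʳ ω u s w 0# w w)
        (trans (+-congʳ (+-congʳ (*-congˡ (trans (B-sym w u) u⊥w))))
          (solve 2 (λ o s → o :* con (+ 0) :+ s :* o :+ con (+ 0) :* o := s :* o) refl ω s))
      Qp≈0 : B p p ≈ 0#
      Qp≈0 = begin
        B p p                                    ≈⟨ B-lin₃ ω u s w 0# w p ⟩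
        ω * B u p + s * B w p + 0# * B w p       ≈⟨ +-cong (+-cong (*-congˡ Bup) (*-congˡ Bwp)) (*-congˡ Bwp) ⟩
        ω * (ω * α) + s * (s * ω) + 0# * (s * ω)
          ≈⟨ solve 3 (λ o a s → o :* (o :* a) :+ s :* (s :* o) :+ con (+ 0) :* (s :* o)
               := o :* (o :* a :+ s :* s)) refl ω α s ⟩
        ω * (ω * α + s * s)                      ≈⟨ *-congˡ (+-congˡ s²) ⟩
        ω * (ω * α - α * ω)                      ≈⟨ solve 2 (λ o a → o :* (o :* a :- a :* o) := con (+ 0)) refl ω α ⟩
        0#                                       ∎

  -- Among three mutually orthogonal anisotropic vectors two have values in the same square class.
  isotropicPair-exists : IsotropicPair
  isotropicPair-exists with a ≟ 0#
  ... | yes a≈0 = isotropicPair {e₀} (λ (1≈0 , _) → 1≉0 1≈0)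
    (trans (e₀∙ (M e₀)) (trans (solve 3 (λ a h g → a :* con (+ 1) :+ h :* con (+ 0) :+ g :* con (+ 0) := a)
      refl a h g) a≈0))
  ... | no a≉0 = orthogonalise (B u₂ u₂ ≟ 0#)
    where
    u₂ u₃ : Triple
    -- Orthogonal to `e₀`, as the first row of the matrix is (a, h, g); `u₃` is orthogonal to both,
    -- and its value is a non-zero multiple of the other two values.
    u₂ = ⟨ - h , a , 0# ⟩
    u₃ = M e₀ ⨯ M u₂
    Q₁ : B e₀ e₀ ≈ a
    Q₁ = trans (e₀∙ (M e₀)) (solve 3 (λ a h g → a :* con (+ 1) :+ h :* con (+ 0) :+ g :* con (+ 0) := a)
      refl a h g)
    Q₁≉0 : ¬ (B e₀ e₀ ≈ 0#)
    Q₁≉0 Q₁≈0 = a≉0 (trans (sym Q₁) Q₁≈0)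
    ⊥₁₂ : B e₀ u₂ ≈ 0#
    ⊥₁₂ = trans (e₀∙ (M u₂)) (solve 3 (λ a h g → a :* (:- h) :+ h :* a :+ g :* con (+ 0) := con (+ 0))
      refl a h g)
    ⊥₁₃ : B e₀ u₃ ≈ 0#
    ⊥₁₃ = trans (B-sym e₀ u₃) (⨯-∙ˡ (M e₀) (M u₂))
    ⊥₂₃ : B u₂ u₃ ≈ 0#
    ⊥₂₃ = trans (B-sym u₂ u₃) (⨯-∙ʳ (M e₀) (M u₂))
    Q₃ : B u₃ u₃ ≈ det * (B e₀ e₀ * B u₂ u₂)
    Q₃ = trans (form-of-⨯ e₀ u₂) (*-congˡ (trans (+-congˡ (-‿cong (trans (*-congʳ ⊥₁₂) (zeroˡ _))))
      (solve 1 (λ x → x :- con (+ 0) := x) refl _)))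
    orthogonalise : Dec (B u₂ u₂ ≈ 0#) → IsotropicPair
    orthogonalise (yes Q₂≈0) = isotropicPair {u₂} (λ (_ , a≈0 , _) → a≉0 a≈0) Q₂≈0
    orthogonalise (no  Q₂≉0) = pigeonhole (isSquare? (B e₀ e₀ * B u₂ u₂)) (isSquare? (B e₀ e₀ * B u₃ u₃))
      where
      Q₃≉0 : ¬ (B u₃ u₃ ≈ 0#)
      Q₃≉0 Q₃≈0 = *-≉0 nondegenerate (*-≉0 Q₁≉0 Q₂≉0) (trans (sym Q₃) Q₃≈0)
      pigeonhole : Dec (IsSquare (B e₀ e₀ * B u₂ u₂)) → Dec (IsSquare (B e₀ e₀ * B u₃ u₃)) → IsotropicPair
      pigeonhole (yes s₁₂) _         = orthogonalPair ⊥₁₂ Q₁≉0 Q₂≉0 s₁₂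
      pigeonhole (no _)    (yes s₁₃) = orthogonalPair ⊥₁₃ Q₁≉0 Q₃≉0 s₁₃
      -- The product of the two non-squares is a square, and it is the square of the first value
      -- times the product of the other two.
      pigeonhole (no ¬s₁₂) (no ¬s₁₃) = orthogonalPair ⊥₂₃ Q₂≉0 Q₃≉0 (isSquare-cancel Q₁≉0
        (isSquare-resp (solve 3 (λ x y z → (x :* y) :* (x :* z) := x :* x :* (y :* z)) refl _ _ _)
          (nonSquare-* ¬s₁₂ ¬s₁₃)))

  -- As 4 = -1, the associated quadratic form is y² - x z.
  ⟪_,_⟫ : Triple → Triple → Carrier
  ⟪ c , d ⟫ = x₁ c * x₁ d + fromℤ (+ 2) * (x₀ c * x₂ d + x₂ c * x₀ d)

  record Coordinates : Set where
    field
      p₀ p₁ p₂ : Triple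
    φ : Triple → Triple
    φ c = lin₃ (x₀ c) p₀ (x₁ c) p₁ (x₂ c) p₂
    field
      ε     : Carrier
      ε≉0   : ¬ (ε ≈ 0#)
      B-φ   : ∀ c d → B (φ c) (φ d) ≈ ε * ⟪ c , d ⟫
      φ-onto : ∀ u → ∃[ c ] φ c ≋ u

  module FromIsotropic {p w : Triple} (Qp : B p p ≈ 0#) (Bwp≉0 : ¬ (B w p ≈ 0#)) where
    b b′ ε : Carrier
    b = B w p
    b′ = fromℤ (+ 2) * (b * b)
    ε = - (det * (b′ * b′))
    b′≉0 : ¬ (b′ ≈ 0#)
    b′≉0 = *-≉0 2≉0 (*-≉0 Bwp≉0 Bwp≉0)

    -- `r` is the second isotropic direction in the plane of `p` and `w`, scaled to avoid a
    -- division; `p₁` is orthogonal to that plane.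
    r p₁ p₂ : Triple
    r = lin₃ (fromℤ (+ 2) * b) w (- B w w) p 0# p
    p₁ = M p ⨯ M r
    τ : Carrier
    -- Chosen so that B (τ r) p = 2 ε, where ε is the value of `p₁`: a single scalar then factors
    -- out of the whole Gram matrix.
    τ = - (fromℤ (+ 2) * det * b′)
    p₂ = lin₃ τ r 0# r 0# r

    τ≉0 : ¬ (τ ≈ 0#)
    τ≉0 τ≈0 = *-≉0 (*-≉0 2≉0 nondegenerate) b′≉0
      (trans (sym (-‿involutive _)) (trans (-‿cong τ≈0) (solve 0 (:- con (+ 0) := con (+ 0)) refl)))

    lin-τ : ∀ {x y} → x ≈ y → τ * x + 0# * x + 0# * x ≈ τ * y
    lin-τ {x} {y} x≈y = trans (solve 2 (λ t x → t :* x :+ con (+ 0) :* x :+ con (+ 0) :* x := t :* x) refl τ x)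
      (*-congˡ x≈y)

    B-p₂ˡ : ∀ k → B p₂ k ≈ τ * B r k
    B-p₂ˡ k = trans (B-lin₃ τ r 0# r 0# r k) (lin-τ refl)

    Bpr : B p r ≈ b′
    Bpr = begin
      B p r                                                  ≈⟨ B-lin₃ʳ (fromℤ (+ 2) * b) w (- B w w) p 0# p p ⟩
      fromℤ (+ 2) * b * B p w + - B w w * B p p + 0# * B p p
        ≈⟨ +-cong (+-cong (*-congˡ (B-sym p w)) (*-congˡ Qp)) (*-congˡ Qp) ⟩
      fromℤ (+ 2) * b * b + - B w w * 0# + 0# * 0#
        ≈⟨ solve 2 (λ b o → con (+ 2) :* b :* b :+ :- o :* con (+ 0) :+ con (+ 0) :* con (+ 0)
             := con (+ 2) :* (b :* b)) refl b (B w w) ⟩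
      b′ ∎

    Bwr : B w r ≈ b * B w w
    Bwr = begin
      B w r                                                  ≈⟨ B-lin₃ʳ (fromℤ (+ 2) * b) w (- B w w) p 0# p w ⟩
      fromℤ (+ 2) * b * B w w + - B w w * b + 0# * b
        ≈⟨ solve 2 (λ b o → con (+ 2) :* b :* o :+ :- o :* b :+ con (+ 0) :* b
             := b :* o) refl b (B w w) ⟩
      b * B w w ∎

    Qr : B r r ≈ 0#
    Qr = begin
      B r r                                                  ≈⟨ B-lin₃ (fromℤ (+ 2) * b) w (- B w w) p 0# p r ⟩
      fromℤ (+ 2) * b * B w r + - B w w * B p r + 0# * B p r
        ≈⟨ +-cong (+-cong (*-congˡ Bwr) (*-congˡ Bpr)) (*-congˡ Bpr) ⟩
      fromℤ (+ 2) * b * (b * B w w) + - B w w * b′ + 0# * b′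
        ≈⟨ solve 2 (λ b o → con (+ 2) :* b :* (b :* o) :+ :- o :* (con (+ 2) :* (b :* b))
             :+ con (+ 0) :* (con (+ 2) :* (b :* b)) := con (+ 0)) refl b (B w w) ⟩
      0# ∎

    B₁₀ : B p₁ p ≈ 0#
    B₁₀ = ⨯-∙ˡ (M p) (M r)
    B₁r : B p₁ r ≈ 0#
    B₁r = ⨯-∙ʳ (M p) (M r)
    B₂₁ : B p₂ p₁ ≈ 0#
    B₂₁ = trans (B-p₂ˡ p₁) (trans (*-congˡ (trans (B-sym r p₁) B₁r)) (zeroʳ τ))
    B₁₁ : B p₁ p₁ ≈ ε
    B₁₁ = trans (form-of-⨯ p r) (trans (*-congˡ (+-cong (trans (*-congʳ Qp) (zeroˡ _)) (-‿cong (*-cong Bpr Bpr))))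
      (solve 2 (λ d b → d :* (con (+ 0) :- b :* b) := :- (d :* (b :* b))) refl det b′))
    B₂₀ : B p₂ p ≈ fromℤ (+ 2) * ε
    B₂₀ = trans (B-p₂ˡ p) (trans (*-congˡ (trans (B-sym r p) Bpr))
      (solve 2 (λ d b → :- (con (+ 2) :* d :* b) :* b := con (+ 2) :* :- (d :* (b :* b))) refl det b′))
    B₂₂ : B p₂ p₂ ≈ 0#
    B₂₂ = trans (B-p₂ˡ p₂) (trans (*-congˡ (trans (B-sym r p₂) (trans (B-p₂ˡ r) (trans (*-congˡ Qr) (zeroʳ τ)))))
      (zeroʳ τ))

    ε≉0 : ¬ (ε ≈ 0#)
    ε≉0 ε≈0 = *-≉0 nondegenerate (*-≉0 b′≉0 b′≉0)
      (trans (sym (-‿involutive _)) (trans (-‿cong ε≈0) (solve 0 (:- con (+ 0) := con (+ 0)) refl)))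

    φ : Triple → Triple
    φ c = lin₃ (x₀ c) p (x₁ c) p₁ (x₂ c) p₂

    B-φ-p : ∀ c → B (φ c) p ≈ fromℤ (+ 2) * ε * x₂ c
    B-φ-p ⟨ x , y , z ⟩ = trans (B-lin₃ x p y p₁ z p₂ p)
      (trans (+-cong (+-cong (*-congˡ Qp) (*-congˡ B₁₀)) (*-congˡ B₂₀))
        (solve 4 (λ x y z t → x :* con (+ 0) :+ y :* con (+ 0) :+ z :* t := t :* z) refl x y z _))

    B-φ-p₁ : ∀ c → B (φ c) p₁ ≈ ε * x₁ c
    B-φ-p₁ ⟨ x , y , z ⟩ = trans (B-lin₃ x p y p₁ z p₂ p₁)
      (trans (+-cong (+-cong (*-congˡ (trans (B-sym p p₁) B₁₀)) (*-congˡ B₁₁)) (*-congˡ B₂₁))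
        (solve 4 (λ x y z t → x :* con (+ 0) :+ y :* t :+ z :* con (+ 0) := t :* y) refl x y z ε))

    B-φ-p₂ : ∀ c → B (φ c) p₂ ≈ fromℤ (+ 2) * ε * x₀ c
    B-φ-p₂ ⟨ x , y , z ⟩ = trans (B-lin₃ x p y p₁ z p₂ p₂)
      (trans (+-cong (+-cong (*-congˡ (trans (B-sym p p₂) B₂₀)) (*-congˡ (trans (B-sym p₁ p₂) B₂₁))) (*-congˡ B₂₂))
        (solve 4 (λ x y z t → x :* t :+ y :* con (+ 0) :+ z :* con (+ 0) := t :* x) refl x y z _))

    B-φ : ∀ c d → B (φ c) (φ d) ≈ ε * ⟪ c , d ⟫
    B-φ c@(⟨ x , y , z ⟩) d@(⟨ x′ , y′ , z′ ⟩) = trans (B-lin₃ʳ x′ p y′ p₁ z′ p₂ (φ c))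
      (trans (+-cong (+-cong (*-congˡ (B-φ-p c)) (*-congˡ (B-φ-p₁ c))) (*-congˡ (B-φ-p₂ c)))
        (solve 7 (λ t x y z x′ y′ z′ →
          x′ :* (con (+ 2) :* t :* z) :+ y′ :* (t :* y) :+ z′ :* (con (+ 2) :* t :* x)
          := t :* (y :* y′ :+ con (+ 2) :* (x :* z′ :+ z :* x′))) refl ε x y z x′ y′ z′))

    -- The polars of `p`, `r` and `p₁` are independent: their triple product is B p₁ p₁, which is ε.
    orthogonal⇒zero : ∀ {v} → B v p ≈ 0# → B v r ≈ 0# → B v p₁ ≈ 0# → IsZero v
    orthogonal⇒zero {v} vp vr vp₁ =
      let c₀ , c₁ , c₂ = reciprocal-basis (M p) (M r) (M p₁) v
      in cancel c₀ , cancel c₁ , cancel c₂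
      where
      cancel : ∀ {x k l m} → B p₁ p₁ * x ≈ B v p * k + B v r * l + B v p₁ * m → x ≈ 0#
      cancel {x} {k} {l} {m} eq = *-cancel-0 (λ B₁₁≈0 → ε≉0 (trans (sym B₁₁) B₁₁≈0)) (trans eq
        (trans (+-cong (+-cong (*-congʳ vp) (*-congʳ vr)) (*-congʳ vp₁))
          (solve 3 (λ k l m → con (+ 0) :* k :+ con (+ 0) :* l :+ con (+ 0) :* m := con (+ 0)) refl k l m)))

    -- The coordinates are read off by pairing with the basis; `p` and `p₂` swap roles because they
    -- are dual to each other. The difference φ c - u is then orthogonal to the basis, hence zero.
    φ-onto : ∀ u → ∃[ c ] φ c ≋ u
    φ-onto u = c , -≈0⇒≈ (trans (difference _ _) z₀) , -≈0⇒≈ (trans (difference _ _) z₁)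
                 , -≈0⇒≈ (trans (difference _ _) z₂)
      where
      κ : Carrier
      κ = inv (fromℤ (+ 2) * ε) (*-≉0 2≉0 ε≉0)
      2εκ : fromℤ (+ 2) * ε * κ ≈ 1#
      2εκ = inverseʳ _ _
      c : Triple
      c = ⟨ κ * B u p₂ , fromℤ (+ 2) * κ * B u p₁ , κ * B u p ⟩
      v : Triple
      v = lin₃ 1# (φ c) (- 1#) u 0# u
      difference : ∀ x y → x - y ≈ 1# * x + - 1# * y + 0# * y
      difference = solve 2 (λ x y → x :- y := con (+ 1) :* x :+ :- con (+ 1) :* y :+ con (+ 0) :* y) refl
      B-v : ∀ k → B (φ c) k ≈ B u k → B v k ≈ 0#
      B-v k eq = trans (B-lin₃ 1# (φ c) (- 1#) u 0# u k) (trans (sym (difference _ _)) (-≈0 eq))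
      unit : ∀ x → fromℤ (+ 2) * ε * (κ * x) ≈ x
      unit x = trans (sym (*-assoc _ κ x)) (trans (*-congʳ 2εκ) (*-identityˡ x))
      vp : B v p ≈ 0#
      vp = B-v p (trans (B-φ-p c) (unit _))
      vp₁ : B v p₁ ≈ 0#
      vp₁ = B-v p₁ (trans (B-φ-p₁ c)
        (trans (solve 3 (λ e k x → e :* (con (+ 2) :* k :* x) := con (+ 2) :* e :* (k :* x)) refl ε κ (B u p₁))
               (unit _)))
      vr : B v r ≈ 0#
      vr = *-cancel-0 τ≉0 (trans (*-congˡ (B-sym v r)) (trans (sym (B-p₂ˡ v)) (trans (B-sym p₂ v)
        (B-v p₂ (trans (B-φ-p₂ c) (unit _))))))
      zero-v : IsZero v
      zero-v = orthogonal⇒zero vp vr vp₁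
      z₀ : x₀ v ≈ 0#
      z₀ = proj₁ zero-v
      z₁ : x₁ v ≈ 0#
      z₁ = proj₁ (proj₂ zero-v)
      z₂ : x₂ v ≈ 0#
      z₂ = proj₂ (proj₂ zero-v)

    fromIsotropic : Coordinates
    fromIsotropic = record
      { p₀ = p ; p₁ = p₁ ; p₂ = p₂ ; ε = ε ; ε≉0 = ε≉0 ; B-φ = B-φ ; φ-onto = φ-onto }

  coordinates : Coordinates
  coordinates = let p , w , Qp , Bwp≉0 = isotropicPair-exists in
    FromIsotropic.fromIsotropic {p} {w} Qp Bwp≉0

-- External lines as pairs of a field element and a non-square

module ExternalLines (F : Field) {q : ℕ} (e : HasSize (Field.setoid F) q)
  (5≈0 : Field._≈_ F (ℤSolver.fromℤ (Field.commutativeRing F) (+ 5)) (Field.0# F))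
  (O : Plane.Conic F) (hyperbolic : NormalForm.Coordinates F e 5≈0 O) where
  open Field F hiding (zero)
  open ℤSolver commutativeRing
  open SetoidReasoning setoid
  open FiniteFields F
  open Characteristic5 e 5≈0
  open Plane F hiding (*-cancel-0; inv≉0)
  open Conic O using (det; nondegenerate)
  open ConicForm F O
  open NormalForm F e 5≈0 O
  open Coordinates hyperbolic
  private
    module H = Setoid homogeneous
    module G = Graph (Γ O)

  ℓ : Triple → Triple
  ℓ c = M (φ c)

  ℓ-φ : ∀ c d → ℓ c ∙ φ d ≈ ε * ⟪ d , c ⟫
  ℓ-φ c d = trans (∙-comm (ℓ c) (φ d)) (B-φ d c)

  ⟪⟫-scale : ∀ d t c → ⟪ d , t *ₗ c ⟫ ≈ t * ⟪ d , c ⟫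
  ⟪⟫-scale ⟨ x , y , z ⟩ t ⟨ x′ , y′ , z′ ⟩ = solve 7 (λ t x y z x′ y′ z′ →
    y :* (t :* y′) :+ con (+ 2) :* (x :* (t :* z′) :+ z :* (t :* x′))
    := t :* (y :* y′ :+ con (+ 2) :* (x :* z′ :+ z :* x′))) refl t x y z x′ y′ z′

  ⟪⟫-nondegenerate : ∀ {c c′} → (∀ d → ⟪ d , c ⟫ ≈ ⟪ d , c′ ⟫) → c ≋ c′
  ⟪⟫-nondegenerate {c} {c′} eq =
    *-cancelˡ 2≉0 (trans (sym (at₂ c)) (trans (eq e₂) (at₂ c′))) ,
    trans (sym (at₁ c)) (trans (eq e₁) (at₁ c′)) ,
    *-cancelˡ 2≉0 (trans (sym (at₀ c)) (trans (eq e₀) (at₀ c′)))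
    where
    at₀ : ∀ c → ⟪ e₀ , c ⟫ ≈ fromℤ (+ 2) * x₂ c
    at₀ ⟨ x , y , z ⟩ = solve 3 (λ x y z → con (+ 0) :* y :+ con (+ 2) :* (con (+ 1) :* z :+ con (+ 0) :* x)
      := con (+ 2) :* z) refl x y z
    at₁ : ∀ c → ⟪ e₁ , c ⟫ ≈ x₁ c
    at₁ ⟨ x , y , z ⟩ = solve 3 (λ x y z → con (+ 1) :* y :+ con (+ 2) :* (con (+ 0) :* z :+ con (+ 0) :* x)
      := y) refl x y z
    at₂ : ∀ c → ⟪ e₂ , c ⟫ ≈ fromℤ (+ 2) * x₀ c
    at₂ ⟨ x , y , z ⟩ = solve 3 (λ x y z → con (+ 0) :* y :+ con (+ 2) :* (con (+ 0) :* z :+ con (+ 1) :* x)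
      := con (+ 2) :* x) refl x y z

  ℓ-injective : ∀ {c t c′} → ℓ c ≋ t *ₗ ℓ c′ → c ≋ t *ₗ c′
  ℓ-injective {c} {t} {c′} eq = ⟪⟫-nondegenerate λ d → *-cancelˡ ε≉0 (begin
    ε * ⟪ d , c ⟫           ≈⟨ B-φ d c ⟨
    φ d ∙ ℓ c               ≈⟨ ∙-cong {φ d} {φ d} ≋-refl eq ⟩
    φ d ∙ (t *ₗ ℓ c′)       ≈⟨ ∙-*ₗ (φ d) t (ℓ c′) ⟩
    t * (φ d ∙ ℓ c′)        ≈⟨ *-congˡ (B-φ d c′) ⟩
    t * (ε * ⟪ d , c′ ⟫)    ≈⟨ solve 3 (λ t e x → t :* (e :* x) := e :* (t :* x)) refl t ε _ ⟩
    ε * (t * ⟪ d , c′ ⟫)    ≈⟨ *-congˡ (⟪⟫-scale d t c′) ⟨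
    ε * ⟪ d , t *ₗ c′ ⟫     ∎)

  φ-cong : ∀ {c d} → c ≋ d → φ c ≋ φ d
  φ-cong (p , r , s) = row , row , row
    where
    row : ∀ {k l m} → _ * k + _ * l + _ * m ≈ _ * k + _ * l + _ * m
    row = +-cong (+-cong (*-congʳ p) (*-congʳ r)) (*-congʳ s)

  ℓ-cong : ∀ {c d} → c ≋ d → ℓ c ≋ ℓ d
  ℓ-cong c≋d = M-cong (φ-cong c≋d)

  φ-scale : ∀ t c → φ (t *ₗ c) ≋ t *ₗ φ c
  φ-scale t ⟨ x , y , z ⟩ = row _ _ _ , row _ _ _ , row _ _ _
    where
    row : ∀ k l m → t * x * k + t * y * l + t * z * m ≈ t * (x * k + y * l + z * m)
    row k l m = solve 7 (λ t x y z k l m → t :* x :* k :+ t :* y :* l :+ t :* z :* m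
      := t :* (x :* k :+ y :* l :+ z :* m)) refl t x y z k l m

  M-scale : ∀ t u → M (t *ₗ u) ≋ t *ₗ M u
  M-scale t u = ∙-*ₗ _ t u , ∙-*ₗ _ t u , ∙-*ₗ _ t u

  ≋-trans : ∀ {u w v} → u ≋ w → w ≋ v → u ≋ v
  ≋-trans (p , r , s) (p′ , r′ , s′) = trans p p′ , trans r r′ , trans s s′

  *ₗ-cong : ∀ {t s u w} → t ≈ s → u ≋ w → t *ₗ u ≋ s *ₗ w
  *ₗ-cong t≈s (p , r , s) = *-cong t≈s p , *-cong t≈s r , *-cong t≈s s

  ℓ-scale : ∀ t c → ℓ (t *ₗ c) ≋ t *ₗ ℓ c
  ℓ-scale t c = ≋-trans (M-cong (φ-scale t c)) (M-scale t (φ c))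

  disc : Triple → Carrier
  disc c = x₁ c * x₁ c - x₀ c * x₂ c

  ℓ-nonzero : ∀ {c} → ¬ IsZero c → ¬ IsZero (ℓ c)
  ℓ-nonzero {c} c≉0 (p , r , s) = c≉0 (vanish c≋0 , vanish′ c≋0 , vanish″ c≋0)
    where
    -- A vanishing `ℓ c` is `0#` times itself, and `ℓ-injective` transports this scalar to `c`.
    c≋0 : c ≋ 0# *ₗ c
    c≋0 = ℓ-injective {c} {0#} {c}
      (trans p (sym (zeroˡ _)) , trans r (sym (zeroˡ _)) , trans s (sym (zeroˡ _)))
    vanish : c ≋ 0# *ₗ c → x₀ c ≈ 0#
    vanish (eq , _) = trans eq (zeroˡ _)
    vanish′ : c ≋ 0# *ₗ c → x₁ c ≈ 0#
    vanish′ (_ , eq , _) = trans eq (zeroˡ _)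
    vanish″ : c ≋ 0# *ₗ c → x₂ c ≈ 0#
    vanish″ (_ , _ , eq) = trans eq (zeroˡ _)

  φ-zero : ∀ {c} → IsZero c → IsZero (φ c)
  φ-zero (p , r , s) = row _ _ _ , row _ _ _ , row _ _ _
    where
    row : ∀ k l m → _ * k + _ * l + _ * m ≈ 0#
    row k l m = trans (+-cong (+-cong (*-congʳ p) (*-congʳ r)) (*-congʳ s))
      (solve 3 (λ k l m → con (+ 0) :* k :+ con (+ 0) :* l :+ con (+ 0) :* m := con (+ 0)) refl k l m)

  φ-nonzero : ∀ {c} → ¬ IsZero c → ¬ IsZero (φ c)
  φ-nonzero {c} c≉0 φc≈0 = ℓ-nonzero c≉0
    (∙-zero _ φc≈0 , ∙-zero _ φc≈0 , ∙-zero _ φc≈0)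

  -- The point ⟨ s , m , t ⟩ lies on the conic and on ℓ ⟨ x , y , z ⟩ when m² = s t and
  -- y m + 2 (s z + t x) = 0; then (4 x m + y s)² = s² (y² - 16 x z).
  nonSquare⇒external : ∀ {c} → NonSquare (disc c) → (ℓc≉0 : ¬ IsZero (ℓ c)) → External O (ℓ c , ℓc≉0)
  nonSquare⇒external {c@(⟨ x , y , z ⟩)} ¬disc _ (P , P≉0) on-line on-conic =
    cases (s ≟ 0#)
    where
    d : Triple
    d = proj₁ (φ-onto P)
    φd≋P : φ d ≋ P
    φd≋P = proj₂ (φ-onto P)
    s m t : Carrier
    s = x₀ d
    m = x₁ d
    t = x₂ d
    R₁ : m * y + fromℤ (+ 2) * (s * z + t * x) ≈ 0#
    R₁ = *-cancel-0 ε≉0 (trans (sym (ℓ-φ c d)) (trans (∙-cong {ℓ c} {ℓ c} ≋-refl φd≋P) on-line))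
    R₂ : m * m ≈ s * t
    R₂ = mod5 (- (s * t)) (-≈0⇒≈ (trans
      (solve 3 (λ m s t → m :* m :- (s :* t :+ con (+ 5) :* (:- (s :* t)))
         := m :* m :+ con (+ 2) :* (s :* t :+ t :* s)) refl m s t)
      (*-cancel-0 ε≉0 (trans (sym (B-φ d d)) (trans (∙-cong {φ d} {P} φd≋P (M-cong φd≋P)) on-conic)))))
    cases : Dec (s ≈ 0#) → ⊥
    cases (no s≉0) = ¬disc (isSquare-cancel s≉0 (fromℤ (+ 4) * x * m + y * s , (begin
      (fromℤ (+ 4) * x * m + y * s) * (fromℤ (+ 4) * x * m + y * s)
        ≈⟨ solve 6 (λ x y z s m t → (con (+ 4) :* x :* m :+ y :* s) :* (con (+ 4) :* x :* m :+ y :* s)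
             := con (+ 8) :* x :* s :* (m :* y :+ con (+ 2) :* (s :* z :+ t :* x))
               :+ con (+ 16) :* x :* x :* (m :* m :- s :* t)
               :+ s :* s :* (y :* y :- con (+ 16) :* (x :* z))) refl x y z s m t ⟩
      fromℤ (+ 8) * x * s * (m * y + fromℤ (+ 2) * (s * z + t * x))
        + fromℤ (+ 16) * x * x * (m * m - s * t) + s * s * (y * y - fromℤ (+ 16) * (x * z))
        ≈⟨ +-congʳ (+-cong (*-congˡ R₁) (*-congˡ (-≈0 R₂))) ⟩
      fromℤ (+ 8) * x * s * 0# + fromℤ (+ 16) * x * x * 0# + s * s * (y * y - fromℤ (+ 16) * (x * z))
        ≈⟨ mod5 (- (fromℤ (+ 3) * s * s * x * z)) (solve 4 (λ x y z s →
             con (+ 8) :* x :* s :* con (+ 0) :+ con (+ 16) :* x :* x :* con (+ 0)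
               :+ s :* s :* (y :* y :- con (+ 16) :* (x :* z))
             := s :* s :* (y :* y :- x :* z) :+ con (+ 5) :* (:- (con (+ 3) :* s :* s :* x :* z)))
             refl x y z s) ⟩
      s * s * disc c ∎)))
    -- The only point of the conic with s = 0 is (0, 0, 1). A line through it has x = 0, and its
    -- discriminant is y².
    cases (yes s≈0) = ¬disc (y , (begin
      y * y             ≈⟨ solve 2 (λ y z → y :* y := y :* y :- con (+ 0) :* z) refl y z ⟩
      y * y - 0# * z    ≈⟨ +-congˡ (-‿cong (*-congʳ x≈0)) ⟨
      y * y - x * z     ∎))
      where
      m≈0 : m ≈ 0#
      m≈0 with m ≟ 0#
      ... | yes m≈0 = m≈0
      ... | no  m≉0 = contradiction (trans R₂ (trans (*-congʳ s≈0) (zeroˡ t))) (*-≉0 m≉0 m≉0)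
      t≉0 : ¬ (t ≈ 0#)
      t≉0 t≈0 = P≉0 (let k₀ , k₁ , k₂ = φd≋P ; z₀ , z₁ , z₂ = φ-zero {d} (s≈0 , m≈0 , t≈0) in
        trans (sym k₀) z₀ , trans (sym k₁) z₁ , trans (sym k₂) z₂)
      x≈0 : x ≈ 0#
      x≈0 = *-cancel-0 (*-≉0 2≉0 t≉0) (begin
        fromℤ (+ 2) * t * x
          ≈⟨ solve 4 (λ x y z t → con (+ 2) :* t :* x := con (+ 0) :* y :+ con (+ 2) :* (con (+ 0) :* z :+ t :* x))
               refl x y z t ⟩
        0# * y + fromℤ (+ 2) * (0# * z + t * x)
          ≈⟨ +-cong (*-congʳ m≈0) (*-congˡ (+-congʳ (*-congʳ s≈0))) ⟨
        m * y + fromℤ (+ 2) * (s * z + t * x)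
          ≈⟨ R₁ ⟩
        0# ∎)

  -- The intersection points are found by solving the quadratic equation above.
  external⇒nonSquare : ∀ {c} (ℓc≉0 : ¬ IsZero (ℓ c)) → External O (ℓ c , ℓc≉0) → NonSquare (disc c)
  external⇒nonSquare {c@(⟨ x , y , z ⟩)} ℓc≉0 external (k , k²≈disc) with x ≟ 0#
  ... | yes x≈0 = external (φ e₂ , φ-nonzero {e₂} (λ (_ , _ , 1≈0) → 1≉0 1≈0))
    (trans (ℓ-φ c e₂) (trans (*-congˡ (trans
      (solve 3 (λ x y z → con (+ 0) :* y :+ con (+ 2) :* (con (+ 0) :* z :+ con (+ 1) :* x) := con (+ 2) :* x)
         refl x y z)
      (trans (*-congˡ x≈0) (zeroʳ _)))) (zeroʳ ε)))
    (trans (B-φ e₂ e₂) (trans (*-congˡ (solve 0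
      (con (+ 0) :* con (+ 0) :+ con (+ 2) :* (con (+ 0) :* con (+ 1) :+ con (+ 1) :* con (+ 0)) := con (+ 0)) refl))
      (zeroʳ ε)))
  ... | no x≉0 = external (φ d , φ-nonzero {d} (λ (xx≈0 , _) → *-≉0 4x≉0 4x≉0 xx≈0))
    (trans (ℓ-φ c d) (trans (*-congˡ on-line) (zeroʳ ε)))
    (trans (B-φ d d) (trans (*-congˡ on-conic) (zeroʳ ε)))
    where
    4x m : Carrier
    4x = fromℤ (+ 4) * x
    m  = k - y
    d : Triple
    -- Points (S², S μ, μ²) lie on the conic, and on the line when 2 x μ² + y S μ + 2 z S² = 0. The
    -- root μ / S = (k - y) / (4 x) gives this point after clearing the denominator.
    d = ⟨ 4x * 4x , 4x * m , m * m ⟩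
    4x≉0 : ¬ (4x ≈ 0#)
    4x≉0 = *-≉0 (λ 4≈0 → *-≉0 2≉0 2≉0 (trans (solve 0 (con (+ 2) :* con (+ 2) := con (+ 4)) refl) 4≈0)) x≉0
    on-line : ⟪ d , c ⟫ ≈ 0#
    on-line = begin
      4x * m * y + fromℤ (+ 2) * (4x * 4x * z + m * m * x)
        ≈⟨ solve 4 (λ x y z k →
             con (+ 4) :* x :* (k :- y) :* y :+ con (+ 2) :* (con (+ 4) :* x :* (con (+ 4) :* x) :* z :+ (k :- y) :* (k :- y) :* x)
             := con (+ 2) :* x :* (k :* k :- y :* y :+ con (+ 16) :* (x :* z))) refl x y z k ⟩
      fromℤ (+ 2) * x * (k * k - y * y + fromℤ (+ 16) * (x * z))
        ≈⟨ *-congˡ (+-congʳ (+-congʳ k²≈disc)) ⟩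
      fromℤ (+ 2) * x * (y * y - x * z - y * y + fromℤ (+ 16) * (x * z))
        ≈⟨ mod5 (fromℤ (+ 6) * x * (x * z)) (solve 3 (λ x y z →
             con (+ 2) :* x :* (y :* y :- x :* z :- y :* y :+ con (+ 16) :* (x :* z))
             := con (+ 0) :+ con (+ 5) :* (con (+ 6) :* x :* (x :* z))) refl x y z) ⟩
      0# ∎
    on-conic : ⟪ d , d ⟫ ≈ 0#
    on-conic = mod5 (4x * 4x * (m * m)) (solve 2 (λ a m →
      a :* m :* (a :* m) :+ con (+ 2) :* (a :* a :* (m :* m) :+ m :* m :* (a :* a))
      := con (+ 0) :+ con (+ 5) :* (a :* a :* (m :* m))) refl 4x m)

  Model : Setoid 0ℓ 0ℓ
  Model = setoid ×ₛ SubSetoid setoid NonSquare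

  open Setoid Model using () renaming (Carrier to ModelVertex; _≈_ to _≈ₘ_)

  coords : ModelVertex → Triple
  coords (y , n , _) = ⟨ 1# , y , y * y - n ⟩

  disc-coords : ∀ a → disc (coords a) ≈ proj₁ (proj₂ a)
  disc-coords (y , n , _) = solve 2 (λ y n → y :* y :- con (+ 1) :* (y :* y :- n) := n) refl y n

  toLine : ModelVertex → G.Vertex
  toLine a = (ℓ (coords a) , nonzero-ℓ)
    , nonSquare⇒external (nonSquare-resp (sym (disc-coords a)) (proj₂ (proj₂ a))) nonzero-ℓ
    where
    nonzero-ℓ : ¬ IsZero (ℓ (coords a))
    nonzero-ℓ = ℓ-nonzero {coords a} (λ (1≈0 , _) → 1≉0 1≈0)

  toLine-cong : ∀ {a b} → a ≈ₘ b → toLine a G.≈ toLine b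
  toLine-cong {a} {b} (y≈ , n≈) = 1# , 1≉0 ,
    ≋-trans (ℓ-cong {coords a} {coords b} (refl , y≈ , +-cong (*-cong y≈ y≈) (-‿cong n≈)))
            (sym (*-identityˡ _) , sym (*-identityˡ _) , sym (*-identityˡ _))

  toLine-injective : ∀ {a b} → toLine a G.≈ toLine b → a ≈ₘ b
  toLine-injective {y , n , _} {y′ , n′ , _} (t , _ , eq) =
    let 1≈t1 , y≈ty′ , z≈tz′ = ℓ-injective {⟨ 1# , y , y * y - n ⟩} {t} {⟨ 1# , y′ , y′ * y′ - n′ ⟩} eq
        t≈1 = trans (sym (*-identityʳ t)) (sym 1≈t1)
        y≈y′ = trans y≈ty′ (trans (*-congʳ t≈1) (*-identityˡ y′))
        z≈z′ = trans z≈tz′ (trans (*-congʳ t≈1) (*-identityˡ _))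
    in y≈y′ , (begin
      n                        ≈⟨ solve 2 (λ y n → n := y :* y :- (y :* y :- n)) refl y n ⟩
      y * y - (y * y - n)      ≈⟨ +-cong (*-cong y≈y′ y≈y′) (-‿cong z≈z′) ⟩
      y′ * y′ - (y′ * y′ - n′) ≈⟨ solve 2 (λ y n → n := y :* y :- (y :* y :- n)) refl y′ n′ ⟨
      n′                       ∎)

  -- Take the coordinates of the pole of the line. Were the first one zero, the discriminant would
  -- be the square y² and the line not external; so it can be scaled to 1, which multiplies the
  -- discriminant by a square.
  toLine-onto : ∀ l → ∃[ a ] toLine a G.≈ l
  toLine-onto ((l , l≉0) , l-external) = a , t , t≉0 , line≋
    where
    c : Triple
    c = proj₁ (φ-onto (A l))
    x y z : Carrier
    x = x₀ c
    y = x₁ c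
    z = x₂ c
    ℓc≋ : ℓ c ≋ det *ₗ l
    ℓc≋ = ≋-trans (M-cong (proj₂ (φ-onto (A l)))) (MA l)
    ℓc≉0 : ¬ IsZero (ℓ c)
    ℓc≉0 (p , r , s) = let k₀ , k₁ , k₂ = ℓc≋ in l≉0
      ( *-cancel-0 nondegenerate (trans (sym k₀) p)
      , *-cancel-0 nondegenerate (trans (sym k₁) r)
      , *-cancel-0 nondegenerate (trans (sym k₂) s) )
    ℓc-external : External O (ℓ c , ℓc≉0)
    ℓc-external P P-on = l-external P (*-cancel-0 nondegenerate (begin
      det * (l ∙ proj₁ P)      ≈⟨ *-congˡ (∙-comm l (proj₁ P)) ⟩
      det * (proj₁ P ∙ l)      ≈⟨ ∙-*ₗ (proj₁ P) det l ⟨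
      proj₁ P ∙ (det *ₗ l)     ≈⟨ ∙-comm (proj₁ P) (det *ₗ l) ⟩
      (det *ₗ l) ∙ proj₁ P     ≈⟨ ∙-cong ℓc≋ (≋-refl {proj₁ P}) ⟨
      ℓ c ∙ proj₁ P            ≈⟨ P-on ⟩
      0#                       ∎))
    ¬disc : NonSquare (disc c)
    ¬disc = external⇒nonSquare ℓc≉0 ℓc-external
    x≉0 : ¬ (x ≈ 0#)
    x≉0 x≈0 = ¬disc (y , (begin
      y * y             ≈⟨ solve 2 (λ y z → y :* y := y :* y :- con (+ 0) :* z) refl y z ⟩
      y * y - 0# * z    ≈⟨ +-congˡ (-‿cong (*-congʳ x≈0)) ⟨
      y * y - x * z     ∎))
    i : Carrier
    i = inv x x≉0
    ix≈1 : i * x ≈ 1#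
    ix≈1 = trans (*-comm i x) (inverseʳ x x≉0)
    a : ModelVertex
    a = i * y , i * i * disc c , λ sq → ¬disc (isSquare-cancel (inv≉0 x≉0) sq)
    coords≋ : coords a ≋ i *ₗ c
    coords≋ = sym ix≈1 , refl , (begin
      i * y * (i * y) - i * i * (y * y - x * z)
        ≈⟨ solve 4 (λ i x y z → i :* y :* (i :* y) :- i :* i :* (y :* y :- x :* z) := i :* x :* (i :* z))
             refl i x y z ⟩
      i * x * (i * z)   ≈⟨ trans (*-congʳ ix≈1) (*-identityˡ _) ⟩
      i * z             ∎)
    t : Carrier
    t = i * det
    t≉0 : ¬ (t ≈ 0#)
    t≉0 = *-≉0 (inv≉0 x≉0) nondegenerate
    line≋ : ℓ (coords a) ≋ t *ₗ l
    line≋ = ≋-trans (ℓ-cong {coords a} {i *ₗ c} coords≋) (≋-trans (ℓ-scale i c)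
      (≋-trans (*ₗ-cong refl ℓc≋) (sym (*-assoc i det _) , sym (*-assoc i det _) , sym (*-assoc i det _))))

  Near : ModelVertex → ModelVertex → Set
  Near (y , n , _) (y′ , n′ , _) = (y - y′) * (y - y′) ≈ n + n′

  near? : ∀ a b → Dec (Near a b)
  near? a b = _ ≟ _

  near-irreflexive : ∀ {a b} → a ≈ₘ b → ¬ Near a b
  near-irreflexive {y , n , ¬n} {y′ , n′ , _} (y≈y′ , n≈n′) eq =
    *-≉0 2≉0 (nonSquare-≉0 ¬n) (begin
      fromℤ (+ 2) * n         ≈⟨ solve 1 (λ n → con (+ 2) :* n := n :+ n) refl n ⟩
      n + n                   ≈⟨ +-congˡ n≈n′ ⟩
      n + n′                  ≈⟨ eq ⟨
      (y - y′) * (y - y′)     ≈⟨ *-congʳ (-≈0 y≈y′) ⟩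
      0# * (y - y′)           ≈⟨ zeroˡ _ ⟩
      0#                      ∎)

  conjugate-form : ∀ c d → ℓ d ∙ A (ℓ c) ≈ det * (ε * ⟪ d , c ⟫)
  conjugate-form c d = begin
    ℓ d ∙ A (ℓ c)              ≈⟨ ∙-comm (ℓ d) (A (ℓ c)) ⟩
    B (A (ℓ c)) (φ d)          ≈⟨ B-sym (A (ℓ c)) (φ d) ⟩
    φ d ∙ M (A (ℓ c))          ≈⟨ ∙-cong {φ d} {φ d} ≋-refl (MA (ℓ c)) ⟩
    φ d ∙ (det *ₗ ℓ c)         ≈⟨ ∙-*ₗ (φ d) det (ℓ c) ⟩
    det * B (φ d) (φ c)        ≈⟨ *-congˡ (B-φ d c) ⟩
    det * (ε * ⟪ d , c ⟫)      ∎

  -- Modulo 5 the mixed term y y′ equals -4 y y′, which completes twice the square of y - y′.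
  ⟪coords⟫ : ∀ a b → ⟪ coords b , coords a ⟫ ≈
    fromℤ (+ 2) * ((proj₁ a - proj₁ b) * (proj₁ a - proj₁ b) - (proj₁ (proj₂ a) + proj₁ (proj₂ b)))
  ⟪coords⟫ (y , n , _) (y′ , n′ , _) = mod5 (y * y′) (solve 4 (λ y n y′ n′ →
    y′ :* y :+ con (+ 2) :* (con (+ 1) :* (y :* y :- n) :+ (y′ :* y′ :- n′) :* con (+ 1))
    := con (+ 2) :* ((y :- y′) :* (y :- y′) :- (n :+ n′)) :+ con (+ 5) :* (y :* y′)) refl y n y′ n′)

  near⇒adjacent : ∀ {a b} → Near a b → G.Adj (toLine a) (toLine b)
  near⇒adjacent {a} {b} near =
    (λ same → near-irreflexive {a} {b} (toLine-injective {a} {b} same) near) ,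
    trans (conjugate-form (coords a) (coords b)) (trans (*-congˡ (trans (*-congˡ
      (trans (⟪coords⟫ a b) (trans (*-congˡ (-≈0 near)) (zeroʳ _)))) (zeroʳ ε))) (zeroʳ det))

  adjacent⇒near : ∀ {a b} → G.Adj (toLine a) (toLine b) → Near a b
  adjacent⇒near {a} {b} (_ , conjugate) = -≈0⇒≈ (*-cancel-0 2≉0 (trans (sym (⟪coords⟫ a b))
    (*-cancel-0 ε≉0 (*-cancel-0 nondegenerate
      (trans (sym (conjugate-form (coords a) (coords b))) conjugate)))))

  -- With a = y₁ - y₂ and b = y₁ - y₃ the three equations give n₁ = a b, n₂ = a (a - b), n₃ = b (b -
  -- a), hence (a - b)² n₁ = - n₂ n₃. The product n₂ n₃ of non-squares is a square and so is -1,
  -- which makes n₁ a square. If a = b, then n₁ = a² already.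
  near-no-triangle : ∀ {a b c} → Near a b → Near a c → ¬ Near b c
  near-no-triangle {y₁ , n₁ , ¬n₁} {y₂ , n₂ , ¬n₂} {y₃ , n₃ , ¬n₃} ab ac bc = cases (a ≟ b)
    where
    a b : Carrier
    a = y₁ - y₂
    b = y₁ - y₃
    ab≈n₁ : a * b ≈ n₁
    ab≈n₁ = *-cancelˡ 2≉0 (begin
      fromℤ (+ 2) * (a * b)
        ≈⟨ solve 3 (λ x y z → con (+ 2) :* ((x :- y) :* (x :- z)) :=
             (x :- y) :* (x :- y) :+ (x :- z) :* (x :- z) :- (y :- z) :* (y :- z)) refl y₁ y₂ y₃ ⟩
      a * a + b * b - (y₂ - y₃) * (y₂ - y₃)
        ≈⟨ +-cong (+-cong ab ac) (-‿cong bc) ⟩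
      n₁ + n₂ + (n₁ + n₃) - (n₂ + n₃)
        ≈⟨ solve 3 (λ x y z → x :+ y :+ (x :+ z) :- (y :+ z) := con (+ 2) :* x) refl n₁ n₂ n₃ ⟩
      fromℤ (+ 2) * n₁ ∎)
    n₂≈ : n₂ ≈ a * a - a * b
    n₂≈ = trans (solve 2 (λ x y → y := x :+ y :- x) refl n₁ n₂) (+-cong (sym ab) (-‿cong (sym ab≈n₁)))
    n₃≈ : n₃ ≈ b * b - a * b
    n₃≈ = trans (solve 2 (λ x y → y := x :+ y :- x) refl n₁ n₃) (+-cong (sym ac) (-‿cong (sym ab≈n₁)))
    cases : Dec (a ≈ b) → ⊥
    cases (yes a≈b) = ¬n₁ (a , trans (*-congˡ a≈b) ab≈n₁)
    cases (no  a≉b) = ¬n₁ (isSquare-cancel (-≉0 a≉b) (isSquare-resp (begin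
      - (n₂ * n₃)
        ≈⟨ -‿cong (*-cong n₂≈ n₃≈) ⟩
      - ((a * a - a * b) * (b * b - a * b))
        ≈⟨ solve 2 (λ a b → :- ((a :* a :- a :* b) :* (b :* b :- a :* b))
             := (a :- b) :* (a :- b) :* (a :* b)) refl a b ⟩
      (a - b) * (a - b) * (a * b)
        ≈⟨ *-congˡ ab≈n₁ ⟩
      (a - b) * (a - b) * n₁ ∎) (isSquare-neg (nonSquare-* ¬n₂ ¬n₃))))

  -- Subtracting the equations of a common neighbour eliminates its second coordinate and leaves a
  -- linear equation for the first, with slope a multiple of y₁ - y₂. A zero slope would force n₁ =
  -- n₂ as well.
  near-unique : ∀ {a b c d} → ¬ (a ≈ₘ b) → Near a c → Near b c → Near a d → Near b d → c ≈ₘ d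
  near-unique {y₁ , n₁ , _} {y₂ , n₂ , _} {y , n , _} {y′ , n′ , _} a≉b ac bc ad bd =
    y≈y′ , (begin
      n                                ≈⟨ solve 2 (λ n m → n := m :+ n :- m) refl n n₁ ⟩
      n₁ + n - n₁                      ≈⟨ +-congʳ ac ⟨
      (y₁ - y) * (y₁ - y) - n₁         ≈⟨ +-congʳ (*-cong (+-congˡ (-‿cong y≈y′)) (+-congˡ (-‿cong y≈y′))) ⟩
      (y₁ - y′) * (y₁ - y′) - n₁       ≈⟨ +-congʳ ad ⟩
      n₁ + n′ - n₁                     ≈⟨ solve 2 (λ n m → n := m :+ n :- m) refl n′ n₁ ⟨
      n′                               ∎)
    where
    difference : ∀ x m → (y₁ - x) * (y₁ - x) ≈ n₁ + m → (y₂ - x) * (y₂ - x) ≈ n₂ + m →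
                 (y₁ - y₂) * (y₁ + y₂ - fromℤ (+ 2) * x) ≈ n₁ - n₂
    difference x m p r = begin
      (y₁ - y₂) * (y₁ + y₂ - fromℤ (+ 2) * x)
        ≈⟨ solve 3 (λ a b x → (a :- b) :* (a :+ b :- con (+ 2) :* x) :=
             (a :- x) :* (a :- x) :- (b :- x) :* (b :- x)) refl y₁ y₂ x ⟩
      (y₁ - x) * (y₁ - x) - (y₂ - x) * (y₂ - x)
        ≈⟨ +-cong p (-‿cong r) ⟩
      n₁ + m - (n₂ + m)
        ≈⟨ solve 3 (λ a b m → a :+ m :- (b :+ m) := a :- b) refl n₁ n₂ m ⟩
      n₁ - n₂ ∎
    y₁≉y₂ : ¬ (y₁ ≈ y₂)
    y₁≉y₂ y₁≈y₂ = a≉b (y₁≈y₂ , sym (-≈0⇒≈ (begin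
      n₂ - n₁      ≈⟨ solve 2 (λ a b → b :- a := :- (a :- b)) refl n₁ n₂ ⟩
      - (n₁ - n₂)  ≈⟨ -‿cong (difference y n ac bc) ⟨
      - ((y₁ - y₂) * (y₁ + y₂ - fromℤ (+ 2) * y))  ≈⟨ -‿cong (*-congʳ (-≈0 y₁≈y₂)) ⟩
      - (0# * (y₁ + y₂ - fromℤ (+ 2) * y))         ≈⟨ solve 1 (λ t → :- (con (+ 0) :* t) := con (+ 0)) refl _ ⟩
      0#           ∎)))
    y≈y′ : y ≈ y′
    y≈y′ = *-cancelˡ 2≉0 (-≈0⇒≈ (*-cancel-0 (-≉0 y₁≉y₂) (begin
      (y₁ - y₂) * (fromℤ (+ 2) * y - fromℤ (+ 2) * y′)
        ≈⟨ solve 4 (λ a b x x′ → (a :- b) :* (con (+ 2) :* x :- con (+ 2) :* x′) :=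
             (a :- b) :* (a :+ b :- con (+ 2) :* x′) :- (a :- b) :* (a :+ b :- con (+ 2) :* x)) refl y₁ y₂ y y′ ⟩
      (y₁ - y₂) * (y₁ + y₂ - fromℤ (+ 2) * y′) - (y₁ - y₂) * (y₁ + y₂ - fromℤ (+ 2) * y)
        ≈⟨ +-cong (difference y′ n′ ad bd) (-‿cong (difference y n ac bc)) ⟩
      n₁ - n₂ - (n₁ - n₂)
        ≈⟨ -‿inverseʳ _ ⟩
      0# ∎)))

  neighbours : ∀ a → Inverse (SubSetoid setoid (λ d → NonSquare (d * d - proj₁ (proj₂ a))))
                             (SubSetoid Model (Near a))
  neighbours a@(y , n , _) = bijection⇒inverse
    (λ (d , ¬d) → (y + d , d * d - n , ¬d) ,
      solve 3 (λ y d n → (y :- (y :+ d)) :* (y :- (y :+ d)) := n :+ (d :* d :- n)) refl y d n)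
    (λ d≈d′ → +-congˡ d≈d′ , +-congʳ (*-cong d≈d′ d≈d′))
    (λ {(d , _)} {(d′ , _)} (eq , _) → begin
      d           ≈⟨ solve 2 (λ y d → d := y :+ d :- y) refl y d ⟩
      y + d - y   ≈⟨ +-congʳ eq ⟩
      y + d′ - y  ≈⟨ solve 2 (λ y d → d := y :+ d :- y) refl y d′ ⟨
      d′          ∎)
    (λ ((y′ , n′ , ¬n′) , near) →
      let n′≈ : n′ ≈ (y′ - y) * (y′ - y) - n
          n′≈ = begin
            n′                          ≈⟨ solve 2 (λ n n′ → n′ := n :+ n′ :- n) refl n n′ ⟩
            n + n′ - n                  ≈⟨ +-congʳ near ⟨
            (y - y′) * (y - y′) - n     ≈⟨ solve 3 (λ y y′ n → (y :- y′) :* (y :- y′) :- n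
                                             := (y′ :- y) :* (y′ :- y) :- n) refl y y′ n ⟩
            (y′ - y) * (y′ - y) - n     ∎
      in (y′ - y , nonSquare-resp n′≈ ¬n′) ,
         solve 2 (λ y y′ → y :+ (y′ :- y) := y′) refl y y′ , sym n′≈)

-- Triangle-free graphs in which two vertices have at most one common neighbour

module _ {n : ℕ} {P : Fin n → Set} (P? : Unary.Decidable P) where
  count-none : (∀ i → ¬ P i) → count P? ≡ 0
  -- The count is generalised to `m`, which can be split by cases together with the enumeration.
  count-none none = helper (count P?) (index P?)
    where
    helper : ∀ m → (Fin m → ∃ P) → m ≡ 0
    helper zero    ix = ≡.refl
    helper (suc m) ix = contradiction (proj₂ (ix zero)) (none (proj₁ (ix zero)))

  count≤1 : (∀ {i j} → P i → P j → i ≡ j) → count P? ℕ.≤ 1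
  count≤1 unique = helper (count P?) (index P?) λ eq →
    ≡.trans (≡.sym (rank-index P? _)) (≡.trans (rank-cong P? _ _ eq) (rank-index P? _))
    where
    helper : ∀ m (ix : Fin m → ∃ P) → (∀ {k l} → proj₁ (ix k) ≡ proj₁ (ix l) → k ≡ l) → m ℕ.≤ 1
    helper zero          ix inj = z≤n
    helper (suc zero)    ix inj = s≤s z≤n
    helper (suc (suc m)) ix inj =
      contradiction (inj {zero} {suc zero} (unique (proj₂ (ix zero)) (proj₂ (ix (suc zero))))) λ ()

-- The order is kept as the product q r with q = 2 r + 1, the size of the model of pairs of a field
-- element and a non-square.
record TriangleFreeGraph (Γ : Graph) (r : ℕ) : Set where
  open Graph Γ
  field
    order        : HasSize vertices (suc (r ℕ.+ r) ℕ.* r)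
    regular      : Regular Γ (suc r)
    adj?         : Decidable Adj
    triangleFree : ∀ {a b c} → Adj a b → Adj a c → ¬ Adj b c
    uniqueCommon : ∀ {a b c d} → ¬ (a ≈ b) → Adj a c → Adj b c → Adj a d → Adj b d → c ≈ d

module _ {Γ : Graph} {ρ : ℕ} (T : TriangleFreeGraph Γ (suc (suc ρ))) where
  open TriangleFreeGraph T
  private
    module Γ = Graph Γ
    r v : ℕ
    r = suc (suc ρ)
    v = suc (r ℕ.+ r) ℕ.* r

  edgeRegular : EdgeRegular Γ v (suc r) 0
  edgeRegular = record
    { order           = order
    ; regular         = regular
    ; commonNeighbors = λ a b ab → mkInverse (λ ()) (λ (c , ac , bc) → contradiction bc (triangleFree ab ac))
        (λ { {()} }) (λ {(c , ac , bc)} _ → contradiction bc (triangleFree ab ac))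
        (λ (c , ac , bc) → contradiction bc (triangleFree ab ac)) (λ ())
    }

  private
    0≤+ : ∀ {i j} → + 0 Int.≤ i → + 0 Int.≤ j → + 0 Int.≤ i Int.+ j
    0≤+ = ℤₚ.+-mono-≤

    0≤* : ∀ {i j} → + 0 Int.≤ i → + 0 Int.≤ j → + 0 Int.≤ i Int.* j
    0≤* {+ m} {+ n} _ _ = ≡.subst (+ 0 Int.≤_) (ℤₚ.pos-* m n) (Int.+≤+ z≤n)

    0≤ℕ : ∀ n → + 0 Int.≤ + n
    0≤ℕ n = Int.+≤+ z≤n

  -- With v = r (2 r + 1) and k = r + 1, the value at s = 2 is x ((x + 1) (v - 2) - 4 r), and
  -- v - 2 = 2 r + w.
  CA-at-2 : ∀ x → + 0 Int.≤ CA (+ v) (+ suc r) (+ 0) x (+ 2)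
  CA-at-2 x = ≡.subst (λ V → + 0 Int.≤ CA V (+ suc r) (+ 0) x (+ 2)) (≡.sym (ℤₚ.pos-* (suc (r ℕ.+ r)) r)) (sign x)
    where
    open IntegerSolver.+-*-Solver
    open Int using (_+_; _*_)
    p w : ℤ
    p = + ρ
    -- This is v - 2 - 2 r at r = ρ + 2. At r = 1 it would be -1, hence the restriction to r ≥ 2.
    w = + 4 + + 7 * p + + 2 * (p * p)
    0≤w : + 0 Int.≤ w
    0≤w = 0≤+ (0≤+ (0≤ℕ 4) (0≤* (0≤ℕ 7) (0≤ℕ ρ))) (0≤* (0≤ℕ 2) (0≤* (0≤ℕ ρ) (0≤ℕ ρ)))
    0≤v-2 : + 0 Int.≤ + 2 * (+ 2 + p) + w
    0≤v-2 = 0≤+ (0≤* (0≤ℕ 2) (0≤+ (0≤ℕ 2) (0≤ℕ ρ))) 0≤w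
    sign : ∀ x → + 0 Int.≤ CA (+ suc (r ℕ.+ r) * + r) (+ suc r) (+ 0) x (+ 2)
    sign (+ zero)  = ≡.subst (+ 0 Int.≤_) (solve 1 (λ p →
        let r = con (+ 2) :+ p ; v = (con (+ 1) :+ (r :+ r)) :* r ; x = con (+ 0) in
        con (+ 0) := x :* (x :+ con (+ 1)) :* (v :- con (+ 2))
          :- con (+ 2) :* x :* con (+ 2) :* (con (+ 1) :+ r :- con (+ 2) :+ con (+ 1))
          :+ con (+ 2) :* (con (+ 2) :- con (+ 1)) :* (con (+ 0) :- con (+ 2) :+ con (+ 2))) ≡.refl p) (0≤ℕ 0)
    sign (+ suc m) = ≡.subst (+ 0 Int.≤_) (solve 2 (λ p m →
        let r = con (+ 2) :+ p ; v = (con (+ 1) :+ (r :+ r)) :* r ; x = con (+ 1) :+ m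
            w = con (+ 4) :+ con (+ 7) :* p :+ con (+ 2) :* (p :* p) in
        x :* (m :* (con (+ 2) :* r :+ w) :+ con (+ 2) :* w)
        := x :* (x :+ con (+ 1)) :* (v :- con (+ 2))
          :- con (+ 2) :* x :* con (+ 2) :* (con (+ 1) :+ r :- con (+ 2) :+ con (+ 1))
          :+ con (+ 2) :* (con (+ 2) :- con (+ 1)) :* (con (+ 0) :- con (+ 2) :+ con (+ 2))) ≡.refl p (+ m))
      (0≤* (0≤ℕ (suc m)) (0≤+ (0≤* (0≤ℕ m) 0≤v-2) (0≤* (0≤ℕ 2) 0≤w)))
    sign -[1+ m ]  = ≡.subst (+ 0 Int.≤_) (solve 2 (λ p m →
        let r = con (+ 2) :+ p ; v = (con (+ 1) :+ (r :+ r)) :* r ; x = :- (con (+ 1) :+ m)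
            w = con (+ 4) :+ con (+ 7) :* p :+ con (+ 2) :* (p :* p) in
        (con (+ 1) :+ m) :* (m :* (con (+ 2) :* r :+ w) :+ con (+ 4) :* r)
        := x :* (x :+ con (+ 1)) :* (v :- con (+ 2))
          :- con (+ 2) :* x :* con (+ 2) :* (con (+ 1) :+ r :- con (+ 2) :+ con (+ 1))
          :+ con (+ 2) :* (con (+ 2) :- con (+ 1)) :* (con (+ 0) :- con (+ 2) :+ con (+ 2))) ≡.refl p (+ m))
      (0≤* (0≤ℕ (suc m)) (0≤+ (0≤* (0≤ℕ m) 0≤v-2) (0≤* (0≤ℕ 4) (0≤ℕ r))))

  capBound : IsCAPBound Γ 2
  -- At x = 0 only the last term 3 · 2 · (0 - 3 + 2) of the polynomial survives, so the sign is
  -- found by computation for all v and k.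
  capBound = v , suc r , 0 , edgeRegular , 3 , s≤s (s≤s z≤n) , (+ 0 , Int.-<+) , ≡.refl , least
    where
    least : ∀ t → 2 ℕ.≤ t → CAPNegative v (suc r) 0 t → 3 ℕ.≤ t
    least 0 () _
    least 1 (s≤s ()) _
    least 2 _ (x , CA<0) = contradiction (ℤₚ.≤-<-trans (CA-at-2 x) CA<0) (ℤₚ.<-irrefl ≡.refl)
    least (suc (suc (suc t))) _ _ = s≤s (s≤s (s≤s z≤n))

  module _ (ℝ : CompleteOrderedField) where
    open CompleteOrderedField ℝ hiding (zero; sum)
    open SemiringMult semiring using (×1-homo-*; ×-homo-+)
    open SemiringSum semiring
    open SetoidReasoning setoid
    open ℤSolver commutativeRing
    open FieldMatrices isField
    open OrderedField ℝ
    open AdjacencySpectrum ℝ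
    open Inverse order using (to; from; from-cong; strictlyInverseˡ; strictlyInverseʳ)

    indicator : ∀ {P : Set} → Dec P → Carrier
    indicator (yes _) = 1#
    indicator (no _)  = 0#

    indicator-yes : ∀ {P : Set} (P? : Dec P) → P → indicator P? ≈ 1#
    indicator-yes (yes _) p = refl
    indicator-yes (no ¬p) p = contradiction p ¬p

    indicator-no : ∀ {P : Set} (P? : Dec P) → ¬ P → indicator P? ≈ 0#
    indicator-no (yes p) ¬p = contradiction p ¬p
    indicator-no (no _)  ¬p = refl

    indicator-cong : ∀ {P Q : Set} (P? : Dec P) (Q? : Dec Q) → (P → Q) → (Q → P) →
                     indicator P? ≈ indicator Q?
    indicator-cong (yes p) Q? P⇒Q Q⇒P = sym (indicator-yes Q? (P⇒Q p))
    indicator-cong (no ¬p) Q? P⇒Q Q⇒P = sym (indicator-no Q? (¬p ∘ Q⇒P))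

    indicator-× : ∀ {P Q : Set} (P? : Dec P) (Q? : Dec Q) →
                  indicator P? * indicator Q? ≈ indicator (P? ×-dec Q?)
    indicator-× (yes p) (yes q) = *-identityˡ 1#
    indicator-× (yes p) (no ¬q) = *-identityˡ 0#
    indicator-× (no ¬p) Q?      = zeroˡ _

    sum-indicator : ∀ {n} {P : Fin n → Set} (P? : Unary.Decidable P) →
                    sum (λ i → indicator (P? i)) ≈ fromℕ (count P?)
    sum-indicator {zero}  P? = refl
    sum-indicator {suc n} P? with P? zero
    ... | yes _ = +-congˡ (sum-indicator (P? ∘ suc))
    ... | no  _ = trans (+-identityˡ _) (sum-indicator (P? ∘ suc))

    adjacency : Mat v
    adjacency i j = indicator (adj? (to i) (to j))

    isAdjacencyMatrix : IsAdjacencyMatrix ℝ Γ order adjacency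
    isAdjacencyMatrix i j with adj? (to i) (to j)
    ... | yes ij = inj₁ (ij , refl)
    ... | no ¬ij = inj₂ (¬ij , refl)

    adjacency-sym : Symmetric adjacency
    adjacency-sym i j = indicator-cong (adj? (to i) (to j)) (adj? (to j) (to i)) Γ.symm Γ.symm

    adjacency-diagonal : ∀ i → adjacency i i ≈ 0#
    adjacency-diagonal i = indicator-no (adj? (to i) (to i)) (Γ.irrefl (Setoid.refl Γ.vertices))

    degree : ∀ i → count (λ j → adj? (to i) (to j)) ≡ suc r
    degree i = size-unique (Finite.subsetSize order (proj₁ Γ.resp) (adj? (to i))) (regular (to i))

    adjacency-regular : ∀ i → (adjacency ·ᵥ ones) i ≈ 1# + fromℕ r
    adjacency-regular i = begin
      adjacency i · ones                           ≈⟨ sum-cong-≋ {v} (λ j → *-identityʳ (adjacency i j)) ⟩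
      sum (adjacency i)                            ≈⟨ sum-indicator (λ j → adj? (to i) (to j)) ⟩
      fromℕ (count (λ j → adj? (to i) (to j)))     ≈⟨ reflexive (≡.cong fromℕ (degree i)) ⟩
      fromℕ (suc r)                                ∎

    common? : ∀ i j → Unary.Decidable (λ l → Γ.Adj (to i) (to l) × Γ.Adj (to l) (to j))
    common? i j l = adj? (to i) (to l) ×-dec adj? (to l) (to j)

    square-count : ∀ i j → square adjacency i j ≈ fromℕ (count (common? i j))
    square-count i j = trans
      (sum-cong-≋ {v} (λ l → indicator-× (adj? (to i) (to l)) (adj? (to l) (to j))))
      (sum-indicator (common? i j))

    square-diagonal : ∀ i → square adjacency i i ≈ 1# + fromℕ r
    square-diagonal i = trans
      (sum-cong-≋ {v} (λ l → trans (indicator-× (adj? (to i) (to l)) (adj? (to l) (to i)))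
        (trans (indicator-cong (common? i i l) (adj? (to i) (to l)) proj₁ (λ il → il , Γ.symm il))
               (sym (*-identityʳ _)))))
      (adjacency-regular i)

    0≤1-fromℕ : ∀ {n} → n ℕ.≤ 1 → 0# ≤ 1# - fromℕ n
    0≤1-fromℕ {zero}        _ = 0≤-resp (solve 0 (con (+ 1) := con (+ 1) :- con (+ 0)) refl) (inj₁ 0<1)
    0≤1-fromℕ {suc zero}    _ = inj₂ (solve 0 (con (+ 0) := con (+ 1) :- (con (+ 1) :+ con (+ 0))) refl)
    0≤1-fromℕ {suc (suc n)} (s≤s ())

    remote-value : ∀ i j {d a s} → δ i j ≡ d → adjacency i j ≈ a → square adjacency i j ≈ s →
      remote (1# + fromℕ r) adjacency i j ≈ ((1# + fromℕ r * d) + - 1# * a) + - 1# * s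
    remote-value i j δ≡d a≈ s≈ = +-cong (+-cong (+-congˡ (*-cong
      (solve 1 (λ k → con (+ 1) :+ k :- con (+ 1) := k) refl (fromℕ r)) (reflexive δ≡d)))
      (*-congˡ a≈)) (*-congˡ s≈)

    -- The entry is 1 + r - (r + 1) = 0 on the diagonal and 1 - 1 - 0 = 0 on an edge, which has no
    -- common neighbours. Elsewhere it is 1 minus the number of common neighbours, of which there is
    -- at most one.
    remote-nonneg : ∀ i j → 0# ≤ remote (1# + fromℕ r) adjacency i j
    remote-nonneg i j = cases (i Finₚ.≟ j) (adj? (to i) (to j))
      where
      cases : Dec (i ≡ j) → Dec (Γ.Adj (to i) (to j)) → 0# ≤ remote (1# + fromℕ r) adjacency i j
      cases (yes ≡.refl) _ = inj₂ (sym (trans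
        (remote-value i i (δ-refl i) (adjacency-diagonal i) (square-diagonal i))
        (solve 1 (λ k → con (+ 1) :+ k :* con (+ 1) :+ :- con (+ 1) :* con (+ 0)
          :+ :- con (+ 1) :* (con (+ 1) :+ k) := con (+ 0)) refl (fromℕ r))))
      cases (no i≢j) (yes ij) = inj₂ (sym (trans
        (remote-value i j (δ-≢ i≢j) (indicator-yes (adj? (to i) (to j)) ij)
          (trans (square-count i j) (reflexive (≡.cong fromℕ (count-none (common? i j)
            (λ l (il , lj) → triangleFree ij il (Γ.symm lj)))))))
        (solve 1 (λ k → con (+ 1) :+ k :* con (+ 0) :+ :- con (+ 1) :* con (+ 1)
          :+ :- con (+ 1) :* con (+ 0) := con (+ 0)) refl (fromℕ r))))
      cases (no i≢j) (no ¬ij) = 0≤-resp (sym (trans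
        (remote-value i j (δ-≢ i≢j) (indicator-no (adj? (to i) (to j)) ¬ij) (square-count i j))
        (solve 2 (λ k s → con (+ 1) :+ k :* con (+ 0) :+ :- con (+ 1) :* con (+ 0)
          :+ :- con (+ 1) :* s := con (+ 1) :- s) refl (fromℕ r) _)))
        (0≤1-fromℕ (count≤1 (common? i j) (λ (il , lj) (im , mj) → injective (uniqueCommon
          (λ i≈j → i≢j (injective i≈j)) il (Γ.symm lj) im (Γ.symm mj)))))
        where
        injective : ∀ {i j} → to i Γ.≈ to j → i ≡ j
        injective i≈j = ≡.trans (≡.sym (strictlyInverseʳ _)) (≡.trans (from-cong i≈j) (strictlyInverseʳ _))

    ones-norm : ones {v} · ones ≈ fromℕ r * (1# + fromℕ r + fromℕ r)
    ones-norm = begin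
      ones {v} · ones                              ≈⟨ sum-cong-≋ {v} (λ _ → *-identityˡ 1#) ⟩
      sum {v} (λ _ → 1#)                           ≈⟨ sum-replicate v ⟩
      fromℕ v                                      ≈⟨ ×1-homo-* (suc (r ℕ.+ r)) r ⟩
      (1# + fromℕ (r ℕ.+ r)) * fromℕ r             ≈⟨ *-congʳ (+-congˡ (×-homo-+ 1# r r)) ⟩
      (1# + (fromℕ r + fromℕ r)) * fromℕ r
        ≈⟨ solve 1 (λ k → (con (+ 1) :+ (k :+ k)) :* k := k :* (con (+ 1) :+ k :+ k)) refl (fromℕ r) ⟩
      fromℕ r * (1# + fromℕ r + fromℕ r)           ∎

    cap<delsarte : ∃[ d ] IsDelsarteBound ℝ Γ d × fromℕ 2 < d
    cap<delsarte =
      -- Both the order and the valency reduce to successors, so a first vertex and a first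
      -- neighbour of it exist; they form the edge that `smallEigenvalue` asks for.
      let c , ac = Inverse.to (regular (to zero)) zero
          γ , γ-min , γ≉0 , 2<d = smallEigenvalue (fromℕ r) adjacency-sym (0≤fromℕ r)
            adjacency-regular ones-norm remote-nonneg {zero} {from c}
            (adjacency-diagonal zero) (adjacency-diagonal (from c))
            (indicator-yes (adj? (to zero) (to (from c)))
              (proj₁ Γ.resp (Setoid.sym Γ.vertices (strictlyInverseˡ c)) ac))
      in _ , (suc r , regular , v , order , adjacency , isAdjacencyMatrix , γ , γ-min , γ≉0 , refl) , 2<d

-- The graph of a conic

module GraphModel (Γ : Graph) (Model : Setoid 0ℓ 0ℓ) where
  private
    module Γ = Graph Γ
    module V = Setoid Γ.vertices
    module M = Setoid Model

  module _ (vertex : M.Carrier → Γ.Vertex)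
    (vertex-cong : ∀ {a b} → a M.≈ b → vertex a Γ.≈ vertex b)
    (vertex-injective : ∀ {a b} → vertex a Γ.≈ vertex b → a M.≈ b)
    (vertex-onto : ∀ x → ∃[ a ] vertex a Γ.≈ x)
    (Near : Rel M.Carrier 0ℓ)
    (near⇒adjacent : ∀ {a b} → Near a b → Γ.Adj (vertex a) (vertex b))
    (adjacent⇒near : ∀ {a b} → Γ.Adj (vertex a) (vertex b) → Near a b)
    where
    private
      adj-resp : ∀ {x x′ y y′} → x Γ.≈ x′ → y Γ.≈ y′ → Γ.Adj x y → Γ.Adj x′ y′
      adj-resp x≈ y≈ xy = proj₂ Γ.resp x≈ (proj₁ Γ.resp y≈ xy)

      code : Γ.Vertex → M.Carrier
      code x = proj₁ (vertex-onto x)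

      vertex-code : ∀ x → vertex (code x) Γ.≈ x
      vertex-code x = proj₂ (vertex-onto x)

      near-code : ∀ {x y} → Γ.Adj x y → Near (code x) (code y)
      near-code {x} {y} xy =
        adjacent⇒near (adj-resp (V.sym (vertex-code x)) (V.sym (vertex-code y)) xy)

      code-injective : ∀ {x y} → code x M.≈ code y → x Γ.≈ y
      code-injective {x} {y} eq =
        V.trans (V.sym (vertex-code x)) (V.trans (vertex-cong eq) (vertex-code y))

    neighbourhood : ∀ x → Inverse (SubSetoid Model (Near (code x))) (SubSetoid Γ.vertices (Γ.Adj x))
    neighbourhood x = bijection⇒inverse
      (λ (b , near) → vertex b , adj-resp (vertex-code x) V.refl (near⇒adjacent near))
      vertex-cong vertex-injective
      (λ (y , xy) → (code y , near-code xy) , vertex-code y)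

    -- Adjacency is decided through the model, where it becomes the decidable relation `Near`.
    triangleFreeGraph : ∀ {r} → HasSize Model (suc (r ℕ.+ r) ℕ.* r) →
      (∀ a → HasSize (SubSetoid Model (Near a)) (suc r)) → Decidable Near →
      (∀ {a b c} → Near a b → Near a c → ¬ Near b c) →
      (∀ {a b c d} → ¬ (a M.≈ b) → Near a c → Near b c → Near a d → Near b d → c M.≈ d) →
      TriangleFreeGraph Γ r
    triangleFreeGraph size degree near? no-triangle unique = record
      { order        = mapSize (bijection⇒inverse vertex vertex-cong vertex-injective vertex-onto) size
      ; regular      = λ x → mapSize (neighbourhood x) (degree (code x))
      ; adj?         = λ x y → map′
          (λ near → adj-resp (vertex-code x) (vertex-code y) (near⇒adjacent near)) near-code
          (near? (code x) (code y))
      ; triangleFree = λ ab ac bc → no-triangle (near-code ab) (near-code ac) (near-code bc)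
      ; uniqueCommon = λ a≉b ac bc ad bd → code-injective (unique (λ eq → a≉b (code-injective eq))
          (near-code ac) (near-code bc) (near-code ad) (near-code bd))
      }

Γ-triangleFree : (F : Field) {q r : ℕ} (e : HasSize (Field.setoid F) q)
  (5≈0 : Field._≈_ F (ℤSolver.fromℤ (Field.commutativeRing F) (+ 5)) (Field.0# F))
  (O : Plane.Conic F) → suc (r ℕ.+ r) ≡ q →
  HasSize (SubSetoid (Field.setoid F) (FiniteFields.NonSquare F)) r →
  TriangleFreeGraph (Plane.Γ F O) r
Γ-triangleFree F e 5≈0 O ≡.refl nonSquares =
  GraphModel.triangleFreeGraph (Plane.Γ F O) Model
    toLine (λ {a} {b} → toLine-cong {a} {b}) (λ {a} {b} → toLine-injective {a} {b}) toLine-onto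
    Near (λ {a} {b} → near⇒adjacent {a} {b}) (λ {a} {b} → adjacent⇒near {a} {b})
    (×-size e nonSquares)
    (λ a → mapSize (neighbours a) (shiftedNonSquares (proj₂ (proj₂ a)) ≡.refl))
    near? (λ {a} {b} {c} → near-no-triangle {a} {b} {c}) (λ {a} {b} {c} {d} → near-unique {a} {b} {c} {d})
  where
  open FiniteFields.Characteristic5 F e 5≈0 using (shiftedNonSquares)
  open ExternalLines F e 5≈0 O (NormalForm.coordinates F e 5≈0 O)

-- Powers of five as the infinite family

open import Data.Nat.Base using (_≤_)

¬2∣5^ : ∀ n → ¬ (2 ∣ 5 ℕ.^ n)
¬2∣5^ zero    2∣1 = contradiction (∣1⇒≡1 2∣1) λ ()
¬2∣5^ (suc n) 2∣5^ = [ from-no (2 ∣? 5) , ¬2∣5^ n ]′ (euclidsLemma 5 (5 ℕ.^ n) prime[2] 2∣5^)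

n≤5^n : ∀ n → n ≤ 5 ℕ.^ n
n≤5^n zero    = z≤n
n≤5^n (suc n) = ℕₚ.≤-trans (ℕₚ.+-mono-≤ (ℕₚ.m^n>0 5 n) (n≤5^n n))
  (ℕₚ.+-monoʳ-≤ (5 ℕ.^ n) (ℕₚ.m≤m+n (5 ℕ.^ n) _))

theorem5p5 : (ℝ : CompleteOrderedField) →
    ∀ (N : ℕ) → ∃[ q ] N ≤ q × OddPrimePower q ×
    (∀ (F : Field) → HasSize (Field.setoid F) q → (O : Plane.Conic F) →
    ∃[ c ] ∃[ d ] IsCAPBound (Plane.Γ F O) c ×
    IsDelsarteBound ℝ (Plane.Γ F O) d ×
    CompleteOrderedField._<_ ℝ (CompleteOrderedField.fromℕ ℝ c) d)
-- The exponent is a successor, as a prime power requires, which also ensures q ≥ 5.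
theorem5p5 ℝ N = 5 ℕ.^ suc N , ℕₚ.≤-trans (n≤5^n N) (ℕₚ.m≤m+n (5 ℕ.^ N) _) ,
  (¬2∣5^ (suc N) , 5 , N , from-yes (prime? 5) , ≡.refl) , λ F e O →
    let 5≈0 = FiniteFields.size5^n⇒5≈0 F e {suc N} ≡.refl
        r , _ , nonSquares , 1+r+r≡q = FiniteFields.Characteristic5.halves F e 5≈0
    in conclude r 1+r+r≡q (Γ-triangleFree F e 5≈0 O 1+r+r≡q nonSquares)
  where
  5≤q : 5 ≤ 5 ℕ.^ suc N
  5≤q = ℕₚ.*-monoʳ-≤ 5 (ℕₚ.m^n>0 5 N)

  conclude : ∀ {Γ} r → suc (r ℕ.+ r) ≡ 5 ℕ.^ suc N → TriangleFreeGraph Γ r →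
    ∃[ c ] ∃[ d ] IsCAPBound Γ c × IsDelsarteBound ℝ Γ d ×
    CompleteOrderedField._<_ ℝ (CompleteOrderedField.fromℕ ℝ c) d
  -- The values r = 0 and r = 1 mean q = 1 and q = 3, both below 5.
  conclude 0 1≡q _ = contradiction (≡.subst (5 ≤_) (≡.sym 1≡q) 5≤q) λ { (s≤s ()) }
  conclude 1 3≡q _ = contradiction (≡.subst (5 ≤_) (≡.sym 3≡q) 5≤q) λ { (s≤s (s≤s (s≤s ()))) }
  conclude (suc (suc ρ)) _ T =
    let d , delsarte , 2<d = cap<delsarte T ℝ in 2 , d , capBound T , delsarte , 2<d
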